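{- For each $\vec e\in\{\vec0,\vec\infty\}$, the $L_{\mathcal{O}}$-theory $T(\vec0,\vec e)$ has the VC $1$ property.
   Context: An oriented abelian group is an abelian group $(A,+,-,0)$ with a ternary relation $\mathcal{O}$ which is a translation-invariant cyclic order: for all $a,b,c,d$, $\mathcal{O}(a,b,c)\to\mathcal{O}(b,c,a)$; $\mathcal{O}(a,b,c)\to\neg\mathcal{O}(c,b,a)$; $\mathcal{O}(a,b,c)\wedge\mathcal{O}(a,c,d)\to\mathcal{O}(a,b,d)$; for pairwise distinct $a,b,c$, $\mathcal{O}(a,b,c)\vee\mathcal{O}(c,b,a)$; $\mathcal{O}(a,b,c)\to\mathcal{O}(a+d,b+d,c+d)$. Write $x<_0y$ for $x\neq y\wedge\mathcal{O}(0,x,y)$. $A$ is regularly dense if for each prime $p$ and all $a,b$ with $\mathcal{O}(0,a,b)$ there is $c$ with $\mathcal{O}(a,pc,b)$ and $ic<_0(i+1)c$ for $i=1,\dots,p-1$. For a prime $p$, $[p]A=|A/pA|$, $\operatorname{Tor}_n(A)=\{a:na=0\}$, and $e(A,p)$ is the least $e\in\mathbb{N}$ with $\operatorname{Tor}_{p^{e+k}}(A)=\operatorname{Tor}_{p^e}(A)$ for all $k$ (where $\operatorname{Tor}_{p^0}(A)=\{0\}$), or $\infty$ if none exists. For sequences $\vec d,\vec e$ indexed by primes $p_i$ with values in $\mathbb{N}\cup\{\infty\}$, $T(\vec d,\vec e)$ is the theory in $L_{\mathcal{O}}=\{+,-,0,\mathcal{O}\}$ whose models are regularly dense oriented abelian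 groups with $[p_i]A=p_i^{d_i}$ and $e(A,p_i)=e_i$; $\vec0,\vec\infty$ are constant sequences. UDTFS: a finite set $\Delta(x;\vec y)$ of formulas in a single object variable $x$ and parameter variables $\vec y$ has uniform definability of types over finite sets (UDTFS) with $d$ parameters in a model $M$ if there are finitely many families $(\psi^i_\varphi(\vec y;\vec y_1,\dots,\vec y_d))_{\varphi\in\Delta}$, $i\in I$, of formulas such that for every finite $B\subseteq M^{|\vec y|}$ with $|B|\ge2$ and every complete $\Delta$-type $q$ in $x$ over $B$ there are $\vec b_1,\dots,\vec b_d\in B$ and $i\in I$ with: for all $\varphi\in\Delta$ and $\vec b\in B$, $\varphi(x;\vec b)\in q$ iff $M\models\psi^i_\varphi(\vec b;\vec b_1,\dots,\vec b_d)$. A complete theory has the VC $d$ property if every finite set of partitioned formulas in a single object variable has UDTFS with $d$ parameters. -}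

module Defs where

open import Level using (0ℓ)
open import Data.Nat as ℕ using (ℕ; zero; suc; _≤_; _<_; _^_)
open import Data.Nat.Primality using (Prime)
open import Data.Fin using (Fin)
open import Data.Vec as Vec using (Vec)
open import Data.List as List using (List; []; _∷_; _++_)
open import Data.List.Membership.Propositional using (_∈_)
open import Data.Product using (Σ; ∃; ∃₂; _×_; _,_)
open import Data.Empty using (⊥)
open import Data.Sum using (_⊎_)
open import Relation.Nullary using (¬_)
open import Relation.Binary.PropositionalEquality using (_≡_; _≢_)
open import Function.Bundles using (_⇔_)

record OrientedAbelianGroup : Set₁ where
  infixl 6 _⊕_
  field
    Carrier : Set
    _⊕_     : Carrier → Carrier → Carrier
    ⊖_      : Carrier → Carrier
    𝟘       : Carrier
    O       : Carrier → Carrier → Carrier → Set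
    ⊕-assoc     : ∀ a b c → (a ⊕ b) ⊕ c ≡ a ⊕ (b ⊕ c)
    ⊕-comm      : ∀ a b → a ⊕ b ≡ b ⊕ a
    ⊕-identityˡ : ∀ a → 𝟘 ⊕ a ≡ a
    ⊖-inverseˡ  : ∀ a → (⊖ a) ⊕ a ≡ 𝟘
    O-cyclic : ∀ {a b c} → O a b c → O b c a
    O-asym   : ∀ {a b c} → O a b c → ¬ O c b a
    O-trans  : ∀ {a b c d} → O a b c → O a c d → O a b d
    O-total  : ∀ {a b c} → a ≢ b → b ≢ c → a ≢ c → O a b c ⊎ O c b a
    O-transl : ∀ {a b c} d → O a b c → O (a ⊕ d) (b ⊕ d) (c ⊕ d)

module _ (G : OrientedAbelianGroup) where
  open OrientedAbelianGroup G

  infixr 7 _·_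
  _·_ : ℕ → Carrier → Carrier
  zero  · a = 𝟘
  suc n · a = a ⊕ (n · a)

  _<₀_ : Carrier → Carrier → Set
  x <₀ y = x ≢ y × O 𝟘 x y

  RegularlyDense : Set
  RegularlyDense =
    ∀ p → Prime p → ∀ a b → O 𝟘 a b →
      ∃ λ c → O a (p · c) b × (∀ i → 1 ≤ i → i < p → (i · c) <₀ (suc i · c))

  -- |A / pA| = n : there are n representatives f 0 … f (n-1) such that every
  -- element is congruent mod pA to exactly one of them.
  QuotientSize : ℕ → ℕ → Set
  QuotientSize p n =
    Σ (Fin n → Carrier) λ f →
      (∀ a → ∃₂ λ j c → a ≡ f j ⊕ (p · c)) ×
      (∀ j j' c → f j ≡ f j' ⊕ (p · c) → j ≡ j')

  -- Tor_{p^{e+k}}(A) = Tor_{p^e}(A) for all k (the inclusion ⊇ is automatic)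
  TorStable : ℕ → ℕ → Set
  TorStable p e = ∀ k a → (p ^ (e ℕ.+ k)) · a ≡ 𝟘 → (p ^ e) · a ≡ 𝟘

data ℕ∞ : Set where
  fin : ℕ → ℕ∞
  ∞   : ℕ∞

module _ (G : OrientedAbelianGroup) where

  IndexIs : ℕ → ℕ∞ → Set
  IndexIs p (fin d) = QuotientSize G p (p ^ d)
  IndexIs p ∞       = ∀ n → ¬ QuotientSize G p n

  ExponentIs : ℕ → ℕ∞ → Set
  ExponentIs p (fin e) = TorStable G p e × (∀ e' → TorStable G p e' → e ≤ e')
  ExponentIs p ∞       = ∀ e → ¬ TorStable G p e

-- sequences indexed by primes: represented as functions on ℕ, only
-- consulted at primes
Seq : Set
Seq = ℕ → ℕ∞

vec0 : Seq
vec0 = λ _ → fin 0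

vec∞ : Seq
vec∞ = λ _ → ∞

ModelOfT : Seq → Seq → OrientedAbelianGroup → Set
ModelOfT d e G =
  RegularlyDense G × (∀ p → Prime p → IndexIs G p (d p) × ExponentIs G p (e p))

data Term : Set where
  var  : ℕ → Term
  zer  : Term
  _+ᵗ_ : Term → Term → Term
  negᵗ : Term → Term

data Formula : Set where
  _≐_  : Term → Term → Formula
  ord  : Term → Term → Term → Formula
  ⊥ᶠ   : Formula
  ¬ᶠ   : Formula → Formula
  _∧ᶠ_ : Formula → Formula → Formula
  _∨ᶠ_ : Formula → Formula → Formula
  _⇒ᶠ_ : Formula → Formula → Formula
  ∀ᶠ   : ℕ → Formula → Formula
  ∃ᶠ   : ℕ → Formula → Formula

module Semantics (G : OrientedAbelianGroup) where
  open OrientedAbelianGroup G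

  Env : Set
  Env = ℕ → Carrier

  _[_↦_] : Env → ℕ → Carrier → Env
  (ρ [ n ↦ a ]) m with n ℕ.≟ m
  ... | Relation.Nullary.yes _ = a
  ... | Relation.Nullary.no  _ = ρ m

  ⟦_⟧ᵗ : Term → Env → Carrier
  ⟦ var n ⟧ᵗ ρ    = ρ n
  ⟦ zer ⟧ᵗ ρ      = 𝟘
  ⟦ s +ᵗ t ⟧ᵗ ρ   = ⟦ s ⟧ᵗ ρ ⊕ ⟦ t ⟧ᵗ ρ
  ⟦ negᵗ t ⟧ᵗ ρ   = ⊖ ⟦ t ⟧ᵗ ρ

  ⟦_⟧ : Formula → Env → Set
  ⟦ s ≐ t ⟧ ρ     = ⟦ s ⟧ᵗ ρ ≡ ⟦ t ⟧ᵗ ρ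
  ⟦ ord s t u ⟧ ρ = O (⟦ s ⟧ᵗ ρ) (⟦ t ⟧ᵗ ρ) (⟦ u ⟧ᵗ ρ)
  ⟦ ⊥ᶠ ⟧ ρ        = ⊥
  ⟦ ¬ᶠ φ ⟧ ρ      = ¬ ⟦ φ ⟧ ρ
  ⟦ φ ∧ᶠ ψ ⟧ ρ    = ⟦ φ ⟧ ρ × ⟦ ψ ⟧ ρ
  ⟦ φ ∨ᶠ ψ ⟧ ρ    = ⟦ φ ⟧ ρ ⊎ ⟦ ψ ⟧ ρ
  ⟦ φ ⇒ᶠ ψ ⟧ ρ    = ⟦ φ ⟧ ρ → ⟦ ψ ⟧ ρ
  ⟦ ∀ᶠ n φ ⟧ ρ    = (a : Carrier) → ⟦ φ ⟧ (ρ [ n ↦ a ])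
  ⟦ ∃ᶠ n φ ⟧ ρ    = Σ Carrier λ a → ⟦ φ ⟧ (ρ [ n ↦ a ])

  envOf : List Carrier → Env
  envOf []      _       = 𝟘
  envOf (a ∷ l) zero    = a
  envOf (a ∷ l) (suc n) = envOf l n

  AtLeastTwo : ∀ {m} → List (Vec Carrier m) → Set
  AtLeastTwo B = ∃₂ λ b b' → b ∈ B × b' ∈ B × b ≢ b'

  -- Δ(x; ȳ) = (φ_0,…,φ_{k-1}) with |ȳ| = m: in φ_l the variable 0 is x and
  -- variables 1..m are ȳ.  A family ψ^i = (ψ^i_φ)_{φ∈Δ} of formulas
  -- ψ^i_φ(ȳ; ȳ_1,…,ȳ_d): variables 0..m-1 are ȳ, then ȳ_1, …, ȳ_d in blocks
  -- of m.  Complete Δ-types over finite B are the types tp_Δ(a/B), a ∈ M.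
  UDTFS : (m k : ℕ) → Vec Formula k → ℕ → Set
  UDTFS m k Δ d =
    Σ ℕ λ n → Σ (Fin n → Fin k → Formula) λ ψ →
      ∀ (B : List (Vec Carrier m)) → AtLeastTwo B → (a : Carrier) →
        Σ (Fin d → Vec Carrier m) λ bs → (∀ j → bs j ∈ B) ×
          Σ (Fin n) λ i →
            ∀ (l : Fin k) (b : Vec Carrier m) → b ∈ B →
              (⟦ Vec.lookup Δ l ⟧ (envOf (a ∷ Vec.toList b))
                ⇔ ⟦ ψ i l ⟧ (envOf (Vec.toList b ++
                                     List.concatMap (λ j → Vec.toList (bs j)) (List.allFin d))))

VCProperty : Seq → Seq → ℕ → Set₁
VCProperty d e d' =
  ∀ (G : OrientedAbelianGroup) → ModelOfT d e G →
    ∀ (m k : ℕ) (Δ : Vec Formula k) → Semantics.UDTFS G m k Δ d'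

module Submission where

-- A is the quotient of an ordered abelian group U, its universal cover, by a cofinal cyclic
-- subgroup ℤ𝟙.  Regular density and A = pA say that n U is dense in U and that U = n U + ℤ𝟙 for all
-- n ≥ 1.  By a back-and-forth argument the truth of a formula at a tuple of A only depends on the signs
-- of finitely many integral linear forms in 𝟙 and the lifts to [0, 𝟙), and on the residues of these
-- lifts modulo some M U.  After the substitution x = M z the residue of x is determined by the integer
-- part of M z, so {z : φ(M z; b)} is a union of atoms of boundedly many initial segments of the order of
-- A cut at 𝟘, and these segments can be chosen definable over b.  Given B and a = M z, take the largest
-- of the segments over parameters in B that avoids z, say with parameter b₁: then φ(a; b) holds iff
-- φ(M x; b) holds for all x immediately above that segment.

open import Defs
open import Level using (0ℓ)
open import Axiom.ExcludedMiddle using (ExcludedMiddle)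
open import Axiom.DoubleNegationElimination using (DoubleNegationElimination; em⇒dne)
open import Algebra.Bundles using (AbelianGroup)
open import Algebra.Structures using (IsAbelianGroup)
import Algebra.Properties.AbelianGroup
import Algebra.Properties.CommutativeMonoid.Mult
import Algebra.Properties.CommutativeSemigroup
open import Data.Bool using (Bool; true; false)
open import Data.Empty using (⊥)
open import Data.Fin as Fin using (Fin; zero; suc)
import Data.Fin.Properties as Fin
open import Data.Integer as ℤ using (ℤ; +_; -[1+_]; 0ℤ; 1ℤ; -1ℤ; ∣_∣)
import Data.Integer.Properties as ℤ
open import Data.Integer.Tactic.RingSolver using (solve-∀)
open import Data.List as List using (List; []; _∷_; _++_)
open import Data.List.Membership.Propositional using (_∈_)
open import Data.List.Membership.Propositional.Properties
  using (∈-map⁺; ∈-map⁻; ∈-++⁺ˡ; ∈-++⁺ʳ; ∈-++⁻; ∈-upTo⁺; ∈-upTo⁻; ∈-allFin; ∈-cartesianProduct⁺;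
         ∈-cartesianProduct⁻; ∈-cartesianProductWith⁺; ∈-cartesianProductWith⁻)
open import Data.List.Relation.Unary.All using (All; []; _∷_)
open import Data.List.Relation.Unary.Any as Any using (here; there)
import Data.List.Relation.Unary.Any.Properties as Any
open import Data.Nat as ℕ using (ℕ; zero; suc; _!)
open import Data.Nat.Divisibility as ℕ using (_∣_; divides; m∣m*n; m≤n⇒m!∣n!)
open import Data.Nat.ListAction using (product)
open import Data.Nat.Primality using (Prime; prime⇒nonZero; prime[2])
open import Data.Nat.Primality.Factorisation using (PrimeFactorisation; factorise)
import Data.Nat.Properties as ℕ
open import Data.Product using (∃; ∃₂; _×_; _,_; proj₁; proj₂)
open import Data.Sum as Sum using (_⊎_; inj₁; inj₂)
open import Data.Vec as Vec using (Vec; []; _∷_)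
open import Data.Vec.Relation.Unary.All as VecAll using ([]; _∷_)
import Data.Vec.Relation.Unary.All.Properties as VecAll
open import Function using (id; it)
open import Function.Bundles using (_⇔_; mk⇔; Equivalence)
open import Relation.Binary.PropositionalEquality as ≡ using (_≡_; _≢_)
import Relation.Binary.Reasoning.Setoid
open import Relation.Nullary using (¬_; Dec; yes; no; contradiction)

-- Two obstacles shape the proof. Comparing two terms of A depends on how often their sums pass 𝟘.
-- In the cover each such turn is a multiple of 𝟙, so 𝟙 becomes a coordinate of every tuple and a
-- term becomes a linear form with bounded coefficients, one of finitely many. The second obstacle
-- is that the cuts described by these forms live in the cover, and their ends need not be values of
-- terms over b. The segments that enter the final formulas are therefore rebuilt from the formula
-- itself, as successive runs on which φ(M x; b) keeps its truth value; the segments given by the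
-- forms only bound the number of runs, independently of b. One parameter suffices because the
-- segments over all tuples of B are initial in the same linear order, hence nested: the largest one
-- avoiding z leaves no room for another to separate z from the points just above it.

-- Integral linear forms over an abelian group

infixl 6 _+ᵛ_
_+ᵛ_ : ∀ {n} → Vec ℤ n → Vec ℤ n → Vec ℤ n
_+ᵛ_ = Vec.zipWith ℤ._+_

-ᵛ_ : ∀ {n} → Vec ℤ n → Vec ℤ n
-ᵛ_ = Vec.map (λ k → ℤ.- k)

infixr 7 _*ᵛ_
_*ᵛ_ : ∀ {n} → ℤ → Vec ℤ n → Vec ℤ n
k *ᵛ m = Vec.map (k ℤ.*_) m

0ᵛ : ∀ {n} → Vec ℤ n
0ᵛ = Vec.replicate _ 0ℤ

unit : ∀ {n} → Fin n → Vec ℤ n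
unit zero = 1ℤ ∷ 0ᵛ
unit (suc i) = 0ℤ ∷ unit i

module LinearForms (A : AbelianGroup 0ℓ 0ℓ) where
  open AbelianGroup A
    renaming (Carrier to X; _∙_ to infixl 6 _+_; ε to 0#; _⁻¹ to infix 8 -_; ∙-cong to +-cong; ∙-congˡ to +-congˡ;
              ∙-congʳ to +-congʳ; assoc to +-assoc; comm to +-comm; identityˡ to +-identityˡ;
              identityʳ to +-identityʳ; ⁻¹-cong to neg-cong; inverseˡ to neg-inverseˡ; inverseʳ to neg-inverseʳ)
    using (setoid; _≈_; refl; sym; trans; commutativeMonoid; commutativeSemigroup; reflexive)
  open Algebra.Properties.AbelianGroup A
    using ()
    renaming (⁻¹-∙-comm to neg-+; ε⁻¹≈ε to neg-0; ⁻¹-involutive to neg-neg)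
  open Algebra.Properties.CommutativeMonoid.Mult commutativeMonoid
    using (×-congʳ; ×-distrib-+) renaming (_×_ to _⊠_)
  open Algebra.Properties.CommutativeSemigroup commutativeSemigroup using (interchange)
  open Relation.Binary.Reasoning.Setoid setoid

  infixr 7 _•_
  _•_ : ℤ → X → X
  (+ n)    • x = n ⊠ x
  -[1+ n ] • x = - (suc n ⊠ x)

  suc-• : ∀ k x → ℤ.suc k • x ≈ x + k • x
  suc-• (+ n) x = refl
  suc-• -[1+ zero ] x = begin
    0#               ≈⟨ neg-inverseʳ x ⟨
    x + - x          ≈⟨ +-congˡ (neg-cong (+-identityʳ x)) ⟨
    x + - (x + 0#)   ∎
  suc-• -[1+ suc n ] x = begin
    - y                  ≈⟨ +-identityˡ _ ⟨
    0# + - y             ≈⟨ +-congʳ (neg-inverseʳ x) ⟨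
    (x + - x) + - y      ≈⟨ +-assoc _ _ _ ⟩
    x + (- x + - y)      ≈⟨ +-congˡ (neg-+ x y) ⟩
    x + - (x + y)        ∎
    where y = suc n ⊠ x

  pred-• : ∀ k x → ℤ.pred k • x ≈ - x + k • x
  pred-• k x = begin
    ℤ.pred k • x                   ≈⟨ +-identityˡ _ ⟨
    0# + ℤ.pred k • x              ≈⟨ +-congʳ (neg-inverseˡ x) ⟨
    (- x + x) + ℤ.pred k • x       ≈⟨ +-assoc _ _ _ ⟩
    - x + (x + ℤ.pred k • x)       ≈⟨ +-congˡ (suc-• (ℤ.pred k) x) ⟨
    - x + ℤ.suc (ℤ.pred k) • x     ≡⟨ ≡.cong (λ j → - x + j • x) (ℤ.suc-pred k) ⟩
    - x + k • x                    ∎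

  +-• : ∀ j k x → (j ℤ.+ k) • x ≈ j • x + k • x
  +-• (+ zero) k x = begin
    (0ℤ ℤ.+ k) • x ≡⟨ ≡.cong (_• x) (ℤ.+-identityˡ k) ⟩
    k • x          ≈⟨ +-identityˡ _ ⟨
    0# + k • x     ∎
  +-• (+ suc n) k x = begin
    (+ suc n ℤ.+ k) • x     ≡⟨ ≡.cong (_• x) (ℤ.+-assoc 1ℤ (+ n) k) ⟩
    ℤ.suc (+ n ℤ.+ k) • x   ≈⟨ suc-• (+ n ℤ.+ k) x ⟩
    x + (+ n ℤ.+ k) • x     ≈⟨ +-congˡ (+-• (+ n) k x) ⟩
    x + (n ⊠ x + k • x)     ≈⟨ +-assoc _ _ _ ⟨
    (x + n ⊠ x) + k • x     ∎
  +-• -[1+ zero ] k x = begin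
    ℤ.pred k • x          ≈⟨ pred-• k x ⟩
    - x + k • x           ≈⟨ +-congʳ (neg-cong (+-identityʳ x)) ⟨
    - (x + 0#) + k • x    ∎
  +-• -[1+ suc n ] k x = begin
    (-[1+ suc n ] ℤ.+ k) • x      ≡⟨ ≡.cong (_• x) (ℤ.+-assoc -1ℤ -[1+ n ] k) ⟩
    ℤ.pred (-[1+ n ] ℤ.+ k) • x   ≈⟨ pred-• (-[1+ n ] ℤ.+ k) x ⟩
    - x + (-[1+ n ] ℤ.+ k) • x    ≈⟨ +-congˡ (+-• -[1+ n ] k x) ⟩
    - x + (- y + k • x)           ≈⟨ +-assoc _ _ _ ⟨
    (- x + - y) + k • x           ≈⟨ +-congʳ (neg-+ x y) ⟩
    - (x + y) + k • x             ∎
    where y = suc n ⊠ x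

  neg-• : ∀ k x → (ℤ.- k) • x ≈ - (k • x)
  neg-• (+ zero) x = sym neg-0
  neg-• (+ suc n) x = refl
  neg-• -[1+ n ] x = sym (neg-neg _)

  •-cong : ∀ k {x y} → x ≈ y → k • x ≈ k • y
  •-cong (+ n) e = ×-congʳ n e
  •-cong -[1+ n ] e = neg-cong (×-congʳ (suc n) e)

  •-+ : ∀ k x y → k • (x + y) ≈ k • x + k • y
  •-+ (+ n) x y = ×-distrib-+ x y n
  •-+ -[1+ n ] x y = trans (neg-cong (×-distrib-+ x y (suc n))) (sym (neg-+ _ _))

  •-0 : ∀ k → k • 0# ≈ 0#
  •-0 (+ n) = ×-zeroʳ n
    where
    ×-zeroʳ : ∀ n → n ⊠ 0# ≈ 0#
    ×-zeroʳ zero = refl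
    ×-zeroʳ (suc n) = trans (+-identityˡ _) (×-zeroʳ n)
  •-0 k@(-[1+ n ]) = trans (neg-cong (•-0 (+ suc n))) neg-0

  1-• : ∀ x → 1ℤ • x ≈ x
  1-• = +-identityʳ

  neg-unique : ∀ x y → x + y ≈ 0# → x ≈ - y
  neg-unique x y e = begin
    x               ≈⟨ +-identityʳ x ⟨
    x + 0#          ≈⟨ +-congˡ (neg-inverseʳ y) ⟨
    x + (y + - y)   ≈⟨ +-assoc _ _ _ ⟨
    (x + y) + - y   ≈⟨ +-congʳ e ⟩
    0# + - y        ≈⟨ +-identityˡ _ ⟩
    - y             ∎

  •-neg : ∀ k x → k • (- x) ≈ - (k • x)
  •-neg k x = neg-unique _ _ (trans (sym (•-+ k (- x) x)) (trans (•-cong k (neg-inverseˡ x)) (•-0 k)))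

  *-• : ∀ j k x → (j ℤ.* k) • x ≈ j • (k • x)
  *-• (+ n) k x = ×-• n
    where
    ×-• : ∀ n → (+ n ℤ.* k) • x ≈ n ⊠ (k • x)
    ×-• zero = reflexive (≡.cong (_• x) (ℤ.*-zeroˡ k))
    ×-• (suc n) = begin
      (+ suc n ℤ.* k) • x              ≡⟨ ≡.cong (_• x) (ℤ.suc-* (+ n) k) ⟩
      (k ℤ.+ + n ℤ.* k) • x            ≈⟨ +-• k (+ n ℤ.* k) x ⟩
      k • x + (+ n ℤ.* k) • x          ≈⟨ +-congˡ (×-• n) ⟩
      k • x + n ⊠ (k • x)              ∎
  *-• j@(-[1+ n ]) k x = begin
    (j ℤ.* k) • x                    ≡⟨ ≡.cong (_• x) (ℤ.neg-distribˡ-* (+ suc n) k) ⟨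
    (ℤ.- (+ suc n ℤ.* k)) • x        ≈⟨ neg-• (+ suc n ℤ.* k) x ⟩
    - ((+ suc n ℤ.* k) • x)          ≈⟨ neg-cong (*-• (+ suc n) k x) ⟩
    - (suc n ⊠ (k • x))              ∎

  eval : ∀ {n} → Vec ℤ n → (ℕ → X) → X
  eval [] ρ = 0#
  eval (m ∷ ms) ρ = m • ρ 0 + eval ms (λ i → ρ (suc i))

  eval-+ : ∀ {n} (m m' : Vec ℤ n) ρ → eval (m +ᵛ m') ρ ≈ eval m ρ + eval m' ρ
  eval-+ [] [] ρ = sym (+-identityˡ 0#)
  eval-+ (k ∷ m) (k' ∷ m') ρ =
    trans (+-cong (+-• k k' (ρ 0)) (eval-+ m m' _)) (interchange _ _ _ _)

  eval-neg : ∀ {n} (m : Vec ℤ n) ρ → eval (-ᵛ m) ρ ≈ - eval m ρ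
  eval-neg [] ρ = sym neg-0
  eval-neg (k ∷ m) ρ = trans (+-cong (neg-• k (ρ 0)) (eval-neg m _)) (neg-+ _ _)

  eval-* : ∀ {n} k (m : Vec ℤ n) ρ → eval (k *ᵛ m) ρ ≈ k • eval m ρ
  eval-* k [] ρ = sym (•-0 k)
  eval-* k (j ∷ m) ρ = trans (+-cong (*-• k j (ρ 0)) (eval-* k m _)) (sym (•-+ k _ _))

  eval-0 : ∀ n ρ → eval (0ᵛ {n}) ρ ≈ 0#
  eval-0 zero ρ = refl
  eval-0 (suc n) ρ = trans (+-identityˡ _) (eval-0 n _)

  eval-unit : ∀ {n} (i : Fin n) ρ → eval (unit i) ρ ≈ ρ (Fin.toℕ i)
  eval-unit {suc n} zero ρ = trans (+-cong (1-• (ρ 0)) (eval-0 n _)) (+-identityʳ _)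
  eval-unit (suc i) ρ = trans (+-identityˡ _) (eval-unit i _)

  eval-cong : ∀ {n} (m : Vec ℤ n) {ρ ρ'} → (∀ i → ρ i ≈ ρ' i) → eval m ρ ≈ eval m ρ'
  eval-cong [] e = refl
  eval-cong (k ∷ m) e = +-cong (•-cong k (e 0)) (eval-cong m (λ i → e (suc i)))

  -- Separates the one coordinate in which `ρ'` may differ from `ρ`; the erased vector does not see
  -- it and can be evaluated at the old tuple.
  eval-update : ∀ {n} (m : Vec ℤ n) (i : Fin n) {ρ ρ'} → (∀ j → Fin.toℕ i ≡.≢ j → ρ' j ≈ ρ j) →
    eval m ρ' ≈ Vec.lookup m i • ρ' (Fin.toℕ i) + eval (m Vec.[ i ]≔ 0ℤ) ρ
  eval-update (k ∷ m) zero {ρ} e =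
    +-congˡ (trans (eval-cong m (λ j → e (suc j) λ ())) (sym (+-identityˡ _)))
  eval-update (k ∷ m) (suc i) {ρ} {ρ'} e = begin
    k • ρ' 0 + eval m (λ j → ρ' (suc j))
      ≈⟨ +-cong (•-cong k (e 0 λ ())) (eval-update m i (λ j ne → e (suc j) (λ p → ne (ℕ.suc-injective p)))) ⟩
    k • ρ 0 + (a + b)    ≈⟨ +-assoc _ _ _ ⟨
    (k • ρ 0 + a) + b    ≈⟨ +-congʳ (+-comm _ _) ⟩
    (a + k • ρ 0) + b    ≈⟨ +-assoc _ _ _ ⟩
    a + (k • ρ 0 + b)    ∎
    where a = Vec.lookup m i • ρ' (suc (Fin.toℕ i))
          b = eval (m Vec.[ i ]≔ 0ℤ) (λ j → ρ (suc j))

  infixl 6 _⊞_ _⊟_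
  infix 8 ⊟_
  data Expr (n : ℕ) : Set where
    var : Fin n → Expr n
    zer : Expr n
    _⊞_ : Expr n → Expr n → Expr n
    ⊟_  : Expr n → Expr n

  _⊟_ : ∀ {n} → Expr n → Expr n → Expr n
  x ⊟ y = x ⊞ ⊟ y

  v0 : ∀ {n} → Expr (suc n)
  v0 = var zero
  v1 : ∀ {n} → Expr (suc (suc n))
  v1 = var (suc zero)
  v2 : ∀ {n} → Expr (suc (suc (suc n)))
  v2 = var (suc (suc zero))
  v3 : ∀ {n} → Expr (suc (suc (suc (suc n))))
  v3 = var (suc (suc (suc zero)))
  v4 : ∀ {n} → Expr (suc (suc (suc (suc (suc n)))))
  v4 = var (suc (suc (suc (suc zero))))

  ⟦_⟧ᵉ : ∀ {n} → Expr n → (ℕ → X) → X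
  ⟦ var i ⟧ᵉ ρ = ρ (Fin.toℕ i)
  ⟦ zer ⟧ᵉ ρ = 0#
  ⟦ s ⊞ t ⟧ᵉ ρ = ⟦ s ⟧ᵉ ρ + ⟦ t ⟧ᵉ ρ
  ⟦ ⊟ s ⟧ᵉ ρ = - ⟦ s ⟧ᵉ ρ

  normal : ∀ {n} → Expr n → Vec ℤ n
  normal (var i) = unit i
  normal zer = 0ᵛ
  normal (s ⊞ t) = normal s +ᵛ normal t
  normal (⊟ s) = -ᵛ normal s

  normal-correct : ∀ {n} (s : Expr n) ρ → eval (normal s) ρ ≈ ⟦ s ⟧ᵉ ρ
  normal-correct (var i) ρ = eval-unit i ρ
  normal-correct {n} zer ρ = eval-0 n ρ
  normal-correct (s ⊞ t) ρ =
    trans (eval-+ (normal s) (normal t) ρ) (+-cong (normal-correct s ρ) (normal-correct t ρ))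
  normal-correct (⊟ s) ρ = trans (eval-neg (normal s) ρ) (neg-cong (normal-correct s ρ))

  at : ∀ {n} → Vec X n → ℕ → X
  at [] i = 0#
  at (x ∷ xs) zero = x
  at (x ∷ xs) (suc i) = at xs i

  abstract
    -- An identity of abelian groups holds once both sides have the same integral coefficient
    -- vector, which `refl` checks by computation. Opaque subterms such as `+ n • x` enter as
    -- entries of `xs`.
    solve : ∀ {n} (xs : Vec X n) (s t : Expr n) → normal s ≡ normal t → ⟦ s ⟧ᵉ (at xs) ≈ ⟦ t ⟧ᵉ (at xs)
    solve xs s t e = begin
      ⟦ s ⟧ᵉ (at xs)           ≈⟨ normal-correct s (at xs) ⟨
      eval (normal s) (at xs)  ≡⟨ ≡.cong (λ m → eval m (at xs)) e ⟩
      eval (normal t) (at xs)  ≈⟨ normal-correct t (at xs) ⟩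
      ⟦ t ⟧ᵉ (at xs)           ∎

open import Relation.Binary.PropositionalEquality
  using (refl; sym; trans; cong; cong₂; subst; subst₂; isEquivalence; module ≡-Reasoning)

-- Ordered abelian groups and signs

-- The order is given by its cone, so that every comparison is the sign of a single element.
record OrderedGroup : Set₁ where
  infixl 6 _+_
  infix 8 -_
  field
    Carrier : Set
    _+_ : Carrier → Carrier → Carrier
    0# : Carrier
    -_ : Carrier → Carrier
    isAbelianGroup : IsAbelianGroup _≡_ _+_ 0# -_
    NonNeg : Carrier → Set
    nonNeg-+ : ∀ {x y} → NonNeg x → NonNeg y → NonNeg (x + y)
    nonNeg-antisym : ∀ {x} → NonNeg x → NonNeg (- x) → x ≡ 0#
    nonNeg-total : ∀ x → NonNeg x ⊎ NonNeg (- x)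

  abelianGroup : AbelianGroup 0ℓ 0ℓ
  abelianGroup = record { isAbelianGroup = isAbelianGroup }

module OrderedGroupProperties (U : OrderedGroup) (em : ExcludedMiddle 0ℓ) where
  open OrderedGroup U
  open LinearForms abelianGroup public

  dne : DoubleNegationElimination 0ℓ
  dne = em⇒dne em

  Pos : Carrier → Set
  Pos x = ¬ NonNeg (- x)

  nonNeg-resp : ∀ {x y} → x ≡ y → NonNeg x → NonNeg y
  nonNeg-resp = subst NonNeg

  pos-resp : ∀ {x y} → x ≡ y → Pos x → Pos y
  pos-resp = subst Pos

  nonNeg-0 : NonNeg 0#
  nonNeg-0 with nonNeg-total 0#
  ... | inj₁ p = p
  ... | inj₂ p = nonNeg-resp (solve [] (⊟ zer) zer refl) p

  pos⇒nonNeg : ∀ {x} → Pos x → NonNeg x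
  pos⇒nonNeg {x} p with nonNeg-total x
  ... | inj₁ q = q
  ... | inj₂ q = contradiction q p

  ¬nonNeg⇒pos : ∀ {x} → ¬ NonNeg x → Pos (- x)
  ¬nonNeg⇒pos {x} p q = p (nonNeg-resp (solve (x ∷ []) (⊟ (⊟ v0)) v0 refl) q)

  ¬pos⇒nonNeg : ∀ {x} → ¬ Pos x → NonNeg (- x)
  ¬pos⇒nonNeg = dne

  pos-+ʳ : ∀ {x y} → Pos x → NonNeg y → Pos (x + y)
  pos-+ʳ {x} {y} p q r = p (nonNeg-resp (solve (x ∷ y ∷ []) (⊟ (v0 ⊞ v1) ⊞ v1) (⊟ v0) refl) (nonNeg-+ r q))

  pos-+ : ∀ {x y} → Pos x → Pos y → Pos (x + y)
  pos-+ p q = pos-+ʳ p (pos⇒nonNeg q)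

  ¬pos-0 : ¬ Pos 0#
  ¬pos-0 p = p (nonNeg-resp (solve [] zer (⊟ zer) refl) nonNeg-0)

  pos⇒≢0 : ∀ {x} → Pos x → x ≢ 0#
  pos⇒≢0 p refl = ¬pos-0 p

  nonNeg∧≢0⇒pos : ∀ {x} → NonNeg x → x ≢ 0# → Pos x
  nonNeg∧≢0⇒pos p ne q = ne (nonNeg-antisym p q)

  nonNeg-• : ∀ n {x} → NonNeg x → NonNeg (+ n • x)
  nonNeg-• zero p = nonNeg-0
  nonNeg-• (suc n) p = nonNeg-+ p (nonNeg-• n p)

  pos-• : ∀ n .{{_ : ℕ.NonZero n}} {x} → Pos x → Pos (+ n • x)
  pos-• (suc n) p = pos-+ʳ p (nonNeg-• n (pos⇒nonNeg p))

  nonNeg-•⁻¹ : ∀ n .{{_ : ℕ.NonZero n}} {x} → NonNeg (+ n • x) → NonNeg x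
  nonNeg-•⁻¹ n {x} p = dne λ q → pos-• n (¬nonNeg⇒pos q)
    (nonNeg-resp (sym (trans (cong -_ (•-neg (+ n) x)) (solve ((+ n • x) ∷ []) (⊟ (⊟ v0)) v0 refl))) p)

  pos-•⁻¹ : ∀ n .{{_ : ℕ.NonZero n}} {x} → Pos (+ n • x) → Pos x
  pos-•⁻¹ n {x} p q = p (nonNeg-resp (•-neg (+ n) x) (nonNeg-• n q))

  -- The two equivalences separate all three signs, since vanishing is the conjunction of `x ≥ 0`
  -- and `x ≤ 0`.
  record SameSign (x y : Carrier) : Set where
    constructor sameSign
    field
      nonNeg⇔ : NonNeg x ⇔ NonNeg y
      nonPos⇔ : NonNeg (- x) ⇔ NonNeg (- y)

    transfer-nonNeg : NonNeg x → NonNeg y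
    transfer-nonNeg = Equivalence.to nonNeg⇔

    transfer-pos : Pos x → Pos y
    transfer-pos p q = p (Equivalence.from nonPos⇔ q)

    transfer-0 : x ≡ 0# → y ≡ 0#
    transfer-0 refl = nonNeg-antisym (transfer-nonNeg nonNeg-0)
      (Equivalence.to nonPos⇔ (nonNeg-resp (solve [] zer (⊟ zer) refl) nonNeg-0))

  open SameSign public

  sameSign-sym : ∀ {x y} → SameSign x y → SameSign y x
  sameSign-sym (sameSign p q) = sameSign (mk⇔ (Equivalence.from p) (Equivalence.to p)) (mk⇔ (Equivalence.from q) (Equivalence.to q))

  sameSign-resp : ∀ {x x' y y'} → x ≡ x' → y ≡ y' → SameSign x y → SameSign x' y'
  sameSign-resp refl refl s = s

  sameSign-neg : ∀ {x y} → SameSign x y → SameSign (- x) (- y)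
  sameSign-neg {x} {y} (sameSign p q) = sameSign q
    (mk⇔ (λ r → nonNeg-resp (sym (neg² y)) (Equivalence.to p (nonNeg-resp (neg² x) r)))
         (λ r → nonNeg-resp (sym (neg² x)) (Equivalence.from p (nonNeg-resp (neg² y) r))))
    where
    neg² : ∀ z → - (- z) ≡ z
    neg² z = solve (z ∷ []) (⊟ (⊟ v0)) v0 refl

  sameSign-•⁻¹ : ∀ n .{{_ : ℕ.NonZero n}} {x y} → SameSign (+ n • x) (+ n • y) → SameSign x y
  sameSign-•⁻¹ n {x} {y} (sameSign p q) = sameSign
    (mk⇔ (λ r → nonNeg-•⁻¹ n (Equivalence.to p (nonNeg-• n r)))
         (λ r → nonNeg-•⁻¹ n (Equivalence.from p (nonNeg-• n r))))
    (mk⇔ (λ r → nonNeg-•⁻¹ n (nonNeg-resp (sym (•-neg (+ n) y)) (Equivalence.to q (nonNeg-resp (•-neg (+ n) x) (nonNeg-• n r)))))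
         (λ r → nonNeg-•⁻¹ n (nonNeg-resp (sym (•-neg (+ n) x)) (Equivalence.from q (nonNeg-resp (•-neg (+ n) y) (nonNeg-• n r))))))

  pos-pos⇒sameSign : ∀ {x y} → Pos x → Pos y → SameSign x y
  pos-pos⇒sameSign p q = sameSign (mk⇔ (λ _ → pos⇒nonNeg q) (λ _ → pos⇒nonNeg p))
    (mk⇔ (λ r → contradiction r p) (λ r → contradiction r q))

  neg-neg⇒sameSign : ∀ {x y} → Pos (- x) → Pos (- y) → SameSign x y
  neg-neg⇒sameSign {x} {y} p q = sameSign-resp (solve (x ∷ []) (⊟ (⊟ v0)) v0 refl) (solve (y ∷ []) (⊟ (⊟ v0)) v0 refl)
    (sameSign-neg (pos-pos⇒sameSign p q))

-- The cyclic order cut at 𝟘, and the carry cocycle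

orientedGroup⇒abelianGroup : OrientedAbelianGroup → AbelianGroup 0ℓ 0ℓ
orientedGroup⇒abelianGroup G = record
  { isAbelianGroup = record
    { isGroup = record
      { isMonoid = record
        { isSemigroup = record
          { isMagma = record { isEquivalence = isEquivalence ; ∙-cong = cong₂ _⊕_ }
          ; assoc = ⊕-assoc }
        ; identity = ⊕-identityˡ , λ a → trans (⊕-comm a 𝟘) (⊕-identityˡ a) }
      ; inverse = ⊖-inverseˡ , λ a → trans (⊕-comm a (⊖ a)) (⊖-inverseˡ a)
      ; ⁻¹-cong = cong ⊖_ }
    ; comm = ⊕-comm } }
  where open OrientedAbelianGroup G

module CyclicOrder (G : OrientedAbelianGroup) (em : ExcludedMiddle 0ℓ) where
  open OrientedAbelianGroup G

  open LinearForms (orientedGroup⇒abelianGroup G) public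

  ⊕-identityʳ : ∀ a → a ⊕ 𝟘 ≡ a
  ⊕-identityʳ a = solve (a ∷ []) (v0 ⊞ zer) v0 refl

  -- The linear order with least element 𝟘 obtained by cutting the cyclic order at 𝟘.
  infix 4 _≺_
  _≺_ : Carrier → Carrier → Set
  x ≺ y = x ≢ y × (x ≡ 𝟘 ⊎ O 𝟘 x y)

  O-distinct₁₂ : ∀ {a b c} → O a b c → a ≢ b
  O-distinct₁₂ h refl = O-asym (O-cyclic h) (O-cyclic h)

  O-distinct₂₃ : ∀ {a b c} → O a b c → b ≢ c
  O-distinct₂₃ h = O-distinct₁₂ (O-cyclic h)

  O-distinct₁₃ : ∀ {a b c} → O a b c → a ≢ c
  O-distinct₁₃ h refl = O-asym h h

  ≺-asym : ∀ {x y} → x ≺ y → ¬ y ≺ x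
  ≺-asym (ne , inj₁ refl) (_ , inj₁ refl) = ne refl
  ≺-asym (_ , inj₁ refl) (_ , inj₂ h) = O-distinct₁₃ h refl
  ≺-asym (_ , inj₂ h) (_ , inj₁ refl) = O-distinct₁₃ h refl
  ≺-asym (_ , inj₂ h) (_ , inj₂ k) = O-asym h (O-cyclic k)

  ≺-irrefl : ∀ {x} → ¬ x ≺ x
  ≺-irrefl (ne , _) = ne refl

  ⊀𝟘 : ∀ {x} → ¬ x ≺ 𝟘
  ⊀𝟘 (ne , inj₁ e) = ne e
  ⊀𝟘 (ne , inj₂ h) = O-distinct₁₃ h refl

  ≺-trans : ∀ {x y z} → x ≺ y → y ≺ z → x ≺ z
  ≺-trans (ne , inj₁ refl) (_ , inj₁ refl) = contradiction refl ne
  ≺-trans (ne , inj₁ refl) (_ , inj₂ k) = O-distinct₁₃ k , inj₁ refl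
  ≺-trans (ne , inj₂ h) (_ , inj₁ refl) = contradiction refl (O-distinct₁₃ h)
  ≺-trans (ne , inj₂ h) (_ , inj₂ k) = O-distinct₂₃ h∘k , inj₂ h∘k
    where h∘k = O-trans h k

  ≺-connex : ∀ {x y} → x ≢ y → x ≺ y ⊎ y ≺ x
  ≺-connex {x} {y} ne with em {x ≡ 𝟘} | em {y ≡ 𝟘}
  ... | yes p | _ = inj₁ (ne , inj₁ p)
  ... | no _ | yes q = inj₂ ((λ e → ne (sym e)) , inj₁ q)
  ... | no p | no q with O-total (λ e → p (sym e)) ne (λ e → q (sym e))
  ...   | inj₁ h = inj₁ (ne , inj₂ h)
  ...   | inj₂ h = inj₂ ((λ e → ne (sym e)) , inj₂ (O-cyclic (O-cyclic h)))

  -- The cases tell on which arc the cut at 𝟘 falls: from `z` to `x`, from `x` to `y`, or from `y`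
  -- to `z`.
  Cyclic : Carrier → Carrier → Carrier → Set
  Cyclic x y z = (x ≺ y × y ≺ z) ⊎ (y ≺ z × z ≺ x) ⊎ (z ≺ x × x ≺ y)

  ascending⇒O : ∀ {x y z} → x ≺ y → y ≺ z → O x y z
  ascending⇒O (ne , inj₁ refl) (_ , inj₁ refl) = contradiction refl ne
  ascending⇒O (ne , inj₁ refl) (_ , inj₂ k) = k
  ascending⇒O (_ , inj₂ h) (_ , inj₁ refl) = contradiction refl (O-distinct₁₃ h)
  ascending⇒O (_ , inj₂ h) (_ , inj₂ k) =
    O-cyclic (O-cyclic (O-trans (O-cyclic k) (O-cyclic (O-cyclic h))))

  cyclic⇒O : ∀ {x y z} → Cyclic x y z → O x y z
  cyclic⇒O (inj₁ (p , q)) = ascending⇒O p q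
  cyclic⇒O (inj₂ (inj₁ (p , q))) = O-cyclic (O-cyclic (ascending⇒O p q))
  cyclic⇒O (inj₂ (inj₂ (p , q))) = O-cyclic (ascending⇒O p q)

  O⇒cyclic : ∀ {x y z} → O x y z → Cyclic x y z
  O⇒cyclic h with ≺-connex (O-distinct₁₂ h) | ≺-connex (O-distinct₂₃ h) | ≺-connex (O-distinct₁₃ h)
  ... | inj₁ p | inj₁ q | _ = inj₁ (p , q)
  ... | inj₁ p | inj₂ q | inj₁ r = contradiction (O-cyclic (ascending⇒O r q)) (O-asym h)
  ... | inj₁ p | inj₂ q | inj₂ r = inj₂ (inj₂ (r , p))
  ... | inj₂ p | inj₁ q | inj₁ r = contradiction (O-cyclic (O-cyclic (ascending⇒O p r))) (O-asym h)
  ... | inj₂ p | inj₁ q | inj₂ r = inj₂ (inj₁ (q , r))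
  ... | inj₂ p | inj₂ q | _ = contradiction (ascending⇒O q p) (O-asym h)

  O-between : ∀ {x y z} → x ≺ z → O x y z → x ≺ y × y ≺ z
  O-between x≺z h with O⇒cyclic h
  ... | inj₁ p = p
  ... | inj₂ (inj₁ (_ , z≺x)) = contradiction z≺x (≺-asym x≺z)
  ... | inj₂ (inj₂ (z≺x , _)) = contradiction z≺x (≺-asym x≺z)

  indicator : {P : Set} → Dec P → ℕ
  indicator (yes _) = 1
  indicator (no _) = 0

  -- Counts how often the cut is crossed when moving in the positive direction from `x` to `y`.
  δ : Carrier → Carrier → ℕ
  δ x y = indicator (em {y ≺ x})

  δ≡1 : ∀ {x y} → y ≺ x → δ x y ≡ 1
  δ≡1 {x} {y} h with em {y ≺ x}
  ... | yes _ = refl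
  ... | no ¬h = contradiction h ¬h

  δ≡0 : ∀ {x y} → ¬ y ≺ x → δ x y ≡ 0
  δ≡0 {x} {y} ¬h with em {y ≺ x}
  ... | yes h = contradiction h ¬h
  ... | no _ = refl

  δ-ascent : ∀ {x y} → x ≺ y → δ x y ≡ 0
  δ-ascent h = δ≡0 (≺-asym h)

  δ-refl : ∀ x → δ x x ≡ 0
  δ-refl x = δ≡0 ≺-irrefl

  δ-swap : ∀ {x y} → x ≢ y → δ x y ℕ.+ δ y x ≡ 1
  δ-swap ne with ≺-connex ne
  ... | inj₁ h = cong₂ ℕ._+_ (δ-ascent h) (δ≡1 h)
  ... | inj₂ h = cong₂ ℕ._+_ (δ≡1 h) (δ-ascent h)

  δ-positive : ∀ {x y z} → O x y z → δ x y ℕ.+ δ y z ≡ δ x z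
  δ-positive h with O⇒cyclic h
  ... | inj₁ (p , q) = trans (cong₂ ℕ._+_ (δ-ascent p) (δ-ascent q)) (sym (δ-ascent (≺-trans p q)))
  ... | inj₂ (inj₁ (p , q)) = trans (cong₂ ℕ._+_ (δ≡1 (≺-trans p q)) (δ-ascent p)) (sym (δ≡1 q))
  ... | inj₂ (inj₂ (p , q)) = trans (cong₂ ℕ._+_ (δ-ascent q) (δ≡1 (≺-trans p q))) (sym (δ≡1 p))

  δ-negative : ∀ {x y z} → O z y x → δ x y ℕ.+ δ y z ≡ 1 ℕ.+ δ x z
  δ-negative h with O⇒cyclic h
  ... | inj₁ (p , q) = trans (cong₂ ℕ._+_ (δ≡1 q) (δ≡1 p)) (cong suc (sym (δ≡1 (≺-trans p q))))
  ... | inj₂ (inj₁ (p , q)) = trans (cong₂ ℕ._+_ (δ≡1 p) (δ-ascent (≺-trans p q))) (cong suc (sym (δ-ascent q)))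
  ... | inj₂ (inj₂ (p , q)) = trans (cong₂ ℕ._+_ (δ-ascent (≺-trans p q)) (δ≡1 q)) (cong suc (sym (δ-ascent p)))

  ⊕-cancelʳ : ∀ d {x y} → x ⊕ d ≡ y ⊕ d → x ≡ y
  ⊕-cancelʳ d {x} {y} e = begin
    x              ≡⟨ solve (x ∷ d ∷ []) v0 ((v0 ⊞ v1) ⊟ v1) refl ⟩
    (x ⊕ d) ⊕ ⊖ d  ≡⟨ cong (_⊕ ⊖ d) e ⟩
    (y ⊕ d) ⊕ ⊖ d  ≡⟨ solve (y ∷ d ∷ []) ((v0 ⊞ v1) ⊟ v1) v0 refl ⟩
    y              ∎
    where open ≡-Reasoning

  -- The defect of δ from being additive along x, y, z is the number of turns made by going from x
  -- to y to z and back; it only depends on the cyclic order, hence is invariant under translation.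
  winding : ∀ x y z d → ∃ λ t →
    δ x y ℕ.+ δ y z ≡ t ℕ.+ δ x z ×
    δ (x ⊕ d) (y ⊕ d) ℕ.+ δ (y ⊕ d) (z ⊕ d) ≡ t ℕ.+ δ (x ⊕ d) (z ⊕ d)
  winding x y z d with em {x ≡ y} | em {y ≡ z} | em {x ≡ z}
  ... | yes refl | _ | _ = 0 , cong (ℕ._+ δ x z) (δ-refl x) , cong (ℕ._+ δ (x ⊕ d) (z ⊕ d)) (δ-refl _)
  ... | no _ | yes refl | _ = 0 , trans (cong (δ x y ℕ.+_) (δ-refl y)) (ℕ.+-identityʳ _)
                                , trans (cong (δ (x ⊕ d) (y ⊕ d) ℕ.+_) (δ-refl _)) (ℕ.+-identityʳ _)
  ... | no p | no _ | yes refl = 1 , trans (δ-swap p) (cong suc (sym (δ-refl x)))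
                                   , trans (δ-swap (λ e → p (⊕-cancelʳ d e))) (cong suc (sym (δ-refl _)))
  ... | no p | no q | no r with O-total p q r
  ...   | inj₁ h = 0 , δ-positive h , δ-positive (O-transl d h)
  ...   | inj₂ h = 1 , δ-negative h , δ-negative (O-transl d h)

  -- The carry of the addition `a ⊕ b`. As a 2-cocycle with values in ℤ it defines the extension of
  -- A by ℤ that is the cover.
  wrap : Carrier → Carrier → ℕ
  wrap a b = δ b (a ⊕ b)

  -- Translate the triple `𝟘`, `b`, `a ⊕ b` by `d`. As nothing lies below `𝟘`, its number of turns
  -- is `wrap a b`; the equation after translation is then the cocycle identity.
  wrap-cocycle : ∀ a b d → wrap a b ℕ.+ wrap (a ⊕ b) d ≡ wrap b d ℕ.+ wrap a (b ⊕ d)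
  wrap-cocycle a b d with winding 𝟘 b (a ⊕ b) d
  ... | t , e , e' rewrite δ≡0 {𝟘} {b} ⊀𝟘 | δ≡0 {𝟘} {a ⊕ b} ⊀𝟘 | ⊕-identityˡ d | ⊕-assoc a b d
                         | e | ℕ.+-identityʳ t = sym e'

  -- Otherwise translates of the two hypotheses would give a closed ascending chain x, y, y - x, -x,
  -- -y, x - y, x.
  O-neg : ∀ {x y} → O 𝟘 x y → O 𝟘 (⊖ y) (⊖ x)
  O-neg {x} {y} h with O-total {𝟘} {⊖ y} {⊖ x}
    (λ e → O-distinct₁₃ h (trans (solve [] zer (⊟ zer) refl) (trans (cong ⊖_ e) (neg² y))))
    (λ e → O-distinct₂₃ h (sym (trans (sym (neg² y)) (trans (cong ⊖_ e) (neg² x)))))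
    (λ e → O-distinct₁₂ h (trans (solve [] zer (⊟ zer) refl) (trans (cong ⊖_ e) (neg² x))))
    where
    neg² : ∀ z → ⊖ (⊖ z) ≡ z
    neg² z = solve (z ∷ []) (⊟ (⊟ v0)) v0 refl
  ... | inj₁ k = k
  ... | inj₂ k = contradiction refl (O-distinct₂₃
        (O-trans h (O-trans h₁ (O-trans h₂ (O-trans h₃ (O-trans h₄ h₅))))))
    where
    h₃ : O 𝟘 (⊖ x) (⊖ y)
    h₃ = O-cyclic (O-cyclic k)
    resp : ∀ {a a' b b' c c'} → a ≡ a' → b ≡ b' → c ≡ c' → O a b c → O a' b' c'
    resp refl refl refl o = o
    h₁ : O 𝟘 y (y ⊕ ⊖ x)
    h₁ = O-cyclic (O-cyclic (resp (⊕-identityˡ y) (⊕-comm _ _) (⊖-inverseˡ y) (O-transl y h₃)))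
    h₂ : O 𝟘 (y ⊕ ⊖ x) (⊖ x)
    h₂ = O-cyclic (resp (⊕-identityˡ _) (solve (x ∷ []) (v0 ⊟ v0) zer refl) refl (O-transl (⊖ x) h))
    h₄ : O 𝟘 (⊖ y) (x ⊕ ⊖ y)
    h₄ = O-cyclic (O-cyclic (resp (⊕-identityˡ _) refl (solve (y ∷ []) (v0 ⊟ v0) zer refl) (O-transl (⊖ y) h)))
    h₅ : O 𝟘 (x ⊕ ⊖ y) x
    h₅ = O-cyclic (resp (⊕-identityˡ _) (⊖-inverseˡ x) (⊕-comm _ _) (O-transl x h₃))

  -- Reflect `𝟘`, `a ⊕ b`, `b` by negation and translate the result by `b ⊕ a`.
  wrap-swap : ∀ {a b} → a ⊕ b ≺ b → b ⊕ a ≺ a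
  wrap-swap {a} {b} (ne , inj₁ e) = (λ e' → ne (trans e (sym (b≡𝟘 e')))) , inj₁ (trans (⊕-comm b a) e)
    where
    b≡𝟘 : b ⊕ a ≡ a → b ≡ 𝟘
    b≡𝟘 e' = ⊕-cancelʳ a (trans e' (sym (⊕-identityˡ a)))
  wrap-swap {a} {b} (ne , inj₂ h) = (λ e → O-distinct₁₃ h (sym (b≡𝟘 e))) , inj₂ o
    where
    b≡𝟘 : b ⊕ a ≡ a → b ≡ 𝟘
    b≡𝟘 e' = ⊕-cancelʳ a (trans e' (sym (⊕-identityˡ a)))
    o : O 𝟘 (b ⊕ a) a
    o = O-cyclic (O-cyclic (subst (λ z → O (b ⊕ a) z 𝟘) (solve (a ∷ b ∷ []) (⊟ v1 ⊞ (v1 ⊞ v0)) v0 refl)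
          (subst (λ z → O (b ⊕ a) (⊖ b ⊕ (b ⊕ a)) z) (solve (a ∷ b ∷ []) (⊟ (v0 ⊞ v1) ⊞ (v1 ⊞ v0)) zer refl)
            (subst (λ z → O z (⊖ b ⊕ (b ⊕ a)) (⊖ (a ⊕ b) ⊕ (b ⊕ a))) (⊕-identityˡ _)
              (O-transl (b ⊕ a) (O-neg h))))))

  wrap-comm : ∀ a b → wrap a b ≡ wrap b a
  wrap-comm a b with em {a ⊕ b ≺ b}
  ... | yes h = sym (δ≡1 (wrap-swap h))
  ... | no ¬h = sym (δ≡0 (λ k → ¬h (wrap-swap k)))

  wrap-≤1 : ∀ a b → wrap a b ≡ 0 ⊎ wrap a b ≡ 1
  wrap-≤1 a b with em {a ⊕ b ≺ b}
  ... | yes h = inj₂ refl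
  ... | no ¬h = inj₁ refl

  wrap-identityˡ : ∀ a → wrap 𝟘 a ≡ 0
  wrap-identityˡ a = δ≡0 λ h → ≺-irrefl (subst (_≺ a) (⊕-identityˡ a) h)

  wrap-identityʳ : ∀ a → wrap a 𝟘 ≡ 0
  wrap-identityʳ a = trans (wrap-comm a 𝟘) (wrap-identityˡ a)

  -- A non-zero `a` and its inverse add up to one full turn, and this produces a carry.
  wrap-inverse : ∀ a → wrap (⊖ a) a ≡ 0 → a ≡ 𝟘
  wrap-inverse a e with em {a ≡ 𝟘}
  ... | yes p = p
  ... | no p = contradiction (trans (sym e) (δ≡1 (subst (_≺ a) (sym (⊖-inverseˡ a)) ((λ q → p (sym q)) , inj₁ refl)))) λ ()

-- The universal cover

-- `decompose` and `π-𝟙` make ℤ𝟙 the kernel of `π`, and `lift` is the section with values in the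
-- fundamental domain [0, 𝟙). The later parts use the cover only through these fields.
record UniversalCover (G : OrientedAbelianGroup) (em : ExcludedMiddle 0ℓ) : Set₁ where
  open OrientedAbelianGroup G
  open CyclicOrder G em using (_≺_)
  field
    cover : OrderedGroup
  open OrderedGroup cover
  open OrderedGroupProperties cover em
  field
    𝟙 : OrderedGroup.Carrier cover
    lift : OrientedAbelianGroup.Carrier G → OrderedGroup.Carrier cover
    π : OrderedGroup.Carrier cover → OrientedAbelianGroup.Carrier G
    π-+ : ∀ x y → π (x + y) ≡ π x ⊕ π y
    π-𝟙 : π 𝟙 ≡ 𝟘
    π-lift : ∀ a → π (lift a) ≡ a
    lift-nonNeg : ∀ a → NonNeg (lift a)
    lift<𝟙 : ∀ a → Pos (𝟙 + - lift a)
    lift-π : ∀ {x} → NonNeg x → Pos (𝟙 + - x) → lift (π x) ≡ x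
    decompose : ∀ x → ∃ λ k → x ≡ lift (π x) + k • 𝟙
    lift-⊕ : ∀ a b → ∃ λ w → (w ≡ 0 ⊎ w ≡ 1) × lift a + lift b ≡ lift (a ⊕ b) + + w • 𝟙
    lift-⊕-ascent : ∀ a b → ¬ a ⊕ b ≺ b → lift (a ⊕ b) ≡ lift a + lift b
    lift-⊖ : ∀ a → ∃ λ w → (w ≡ 0 ⊎ w ≡ 1) × lift (⊖ a) ≡ - lift a + + w • 𝟙
    ≺⇒lift : ∀ {a b} → a ≺ b → Pos (lift b + - lift a)
    lift⇒≺ : ∀ {a b} → Pos (lift b + - lift a) → a ≺ b

module CoverConstruction (G : OrientedAbelianGroup) (em : ExcludedMiddle 0ℓ) where
  open OrientedAbelianGroup G
  open CyclicOrder G em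
    using (_≺_; wrap; wrap-cocycle; wrap-comm; wrap-identityˡ; wrap-identityʳ; wrap-inverse; wrap-≤1;
           ⊕-identityʳ; δ≡0; δ≡1; solve; v0; v1; zer; _⊞_; ⊟_; _⊟_)

  -- (a , m) stands for the lift of a to [0, 𝟙) plus m 𝟙.
  C : Set
  C = Carrier × ℤ

  _+ᶜ_ : C → C → C
  (a , m) +ᶜ (b , n) = a ⊕ b , (m ℤ.+ n) ℤ.+ + wrap a b

  -ᶜ_ : C → C
  -ᶜ (a , m) = ⊖ a , ℤ.- m ℤ.- + wrap (⊖ a) a

  0ᶜ : C
  0ᶜ = 𝟘 , 0ℤ

  open ≡-Reasoning

  +ᶜ-assoc : ∀ x y z → (x +ᶜ y) +ᶜ z ≡ x +ᶜ (y +ᶜ z)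
  +ᶜ-assoc (a , k) (b , m) (d , n) = cong₂ _,_ (⊕-assoc a b d) (begin
    (((k ℤ.+ m) ℤ.+ + w₁) ℤ.+ n) ℤ.+ + w₂   ≡⟨ lhs k m n (+ w₁) (+ w₂) ⟩
    ((k ℤ.+ m) ℤ.+ n) ℤ.+ + (w₁ ℕ.+ w₂)     ≡⟨ cong (λ w → ((k ℤ.+ m) ℤ.+ n) ℤ.+ + w) (wrap-cocycle a b d) ⟩
    ((k ℤ.+ m) ℤ.+ n) ℤ.+ + (w₃ ℕ.+ w₄)     ≡⟨ rhs k m n (+ w₃) (+ w₄) ⟨
    (k ℤ.+ ((m ℤ.+ n) ℤ.+ + w₃)) ℤ.+ + w₄   ∎)
    where
    w₁ = wrap a b
    w₂ = wrap (a ⊕ b) d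
    w₃ = wrap b d
    w₄ = wrap a (b ⊕ d)
    lhs : ∀ k m n v w → (((k ℤ.+ m) ℤ.+ v) ℤ.+ n) ℤ.+ w ≡ ((k ℤ.+ m) ℤ.+ n) ℤ.+ (v ℤ.+ w)
    lhs = solve-∀
    rhs : ∀ k m n v w → (k ℤ.+ ((m ℤ.+ n) ℤ.+ v)) ℤ.+ w ≡ ((k ℤ.+ m) ℤ.+ n) ℤ.+ (v ℤ.+ w)
    rhs = solve-∀

  +ᶜ-comm : ∀ x y → x +ᶜ y ≡ y +ᶜ x
  +ᶜ-comm (a , m) (b , n) = cong₂ _,_ (⊕-comm a b) (cong₂ (λ k w → k ℤ.+ + w) (ℤ.+-comm m n) (wrap-comm a b))

  +ᶜ-identityˡ : ∀ x → 0ᶜ +ᶜ x ≡ x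
  +ᶜ-identityˡ (a , m) = cong₂ _,_ (⊕-identityˡ a)
    (trans (cong (λ w → (0ℤ ℤ.+ m) ℤ.+ + w) (wrap-identityˡ a)) (trans (ℤ.+-identityʳ _) (ℤ.+-identityˡ m)))

  -ᶜ-inverseˡ : ∀ x → (-ᶜ x) +ᶜ x ≡ 0ᶜ
  -ᶜ-inverseˡ (a , m) = cong₂ _,_ (⊖-inverseˡ a) (cancel m (+ wrap (⊖ a) a))
    where
    cancel : ∀ m w → ((ℤ.- m ℤ.- w) ℤ.+ m) ℤ.+ w ≡ 0ℤ
    cancel = solve-∀

  isAbelianGroupᶜ : IsAbelianGroup _≡_ _+ᶜ_ 0ᶜ -ᶜ_
  isAbelianGroupᶜ = record
    { isGroup = record
      { isMonoid = record
        { isSemigroup = record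
          { isMagma = record { isEquivalence = isEquivalence ; ∙-cong = cong₂ _+ᶜ_ }
          ; assoc = +ᶜ-assoc }
        ; identity = +ᶜ-identityˡ , λ x → trans (+ᶜ-comm x 0ᶜ) (+ᶜ-identityˡ x) }
      ; inverse = -ᶜ-inverseˡ , λ x → trans (+ᶜ-comm x (-ᶜ x)) (-ᶜ-inverseˡ x)
      ; ⁻¹-cong = cong -ᶜ_ }
    ; comm = +ᶜ-comm }

  -- The lift of the first component lies in [0, 𝟙), so the number of turns alone decides the sign.
  NonNegᶜ : C → Set
  NonNegᶜ (_ , m) = 0ℤ ℤ.≤ m

  orderedGroup : OrderedGroup
  orderedGroup = record
    { isAbelianGroup = isAbelianGroupᶜ
    ; NonNeg = NonNegᶜ
    ; nonNeg-+ = λ p q → ℤ.+-mono-≤ (ℤ.+-mono-≤ p q) (ℤ.+≤+ ℕ.z≤n)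
    ; nonNeg-antisym = λ {x} → antisym {x}
    ; nonNeg-total = total }
    where
    antisym : ∀ {x} → NonNegᶜ x → NonNegᶜ (-ᶜ x) → x ≡ 0ᶜ
    antisym {a , + zero} _ q = cong (_, 0ℤ) (wrap-inverse a (zero-wrap (wrap (⊖ a) a) q))
      where
      zero-wrap : ∀ w → 0ℤ ℤ.≤ 0ℤ ℤ.- + w → w ≡ 0
      zero-wrap zero _ = refl
      zero-wrap (suc w) ()
    antisym {a , + suc n} _ q = contradiction q (bad (wrap (⊖ a) a))
      where
      bad : ∀ w → ¬ 0ℤ ℤ.≤ -[1+ n ] ℤ.- + w
      bad zero ()
      bad (suc w) ()
    total : ∀ x → NonNegᶜ x ⊎ NonNegᶜ (-ᶜ x)
    total (a , + n) = inj₁ (ℤ.+≤+ ℕ.z≤n)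
    total (a , -[1+ n ]) with wrap (⊖ a) a | wrap-≤1 (⊖ a) a
    ... | _ | inj₁ refl = inj₂ (ℤ.+≤+ ℕ.z≤n)
    ... | _ | inj₂ refl = inj₂ (ℤ.+≤+ ℕ.z≤n)

  open OrderedGroupProperties orderedGroup em
    using (Pos; ¬nonNeg⇒pos; neg-•; pos-resp)
    renaming (_•_ to _•ᶜ_; solve to solveᶜ; v0 to u0; v1 to u1; v2 to u2; _⊞_ to _⊞ᶜ_; ⊟_ to ⊟ᶜ_; _⊟_ to _⊟ᶜ_)

  𝟙ᶜ : C
  𝟙ᶜ = 𝟘 , 1ℤ

  •-𝟙ᶜ : ∀ k → k •ᶜ 𝟙ᶜ ≡ (𝟘 , k)
  •-𝟙ᶜ (+ zero) = refl
  •-𝟙ᶜ (+ suc n) = begin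
    𝟙ᶜ +ᶜ (+ n •ᶜ 𝟙ᶜ)   ≡⟨ cong (𝟙ᶜ +ᶜ_) (•-𝟙ᶜ (+ n)) ⟩
    𝟙ᶜ +ᶜ (𝟘 , + n)     ≡⟨ cong₂ _,_ (⊕-identityˡ 𝟘) (trans (cong (λ w → + suc n ℤ.+ + w) (wrap-identityˡ 𝟘)) (ℤ.+-identityʳ _)) ⟩
    (𝟘 , + suc n)       ∎
  •-𝟙ᶜ -[1+ n ] = begin
    -ᶜ (+ suc n •ᶜ 𝟙ᶜ)  ≡⟨ cong -ᶜ_ (helper (suc n)) ⟩
    -ᶜ (𝟘 , + suc n)    ≡⟨ cong₂ _,_ (solve [] (⊟ zer) zer refl)
                             (trans (cong (λ w → -[1+ n ] ℤ.- + w) (wrap-identityʳ (⊖ 𝟘))) (ℤ.+-identityʳ _)) ⟩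
    (𝟘 , -[1+ n ])      ∎
    where
    helper : ∀ n → + n •ᶜ 𝟙ᶜ ≡ (𝟘 , + n)
    helper zero = refl
    helper (suc n) = trans (cong (𝟙ᶜ +ᶜ_) (helper n))
      (cong₂ _,_ (⊕-identityˡ 𝟘) (trans (cong (λ w → + suc n ℤ.+ + w) (wrap-identityˡ 𝟘)) (ℤ.+-identityʳ _)))

  shift : ∀ a m k → (a , m) +ᶜ (k •ᶜ 𝟙ᶜ) ≡ (a , m ℤ.+ k)
  shift a m k = begin
    (a , m) +ᶜ (k •ᶜ 𝟙ᶜ)   ≡⟨ cong ((a , m) +ᶜ_) (•-𝟙ᶜ k) ⟩
    (a , m) +ᶜ (𝟘 , k)     ≡⟨ cong₂ _,_ (⊕-identityʳ a) (trans (cong (λ w → (m ℤ.+ k) ℤ.+ + w) (wrap-identityʳ a)) (ℤ.+-identityʳ _)) ⟩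
    (a , m ℤ.+ k)          ∎

  below-𝟙 : ∀ a m → (a , m) +ᶜ (-ᶜ 𝟙ᶜ) ≡ (a , m ℤ.+ -1ℤ)
  below-𝟙 a m = trans (cong (λ z → (a , m) +ᶜ (-ᶜ z)) (sym (trans (•-𝟙ᶜ 1ℤ) refl))) (shift a m -1ℤ)

  liftᶜ : Carrier → C
  liftᶜ a = a , 0ℤ

  liftᶜ-+ : ∀ a b → liftᶜ a +ᶜ liftᶜ b ≡ liftᶜ (a ⊕ b) +ᶜ (+ wrap a b •ᶜ 𝟙ᶜ)
  liftᶜ-+ a b = sym (shift (a ⊕ b) 0ℤ (+ wrap a b))

  -- Write `a` as `d ⊕ b` with `d = a ⊕ ⊖ b`; adding the lifts of `d` and `b` costs the carry
  -- `wrap d b`. It is 1 exactly if `a ≺ b`, whence the sign of the difference recovers `≺`.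
  liftᶜ-difference : ∀ a b → liftᶜ a +ᶜ (-ᶜ liftᶜ b) ≡ (a ⊕ ⊖ b , ℤ.- + wrap (a ⊕ ⊖ b) b)
  liftᶜ-difference a b = begin
    liftᶜ a +ᶜ (-ᶜ liftᶜ b)
      ≡⟨ cong (λ z → liftᶜ z +ᶜ (-ᶜ liftᶜ b)) (solve (a ∷ b ∷ []) v0 ((v0 ⊟ v1) ⊞ v1) refl) ⟩
    liftᶜ (d ⊕ b) +ᶜ (-ᶜ liftᶜ b)
      ≡⟨ solveᶜ (liftᶜ (d ⊕ b) ∷ W ∷ liftᶜ b ∷ []) (u0 ⊟ᶜ u2) (((u0 ⊞ᶜ u1) ⊟ᶜ u2) ⊟ᶜ u1) refl ⟩
    ((liftᶜ (d ⊕ b) +ᶜ W) +ᶜ (-ᶜ liftᶜ b)) +ᶜ (-ᶜ W)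
      ≡⟨ cong (λ z → (z +ᶜ (-ᶜ liftᶜ b)) +ᶜ (-ᶜ W)) (sym (liftᶜ-+ d b)) ⟩
    ((liftᶜ d +ᶜ liftᶜ b) +ᶜ (-ᶜ liftᶜ b)) +ᶜ (-ᶜ W)
      ≡⟨ solveᶜ (liftᶜ d ∷ W ∷ liftᶜ b ∷ []) (((u0 ⊞ᶜ u2) ⊟ᶜ u2) ⊟ᶜ u1) (u0 ⊟ᶜ u1) refl ⟩
    liftᶜ d +ᶜ (-ᶜ W)
      ≡⟨ cong (liftᶜ d +ᶜ_) (sym (neg-• (+ w) 𝟙ᶜ)) ⟩
    liftᶜ d +ᶜ ((ℤ.- + w) •ᶜ 𝟙ᶜ)
      ≡⟨ trans (shift d 0ℤ (ℤ.- + w)) (cong (d ,_) (ℤ.+-identityˡ _)) ⟩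
    (d , ℤ.- + w) ∎
    where
    d = a ⊕ ⊖ b
    w = wrap d b
    W = + w •ᶜ 𝟙ᶜ

  universalCover : UniversalCover G em
  universalCover = record
    { cover = orderedGroup
    ; 𝟙 = 𝟙ᶜ
    ; lift = liftᶜ
    ; π = proj₁
    ; π-+ = λ _ _ → refl
    ; π-𝟙 = refl
    ; π-lift = λ _ → refl
    ; lift-nonNeg = λ _ → ℤ.+≤+ ℕ.z≤n
    ; lift<𝟙 = λ a → pos-resp (trans (cong -ᶜ_ (sym (below-𝟙 a 0ℤ))) (swap (liftᶜ a))) (¬nonNeg⇒pos {a , -1ℤ} λ ())
    ; lift-π = λ {x} → lift-proj x
    ; decompose = λ { (a , m) → m , sym (trans (shift a 0ℤ m) (cong (a ,_) (ℤ.+-identityˡ m))) }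
    ; lift-⊕ = λ a b → wrap a b , wrap-≤1 a b , liftᶜ-+ a b
    ; lift-⊕-ascent = λ a b h → sym (cong (a ⊕ b ,_) (cong +_ (δ≡0 h)))
    ; lift-⊖ = λ a → wrap (⊖ a) a , wrap-≤1 (⊖ a) a ,
        sym (trans (shift (⊖ a) (0ℤ ℤ.- + wrap (⊖ a) a) (+ wrap (⊖ a) a)) (cong (⊖ a ,_) (cancel (+ wrap (⊖ a) a))))
    ; ≺⇒lift = λ {a} {b} h → pos-resp (swap-difference b a) (¬nonNeg⇒pos
        (subst (λ z → ¬ NonNegᶜ z) (sym (liftᶜ-difference a b))
          (subst (λ w → ¬ 0ℤ ℤ.≤ ℤ.- + w) (sym (wrap≡1 h)) λ ())))
    ; lift⇒≺ = λ {a} {b} p → descend a b λ e → p (subst NonNegᶜ (sym (swap-difference' b a))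
        (subst NonNegᶜ (sym (liftᶜ-difference a b)) (subst (λ w → 0ℤ ℤ.≤ ℤ.- + w) (sym e) (ℤ.+≤+ ℕ.z≤n)))) }
    where
    swap : ∀ x → -ᶜ (x +ᶜ (-ᶜ 𝟙ᶜ)) ≡ 𝟙ᶜ +ᶜ (-ᶜ x)
    swap x = solveᶜ (x ∷ 𝟙ᶜ ∷ []) (⊟ᶜ (u0 ⊟ᶜ u1)) (u1 ⊟ᶜ u0) refl
    swap-difference : ∀ b a → -ᶜ (liftᶜ a +ᶜ (-ᶜ liftᶜ b)) ≡ liftᶜ b +ᶜ (-ᶜ liftᶜ a)
    swap-difference b a = solveᶜ (liftᶜ a ∷ liftᶜ b ∷ []) (⊟ᶜ (u0 ⊟ᶜ u1)) (u1 ⊟ᶜ u0) refl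
    swap-difference' : ∀ b a → -ᶜ (liftᶜ b +ᶜ (-ᶜ liftᶜ a)) ≡ liftᶜ a +ᶜ (-ᶜ liftᶜ b)
    swap-difference' b a = swap-difference a b
    cancel : ∀ w → (0ℤ ℤ.- w) ℤ.+ w ≡ 0ℤ
    cancel = solve-∀
    restore : ∀ a b → (a ⊕ ⊖ b) ⊕ b ≡ a
    restore a b = solve (a ∷ b ∷ []) ((v0 ⊟ v1) ⊞ v1) v0 refl
    wrap≡1 : ∀ {a b} → a ≺ b → wrap (a ⊕ ⊖ b) b ≡ 1
    wrap≡1 {a} {b} h = δ≡1 (subst (_≺ b) (sym (restore a b)) h)
    descend : ∀ a b → wrap (a ⊕ ⊖ b) b ≢ 0 → a ≺ b
    descend a b ne with em {a ≺ b}
    ... | yes h = h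
    ... | no ¬h = contradiction (δ≡0 (subst (λ z → ¬ z ≺ b) (sym (restore a b)) ¬h)) ne
    lift-proj : ∀ x → NonNegᶜ x → Pos (𝟙ᶜ +ᶜ (-ᶜ x)) → liftᶜ (proj₁ x) ≡ x
    lift-proj (a , + zero) _ _ = refl
    lift-proj (a , + suc n) _ q = contradiction
      (subst NonNegᶜ (sym (trans (cong -ᶜ_ (sym (swap (a , + suc n))))
        (trans (solveᶜ (((a , + suc n) +ᶜ (-ᶜ 𝟙ᶜ)) ∷ []) (⊟ᶜ (⊟ᶜ u0)) u0 refl) (below-𝟙 a (+ suc n))))) (ℤ.+≤+ ℕ.z≤n)) q

module CoverProperties (G : OrientedAbelianGroup) (em : ExcludedMiddle 0ℓ) (Ũ : UniversalCover G em) where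
  open OrientedAbelianGroup G hiding (Carrier)
  open UniversalCover Ũ public
  open OrderedGroup cover public
  open OrderedGroupProperties cover em public
  private
    module 𝔾 = CyclicOrder G em
    infixr 7 _∙_
    _∙_ = _·_ G

  π-0 : π 0# ≡ 𝟘
  π-0 = 𝔾.⊕-cancelʳ (π 0#) (trans (sym (π-+ 0# 0#)) (trans (cong π (solve [] (zer ⊞ zer) zer refl)) (sym (⊕-identityˡ _))))

  π-neg : ∀ x → π (- x) ≡ ⊖ π x
  π-neg x = 𝔾.⊕-cancelʳ (π x) (trans (sym (π-+ (- x) x))
    (trans (cong π (solve (x ∷ []) (⊟ v0 ⊞ v0) zer refl)) (trans π-0 (sym (⊖-inverseˡ (π x))))))

  π-• : ∀ n x → π (+ n • x) ≡ n ∙ π x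
  π-• zero x = π-0
  π-• (suc n) x = trans (π-+ x (+ n • x)) (cong (π x ⊕_) (π-• n x))

  ∙-𝟘 : ∀ n → n ∙ 𝟘 ≡ 𝟘
  ∙-𝟘 zero = refl
  ∙-𝟘 (suc n) = trans (⊕-identityˡ _) (∙-𝟘 n)

  π-•𝟙 : ∀ k → π (k • 𝟙) ≡ 𝟘
  π-•𝟙 (+ n) = trans (π-• n 𝟙) (trans (cong (n ∙_) π-𝟙) (∙-𝟘 n))
  π-•𝟙 -[1+ n ] = trans (π-neg (+ suc n • 𝟙)) (trans (cong ⊖_ (π-•𝟙 (+ suc n))) (𝔾.solve [] (𝔾.⊟ 𝔾.zer) 𝔾.zer refl))

  pos-𝟙 : Pos 𝟙
  pos-𝟙 = pos-resp (solve (𝟙 ∷ lift 𝟘 ∷ []) ((v0 ⊟ v1) ⊞ v1) v0 refl) (pos-+ʳ (lift<𝟙 𝟘) (lift-nonNeg 𝟘))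

  lift-𝟘 : lift 𝟘 ≡ 0#
  lift-𝟘 = trans (cong lift (sym π-0)) (lift-π nonNeg-0 (pos-resp (solve (𝟙 ∷ []) v0 (v0 ⊟ zer) refl) pos-𝟙))

  lift-pos : ∀ {a} → a ≢ 𝟘 → Pos (lift a)
  lift-pos {a} ne = nonNeg∧≢0⇒pos (lift-nonNeg a) λ e → ne (trans (sym (π-lift a)) (trans (cong π e) π-0))

  ≺⇒pos : ∀ {a b x y} → lift a ≡ x → lift b ≡ y → a 𝔾.≺ b → Pos (y + - x)
  ≺⇒pos refl refl = ≺⇒lift

  pos⇒≺ : ∀ {a b x y} → lift a ≡ x → lift b ≡ y → Pos (y + - x) → a 𝔾.≺ b
  pos⇒≺ refl refl = lift⇒≺

  -- `j` is the integer part of `+ n • lift a` in units of `𝟙`: each of the `n` additions carries at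
  -- most one turn.
  lift-∙ : ∀ n a → ∃ λ j → j ℕ.≤ n × lift (n ∙ a) ≡ + n • lift a + - (+ j • 𝟙)
  lift-∙ zero a = 0 , ℕ.z≤n , trans lift-𝟘 (solve [] zer (zer ⊟ zer) refl)
  lift-∙ (suc n) a with lift-∙ n a | lift-⊕ a (n ∙ a)
  ... | j , j≤n , e | w , w≤1 , e' = w ℕ.+ j , ℕ.+-mono-≤ (bound w≤1) j≤n , eq
    where
    bound : ∀ {w} → w ≡ 0 ⊎ w ≡ 1 → w ℕ.≤ 1
    bound (inj₁ refl) = ℕ.z≤n
    bound (inj₂ refl) = ℕ.≤-refl
    open ≡-Reasoning
    y = lift (a ⊕ n ∙ a)
    eq : y ≡ (lift a + + n • lift a) + - (+ (w ℕ.+ j) • 𝟙)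
    eq = begin
      y
        ≡⟨ solve (y ∷ (+ w • 𝟙) ∷ []) v0 ((v0 ⊞ v1) ⊟ v1) refl ⟩
      (y + + w • 𝟙) + - (+ w • 𝟙)
        ≡⟨ cong (λ z → z + - (+ w • 𝟙)) (sym e') ⟩
      (lift a + lift (n ∙ a)) + - (+ w • 𝟙)
        ≡⟨ cong (λ z → (lift a + z) + - (+ w • 𝟙)) e ⟩
      (lift a + (+ n • lift a + - (+ j • 𝟙))) + - (+ w • 𝟙)
        ≡⟨ solve (lift a ∷ (+ n • lift a) ∷ (+ j • 𝟙) ∷ (+ w • 𝟙) ∷ []) ((v0 ⊞ (v1 ⊟ v2)) ⊟ v3) ((v0 ⊞ v1) ⊟ (v3 ⊞ v2)) refl ⟩
      (lift a + + n • lift a) + - (+ w • 𝟙 + + j • 𝟙)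
        ≡⟨ cong (λ z → (lift a + + n • lift a) + - z) (sym (+-• (+ w) (+ j) 𝟙)) ⟩
      (lift a + + n • lift a) + - (+ (w ℕ.+ j) • 𝟙) ∎

-- Density and divisibility in the cover

module Density (G : OrientedAbelianGroup) (em : ExcludedMiddle 0ℓ) (Ũ : UniversalCover G em)
  (regularlyDense : RegularlyDense G) (primeDivisible : ∀ p → Prime p → ∀ a → ∃ λ c → a ≡ _·_ G p c)
  (nontrivial : ∃ λ a → a ≢ OrientedAbelianGroup.𝟘 G) where
  open CoverProperties G em Ũ
  open OrientedAbelianGroup G hiding (Carrier)
  private
    module 𝔾 = CyclicOrder G em
    infixr 7 _∙_
    _∙_ = _·_ G

  -- The monotonicity clause of regular density says that no carry occurs on the way from `c` to
  -- `p ∙ c`, so that lifting commutes with these multiples.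
  lift-∙-increasing : ∀ p c → (∀ i → 1 ℕ.≤ i → i ℕ.< p → _<₀_ G (i ∙ c) (suc i ∙ c)) →
    ∀ i → suc i ℕ.≤ p → lift (suc i ∙ c) ≡ + suc i • lift c
  lift-∙-increasing p c inc zero _ = trans (cong lift (𝔾.⊕-identityʳ c)) (sym (1-• _))
  lift-∙-increasing p c inc (suc i) i<p with inc (suc i) (ℕ.s≤s ℕ.z≤n) i<p
  ... | ne , o = trans (lift-⊕-ascent c (suc i ∙ c) (𝔾.≺-asym (ne , inj₂ o)))
                   (cong (λ z → lift c + z) (lift-∙-increasing p c inc i (ℕ.<⇒≤ i<p)))

  -- Regular density read through `lift`. It speaks only of intervals strictly between 0 and `𝟙`;
  -- intervals that meet ℤ𝟙 require the approximations below.
  dense-in-fundamental-domain : ∀ p → Prime p → ∀ {x y} → Pos x → Pos (y + - x) → Pos (𝟙 + - y) →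
    ∃ λ c → Pos (+ p • c + - x) × Pos (y + - (+ p • c))
  dense-in-fundamental-domain p@(suc i) pr {x} {y} 0<x x<y y<𝟙 = lift c ,
    ≺⇒pos x≡ pc≡ (proj₁ between) , ≺⇒pos pc≡ y≡ (proj₂ between)
    where
    0<y : Pos y
    0<y = pos-resp (solve (x ∷ y ∷ []) (v0 ⊞ (v1 ⊟ v0)) v1 refl) (pos-+ 0<x x<y)
    x<𝟙 : Pos (𝟙 + - x)
    x<𝟙 = pos-resp (solve (x ∷ y ∷ 𝟙 ∷ []) ((v1 ⊟ v0) ⊞ (v2 ⊟ v1)) (v2 ⊟ v0) refl) (pos-+ x<y y<𝟙)
    x≡ : lift (π x) ≡ x
    x≡ = lift-π (pos⇒nonNeg 0<x) x<𝟙
    y≡ : lift (π y) ≡ y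
    y≡ = lift-π (pos⇒nonNeg 0<y) y<𝟙
    ordered : π x 𝔾.≺ π y
    ordered = pos⇒≺ x≡ y≡ x<y
    0≺ : 𝟘 𝔾.≺ π x
    0≺ = (λ e → pos⇒≢0 0<x (trans (sym x≡) (trans (cong lift (sym e)) lift-𝟘))) , inj₁ refl
    witness = regularlyDense p pr (π x) (π y) (𝔾.ascending⇒O 0≺ ordered)
    c = proj₁ witness
    pc≡ : lift (p ∙ c) ≡ + p • lift c
    pc≡ = lift-∙-increasing p c (proj₂ (proj₂ witness)) i ℕ.≤-refl
    between : π x 𝔾.≺ p ∙ c × p ∙ c 𝔾.≺ π y
    between = 𝔾.O-between ordered (proj₁ (proj₂ witness))

  -- Take a half of `b`: if it were `𝟘` or `b`, then `b` would vanish.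
  other-element : ∀ {b} → b ≢ 𝟘 → ∃ λ c → c ≢ 𝟘 × c ≢ b
  other-element {b} b≢𝟘 with primeDivisible 2 prime[2] b
  ... | c , b≡2c = c
    , (λ e → b≢𝟘 (trans b≡2c (trans (cong (2 ∙_) e) (∙-𝟘 2))))
    , (λ e → b≢𝟘 (𝔾.⊕-cancelʳ b (trans (cong (λ z → b ⊕ z) (sym (𝔾.⊕-identityʳ b)))
        (trans (sym (trans b≡2c (cong (2 ∙_) e))) (sym (⊕-identityˡ b))))))

  -- A third element of A lifts to some `g > b`, and leastness of `b` applied to `g - b` gives
  -- `b + b ≤ g < 𝟙`.
  twice-least<𝟙 : ∀ {b} → Pos b → Pos (𝟙 + - b) → (∀ {e} → Pos e → NonNeg (e + - b)) → Pos (𝟙 + - (b + b))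
  twice-least<𝟙 {b} 0<b b<𝟙 least =
    pos-resp (solve (𝟙 ∷ b ∷ g ∷ []) ((v0 ⊟ v2) ⊞ ((v2 ⊟ v1) ⊟ v1)) (v0 ⊟ (v1 ⊞ v1)) refl)
      (pos-+ʳ (lift<𝟙 c) (least b<g))
    where
    lift-πb : lift (π b) ≡ b
    lift-πb = lift-π (pos⇒nonNeg 0<b) b<𝟙
    other : ∃ λ c → c ≢ 𝟘 × c ≢ π b
    other = other-element λ e → pos⇒≢0 0<b (trans (sym lift-πb) (trans (cong lift e) lift-𝟘))
    c = proj₁ other
    g = lift c
    g≢b : g + - b ≢ 0#
    g≢b e = proj₂ (proj₂ other) (trans (sym (π-lift c)) (cong π
      (trans (solve (g ∷ b ∷ []) v0 ((v0 ⊟ v1) ⊞ v1) refl)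
        (trans (cong (λ z → z + b) e) (solve (b ∷ []) (zer ⊞ v0) v0 refl)))))
    b<g : Pos (g + - b)
    b<g = nonNeg∧≢0⇒pos (least (lift-pos (proj₁ (proj₂ other)))) g≢b

  -- If b were the least positive element, nothing would lie between b and 2b.
  no-least-positive : ∀ {b} → Pos b → Pos (𝟙 + - b) → ∃ λ e → Pos e × Pos (b + - e)
  no-least-positive {b} 0<b b<𝟙 = dne λ none →
    refute none (twice-least<𝟙 0<b b<𝟙 λ {e} 0<e →
      nonNeg-resp (solve (b ∷ e ∷ []) (⊟ (v0 ⊟ v1)) (v1 ⊟ v0) refl) (¬pos⇒nonNeg λ e<b → none (e , 0<e , e<b)))
    where
    refute : ¬ (∃ λ e → Pos e × Pos (b + - e)) → ¬ Pos (𝟙 + - (b + b))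
    refute none 2b<𝟙 with dense-in-fundamental-domain 2 prime[2] 0<b
      (pos-resp (solve (b ∷ []) v0 ((v0 ⊞ v0) ⊟ v0) refl) 0<b) 2b<𝟙
    ... | d , b<2d , 2d<2b = none (_ , b<2d , pos-resp (solve (b ∷ (+ 2 • d) ∷ []) ((v0 ⊞ v0) ⊟ v1) (v0 ⊟ (v1 ⊟ v0)) refl) 2d<2b)

  -- The cover extends beyond `𝟙`: for `ε ≥ 𝟙` the lift of any non-zero element of A is small
  -- enough.
  shrink : ∀ {ε} → Pos ε → ∃ λ e → Pos e × Pos (ε + - e) × Pos (𝟙 + - e)
  shrink {ε} 0<ε with em {Pos (𝟙 + - ε)}
  ... | yes ε<𝟙 =
    let e , 0<e , e<ε = no-least-positive 0<ε ε<𝟙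
    in e , 0<e , e<ε , pos-resp (solve (𝟙 ∷ ε ∷ e ∷ []) ((v0 ⊟ v1) ⊞ (v1 ⊟ v2)) (v0 ⊟ v2) refl) (pos-+ ε<𝟙 e<ε)
  ... | no ε≮𝟙 =
    let a , a≢𝟘 = nontrivial
    in lift a , lift-pos a≢𝟘 ,
      pos-resp (solve (𝟙 ∷ ε ∷ lift a ∷ []) ((v0 ⊟ v2) ⊞ (⊟ (v0 ⊟ v1))) (v1 ⊟ v2) refl)
        (pos-+ʳ (lift<𝟙 a) (¬pos⇒nonNeg ε≮𝟙)) , lift<𝟙 a

  -- Of the parts `e` and `ε - e` the smaller one is at most half of `ε`; no exact division is
  -- needed.
  halve : ∀ {ε} → Pos ε → ∃ λ e → Pos e × NonNeg (ε + - (e + e))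
  halve {ε} 0<ε with shrink 0<ε
  ... | e , 0<e , e<ε , _ with nonNeg-total (ε + - (e + e))
  ...   | inj₁ h = e , 0<e , h
  ...   | inj₂ h = ε + - e , e<ε ,
          nonNeg-resp (solve (ε ∷ e ∷ []) (⊟ (v0 ⊟ (v1 ⊞ v1))) (v0 ⊟ ((v0 ⊟ v1) ⊞ (v0 ⊟ v1))) refl) h

  module _ (p : ℕ) (pr : Prime p) where

    -- `k • 𝟙` is a limit from above of multiples of `p`. Since every element lies in pU + ℤ𝟙, this
    -- at the integers is density of pU everywhere.
    Approximable : ℤ → Set
    Approximable k = ∀ {ε} → Pos ε → ∃ λ c → Pos (+ p • c + - (k • 𝟙)) × Pos (ε + - (+ p • c + - (k • 𝟙)))

    approximable-0 : Approximable 0ℤ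
    approximable-0 {ε} 0<ε =
      let e , 0<e , e<ε , e<𝟙 = shrink 0<ε
          e' , 0<e' , e'<e , _ = shrink 0<e
          c , e'<pc , pc<e = dense-in-fundamental-domain p pr 0<e' e'<e e<𝟙
          P = + p • c
      in c , pos-resp (solve (e' ∷ P ∷ []) (v0 ⊞ (v1 ⊟ v0)) (v1 ⊟ zer) refl) (pos-+ 0<e' e'<pc)
           , pos-resp (solve (ε ∷ e ∷ P ∷ []) ((v0 ⊟ v1) ⊞ (v1 ⊟ v2)) (v0 ⊟ (v2 ⊟ zer)) refl) (pos-+ e<ε pc<e)

    -- The interval from `𝟙 - e` to `𝟙 - e'` with `0 < e' < e` ends strictly before `𝟙`, as density
    -- in the fundamental domain demands.
    near-𝟙 : ∀ {e} → Pos e → Pos (𝟙 + - e) → ∃ λ c → Pos (𝟙 + - (+ p • c)) × Pos (e + - (𝟙 + - (+ p • c)))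
    near-𝟙 {e} 0<e e<𝟙 =
      let e' , 0<e' , e'<e , _ = shrink 0<e
          c , below , above = dense-in-fundamental-domain p pr e<𝟙
            (pos-resp (solve (𝟙 ∷ e ∷ e' ∷ []) (v1 ⊟ v2) ((v0 ⊟ v2) ⊟ (v0 ⊟ v1)) refl) e'<e)
            (pos-resp (solve (𝟙 ∷ e' ∷ []) v1 (v0 ⊟ (v0 ⊟ v1)) refl) 0<e')
          P = + p • c
      in c , pos-resp (solve (𝟙 ∷ e' ∷ P ∷ []) (v1 ⊞ ((v0 ⊟ v1) ⊟ v2)) (v0 ⊟ v2) refl) (pos-+ 0<e' above)
           , pos-resp (solve (𝟙 ∷ e ∷ P ∷ []) (v2 ⊟ (v0 ⊟ v1)) (v1 ⊟ (v0 ⊟ v2)) refl) below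

    -- Negation turns multiples just below `𝟙` into multiples just above `- 𝟙`.
    approximable--1 : Approximable -1ℤ
    approximable--1 {ε} 0<ε =
      let e , 0<e , e<ε , e<𝟙 = shrink 0<ε
          c , 0<θ , θ<e = near-𝟙 0<e e<𝟙
          P = + p • c
          θ≡ : 𝟙 + - P ≡ + p • (- c) + - (-1ℤ • 𝟙)
          -- `-1ℤ • 𝟙` unfolds to `- (𝟙 + 0#)`, the shape given to the solver.
          θ≡ = trans (solve (𝟙 ∷ P ∷ []) (v0 ⊟ v1) ((⊟ v1) ⊟ (⊟ (v0 ⊞ zer))) refl)
                 (cong (λ z → z + - (-1ℤ • 𝟙)) (sym (•-neg (+ p) c)))
      in - c , pos-resp θ≡ 0<θ , pos-resp (trans (solve (ε ∷ e ∷ (𝟙 + - P) ∷ []) ((v0 ⊟ v1) ⊞ (v1 ⊟ v2)) (v0 ⊟ v2) refl)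
                                    (cong (λ z → ε + - z) θ≡)) (pos-+ e<ε θ<e)

    -- To a multiple `𝟙 - θ` just below `𝟙`, add a small multiple that slightly exceeds the gap `θ`.
    approximable-1 : Approximable 1ℤ
    approximable-1 {ε} 0<ε =
      let e , 0<e , e<ε , e<𝟙 = shrink 0<ε
          c₁ , 0<θ , θ<e = near-𝟙 0<e e<𝟙
          c₂ , θ<pc₂ , pc₂<e = dense-in-fundamental-domain p pr 0<θ θ<e e<𝟙
          P₁ = + p • c₁
          P₂ = + p • c₂
          sum≡ : P₂ + - (𝟙 + - P₁) ≡ + p • (c₁ + c₂) + - (1ℤ • 𝟙)
          sum≡ = trans (solve (𝟙 ∷ P₁ ∷ P₂ ∷ []) (v2 ⊟ (v0 ⊟ v1)) ((v1 ⊞ v2) ⊟ (v0 ⊞ zer)) refl)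
                   (cong (λ z → z + - (1ℤ • 𝟙)) (sym (•-+ (+ p) c₁ c₂)))
      in c₁ + c₂ , pos-resp sum≡ θ<pc₂
           , pos-resp (trans (solve (ε ∷ e ∷ P₂ ∷ (𝟙 + - P₁) ∷ []) (((v0 ⊟ v1) ⊞ (v1 ⊟ v2)) ⊞ v3) (v0 ⊟ (v2 ⊟ v3)) refl)
               (cong (λ z → ε + - z) sum≡)) (pos-+ (pos-+ e<ε pc₂<e) 0<θ)

    approximable-+ : ∀ j k → Approximable j → Approximable k → Approximable (j ℤ.+ k)
    approximable-+ j k f g {ε} 0<ε =
      let e , 0<e , 2e≤ε = halve 0<ε
          c , lo , hi = f 0<e
          d , lo' , hi' = g 0<e
          C = + p • c
          D = + p • d
          J = j • 𝟙
          K = k • 𝟙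
          sum≡ : (C + - J) + (D + - K) ≡ + p • (c + d) + - ((j ℤ.+ k) • 𝟙)
          sum≡ = trans (solve (C ∷ J ∷ D ∷ K ∷ []) ((v0 ⊟ v1) ⊞ (v2 ⊟ v3)) ((v0 ⊞ v2) ⊟ (v1 ⊞ v3)) refl)
                   (cong₂ (λ s t → s + - t) (sym (•-+ (+ p) c d)) (sym (+-• j k 𝟙)))
      in c + d , pos-resp sum≡ (pos-+ lo lo')
           , pos-resp (trans (solve (ε ∷ e ∷ (C + - J) ∷ (D + - K) ∷ []) (((v1 ⊟ v2) ⊞ (v1 ⊟ v3)) ⊞ (v0 ⊟ (v1 ⊞ v1))) (v0 ⊟ (v2 ⊞ v3)) refl)
               (cong (λ z → ε + - z) sum≡)) (pos-+ʳ (pos-+ hi hi') 2e≤ε)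

    approximable : ∀ k → Approximable k
    approximable (+ zero) = approximable-0
    approximable (+ suc n) = approximable-+ 1ℤ (+ n) approximable-1 (approximable (+ n))
    approximable -[1+ zero ] = approximable--1
    approximable -[1+ suc n ] = approximable-+ -1ℤ -[1+ n ] approximable--1 (approximable -[1+ n ])

  Dense : ℕ → Set
  Dense n = ∀ {x y} → Pos (y + - x) → ∃ λ c → Pos (+ n • c + - x) × Pos (y + - (+ n • c))

  Divisible : ℕ → Set
  Divisible n = ∀ x → ∃₂ λ w k → x ≡ + n • w + k • 𝟙

  prime-divisible : ∀ p → Prime p → Divisible p
  prime-divisible p pr x with primeDivisible p pr (π x)
  ... | c , e with decompose (x + - (+ p • lift c))
  ...   | k , e' = lift c , k , (begin
      x                                    ≡⟨ solve (x ∷ P ∷ []) v0 (v1 ⊞ (v0 ⊟ v1)) refl ⟩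
      P + (x + - P)                        ≡⟨ cong (λ z → P + z) e' ⟩
      P + (lift (π (x + - P)) + k • 𝟙)     ≡⟨ cong (λ z → P + (lift z + k • 𝟙)) zero-remainder ⟩
      P + (lift 𝟘 + k • 𝟙)                 ≡⟨ cong (λ z → P + (z + k • 𝟙)) lift-𝟘 ⟩
      P + (0# + k • 𝟙)                     ≡⟨ solve (P ∷ (k • 𝟙) ∷ []) (v0 ⊞ (zer ⊞ v1)) (v0 ⊞ v1) refl ⟩
      P + k • 𝟙                            ∎)
    where
    open ≡-Reasoning
    P = + p • lift c
    zero-remainder : π (x + - P) ≡ 𝟘
    zero-remainder = begin
      π (x + - P)         ≡⟨ π-+ x (- P) ⟩
      π x ⊕ π (- P)       ≡⟨ cong (π x ⊕_) (π-neg P) ⟩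
      π x ⊕ ⊖ π P         ≡⟨ cong (λ z → π x ⊕ ⊖ z) (trans (π-• p (lift c)) (trans (cong (p ∙_) (π-lift c)) (sym e))) ⟩
      π x ⊕ ⊖ π x         ≡⟨ 𝔾.solve (π x ∷ []) (𝔾.v0 𝔾.⊟ 𝔾.v0) 𝔾.zer refl ⟩
      𝟘                   ∎

  -- Subtracting `p w` from `x = p w + k 𝟙` leaves the search for a multiple of `p` just above
  -- `k 𝟙`, with tolerance `y - x`.
  prime-dense : ∀ p → Prime p → Dense p
  prime-dense p pr {x} {y} x<y with prime-divisible p pr x
  ... | w , k , e with approximable p pr k x<y
  ...   | c , lo , hi = w + c , pos-resp (trans (solve (P ∷ W ∷ K ∷ []) (v0 ⊟ v2) ((v1 ⊞ v0) ⊟ (v1 ⊞ v2)) refl) (sym (cong₂ (λ s t → s + - t) (•-+ (+ p) w c) e))) lo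
                          , pos-resp hi≡ hi
    where
    open ≡-Reasoning
    P = + p • c
    W = + p • w
    K = k • 𝟙
    hi≡ : (y + - x) + - (P + - K) ≡ y + - (+ p • (w + c))
    hi≡ = begin
      (y + - x) + - (P + - K)          ≡⟨ cong (λ z → (y + - z) + - (P + - K)) e ⟩
      (y + - (W + K)) + - (P + - K)    ≡⟨ solve (y ∷ W ∷ K ∷ P ∷ []) ((v0 ⊟ (v1 ⊞ v2)) ⊟ (v3 ⊟ v2)) (v0 ⊟ (v1 ⊞ v3)) refl ⟩
      y + - (W + P)                    ≡⟨ cong (λ z → y + - z) (•-+ (+ p) w c) ⟨
      y + - (+ p • (w + c))            ∎

  pos-*-• : ∀ m n x → + (m ℕ.* n) • x ≡ + m • (+ n • x)
  pos-*-• m n x = trans (cong (_• x) (ℤ.pos-* m n)) (*-• (+ m) (+ n) x)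

  -- Two multiples `m v < m v'` inside the interval reduce the claim to the density of the multiples
  -- of `n` between `v` and `v'`.
  dense-* : ∀ m n .{{_ : ℕ.NonZero m}} → Dense m → Dense n → Dense (m ℕ.* n)
  dense-* m n f g {x} {y} x<y =
    let v , x<mv , mv<y = f x<y
        v' , mv<mv' , mv'<y = f mv<y
        c , v<nc , nc<v' = g {v} {v'} (pos-•⁻¹ m (pos-resp (sym (scale v' v)) mv<mv'))
        mn≡ = sym (pos-*-• m n c)
    in c , pos-resp (trans (solve ((+ m • v) ∷ x ∷ (+ m • (+ n • c)) ∷ []) ((v0 ⊟ v1) ⊞ (v2 ⊟ v0)) (v2 ⊟ v1) refl)
                       (cong (λ z → z + - x) mn≡))
             (pos-+ x<mv (pos-resp (scale (+ n • c) v) (pos-• m v<nc)))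
         , pos-resp (trans (solve ((+ m • v') ∷ y ∷ (+ m • (+ n • c)) ∷ []) ((v1 ⊟ v0) ⊞ (v0 ⊟ v2)) (v1 ⊟ v2) refl)
                       (cong (λ z → y + - z) mn≡))
             (pos-+ mv'<y (pos-resp (scale v' (+ n • c)) (pos-• m nc<v')))
    where
    scale : ∀ s t → + m • (s + - t) ≡ + m • s + - (+ m • t)
    scale s t = trans (•-+ (+ m) s (- t)) (cong (λ z → + m • s + z) (•-neg (+ m) t))

  divisible-* : ∀ m n → Divisible m → Divisible n → Divisible (m ℕ.* n)
  divisible-* m n f g x with f x
  ... | w , k , e with g w
  ...   | w' , k' , e' = w' , + m ℤ.* k' ℤ.+ k , (begin
      x                                               ≡⟨ e ⟩
      + m • w + k • 𝟙                                 ≡⟨ cong (λ z → + m • z + k • 𝟙) e' ⟩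
      + m • (+ n • w' + k' • 𝟙) + k • 𝟙               ≡⟨ cong (λ z → z + k • 𝟙) (•-+ (+ m) _ _) ⟩
      (+ m • (+ n • w') + + m • (k' • 𝟙)) + k • 𝟙     ≡⟨ solve ((+ m • (+ n • w')) ∷ (+ m • (k' • 𝟙)) ∷ (k • 𝟙) ∷ []) ((v0 ⊞ v1) ⊞ v2) (v0 ⊞ (v1 ⊞ v2)) refl ⟩
      + m • (+ n • w') + (+ m • (k' • 𝟙) + k • 𝟙)     ≡⟨ cong₂ (λ s t → s + (t + k • 𝟙)) (pos-*-• m n w') (*-• (+ m) k' 𝟙) ⟨
      + (m ℕ.* n) • w' + ((+ m ℤ.* k') • 𝟙 + k • 𝟙)   ≡⟨ cong (λ z → + (m ℕ.* n) • w' + z) (+-• (+ m ℤ.* k') k 𝟙) ⟨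
      + (m ℕ.* n) • w' + (+ m ℤ.* k' ℤ.+ k) • 𝟙       ∎)
    where open ≡-Reasoning

  dense-1 : Dense 1
  dense-1 {x} {y} x<y with shrink x<y
  ... | e , 0<e , e<y-x , _ = x + e ,
    pos-resp (solve (x ∷ e ∷ []) v1 (((v0 ⊞ v1) ⊞ zer) ⊟ v0) refl) 0<e ,
    pos-resp (solve (x ∷ e ∷ y ∷ []) ((v2 ⊟ v0) ⊟ v1) (v2 ⊟ ((v0 ⊞ v1) ⊞ zer)) refl) e<y-x

  divisible-1 : Divisible 1
  divisible-1 x = x , 0ℤ , solve (x ∷ []) v0 ((v0 ⊞ zer) ⊞ zer) refl

  dense-product : ∀ {ps} → All Prime ps → Dense (product ps)
  dense-product [] = dense-1
  dense-product {p ∷ ps} (pr ∷ prs) =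
    dense-* p (product ps) {{prime⇒nonZero pr}} (prime-dense p pr) (dense-product prs)

  divisible-product : ∀ {ps} → All Prime ps → Divisible (product ps)
  divisible-product [] = divisible-1
  divisible-product {p ∷ ps} (pr ∷ prs) = divisible-* p (product ps) (prime-divisible p pr) (divisible-product prs)

  dense : ∀ n .{{_ : ℕ.NonZero n}} → Dense n
  dense n = subst Dense (sym isFactorisation) (dense-product factorsPrime)
    where open PrimeFactorisation (factorise n)

  divisible : ∀ n .{{_ : ℕ.NonZero n}} → Divisible n
  divisible n = subst Divisible (sym isFactorisation) (divisible-product factorsPrime)
    where open PrimeFactorisation (factorise n)

-- Bounded coefficient vectors and maxima over finite lists

Bounded : ∀ {n} → ℕ → Vec ℤ n → Set
Bounded N = VecAll.All (λ k → ∣ k ∣ ℕ.≤ N)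

bounded-mono : ∀ {n N N'} {m : Vec ℤ n} → N ℕ.≤ N' → Bounded N m → Bounded N' m
bounded-mono N≤N' = VecAll.map (λ b → ℕ.≤-trans b N≤N')

bounded-+ : ∀ {n N N'} {m m' : Vec ℤ n} → Bounded N m → Bounded N' m' → Bounded (N ℕ.+ N') (m +ᵛ m')
bounded-+ [] [] = []
bounded-+ {m = k ∷ _} {k' ∷ _} (b ∷ bs) (b' ∷ bs') =
  ℕ.≤-trans (ℤ.∣i+j∣≤∣i∣+∣j∣ k k') (ℕ.+-mono-≤ b b') ∷ bounded-+ bs bs'

bounded-neg : ∀ {n N} {m : Vec ℤ n} → Bounded N m → Bounded N (-ᵛ m)
bounded-neg [] = []
bounded-neg {m = k ∷ _} (b ∷ bs) = subst (ℕ._≤ _) (sym (ℤ.∣-i∣≡∣i∣ k)) b ∷ bounded-neg bs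

bounded-* : ∀ {n N K} k {m : Vec ℤ n} → ∣ k ∣ ℕ.≤ K → Bounded N m → Bounded (K ℕ.* N) (k *ᵛ m)
bounded-* k k≤K [] = []
bounded-* k {j ∷ _} k≤K (b ∷ bs) =
  subst (ℕ._≤ _) (sym (ℤ.abs-* k j)) (ℕ.*-mono-≤ k≤K b) ∷ bounded-* k k≤K bs

bounded-0 : ∀ {N} n → Bounded N (0ᵛ {n})
bounded-0 zero = []
bounded-0 (suc n) = ℕ.z≤n ∷ bounded-0 n

bounded-unit : ∀ {n} (i : Fin n) → Bounded 1 (unit i)
bounded-unit {suc n} zero = ℕ.≤-refl ∷ bounded-0 n
bounded-unit (suc i) = ℕ.z≤n ∷ bounded-unit i

bounded-erase : ∀ {n N} {m : Vec ℤ n} (i : Fin n) → Bounded N m → Bounded N (m Vec.[ i ]≔ 0ℤ)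
bounded-erase zero (b ∷ bs) = ℕ.z≤n ∷ bs
bounded-erase (suc i) (b ∷ bs) = b ∷ bounded-erase i bs

intsUpTo : ℕ → List ℤ
intsUpTo N = List.map +_ (List.upTo (suc N)) List.++ List.map (λ n → ℤ.- + n) (List.upTo (suc N))

∈-intsUpTo⁺ : ∀ {N} k → ∣ k ∣ ℕ.≤ N → k ∈ intsUpTo N
∈-intsUpTo⁺ (+ n) b = ∈-++⁺ˡ (∈-map⁺ +_ (∈-upTo⁺ (ℕ.s≤s b)))
∈-intsUpTo⁺ {N} -[1+ n ] b = ∈-++⁺ʳ (List.map +_ (List.upTo (suc N))) (∈-map⁺ (λ n → ℤ.- + n) (∈-upTo⁺ (ℕ.s≤s b)))

∈-intsUpTo⁻ : ∀ {N k} → k ∈ intsUpTo N → ∣ k ∣ ℕ.≤ N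
∈-intsUpTo⁻ {N} k∈ with ∈-++⁻ (List.map +_ (List.upTo (suc N))) k∈
... | inj₁ p with ∈-map⁻ +_ p
...   | n , n∈ , refl = ℕ.≤-pred (∈-upTo⁻ n∈)
∈-intsUpTo⁻ {N} k∈ | inj₂ p with ∈-map⁻ (λ n → ℤ.- + n) p
...   | n , n∈ , refl = subst (ℕ._≤ N) (sym (ℤ.∣-i∣≡∣i∣ (+ n))) (ℕ.≤-pred (∈-upTo⁻ n∈))

box : ∀ n → ℕ → List (Vec ℤ n)
box zero N = [] ∷ []
box (suc n) N = List.cartesianProductWith _∷_ (intsUpTo N) (box n N)

∈-box⁺ : ∀ {n N} {m : Vec ℤ n} → Bounded N m → m ∈ box n N
∈-box⁺ [] = here refl
∈-box⁺ {m = k ∷ _} (b ∷ bs) = ∈-cartesianProductWith⁺ _∷_ (∈-intsUpTo⁺ k b) (∈-box⁺ bs)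

∈-box⁻ : ∀ n {N} {m : Vec ℤ n} → m ∈ box n N → Bounded N m
∈-box⁻ zero {m = []} _ = []
∈-box⁻ (suc n) {N} m∈ with ∈-cartesianProductWith⁻ _∷_ (intsUpTo N) (box n N) m∈
... | k , m , k∈ , m∈' , refl = ∈-intsUpTo⁻ k∈ ∷ ∈-box⁻ n m∈'

maximum : ExcludedMiddle 0ℓ → {X : Set} (_≲_ : X → X → Set) → (∀ {x y z} → x ≲ y → y ≲ z → x ≲ z) →
  (∀ x y → x ≲ y ⊎ y ≲ x) → (P : X → Set) (xs : List X) → (∃ λ x → x ∈ xs × P x) →
  ∃ λ x → x ∈ xs × P x × (∀ {y} → y ∈ xs → P y → y ≲ x)
maximum em _≲_ ≲-trans ≲-total P [] (_ , () , _)
maximum em _≲_ ≲-trans ≲-total P (x ∷ xs) some with em {∃ λ y → y ∈ xs × P y} | em {P x}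
... | no none | no ¬px = contradiction some λ { (_ , here refl , py) → ¬px py ; (y , there y∈ , py) → none (y , y∈ , py) }
... | no none | yes px = x , here refl , px , λ { (here refl) _ → Sum.reduce (≲-total x x) ; (there y∈) py → contradiction (_ , y∈ , py) none }
... | yes rest | no ¬px with maximum em _≲_ ≲-trans ≲-total P xs rest
...   | m , m∈ , pm , max = m , there m∈ , pm , λ { (here refl) px → contradiction px ¬px ; (there y∈) py → max y∈ py }
maximum em _≲_ ≲-trans ≲-total P (x ∷ xs) some | yes rest | yes px with maximum em _≲_ ≲-trans ≲-total P xs rest
... | m , m∈ , pm , max with ≲-total x m
...   | inj₁ x≲m = m , there m∈ , pm , λ { (here refl) _ → x≲m ; (there y∈) py → max y∈ py }
...   | inj₂ m≲x = x , here refl , px , λ { (here refl) _ → Sum.reduce (≲-total x x) ; (there y∈) py → ≲-trans (max y∈ py) m≲x }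

-- One step of the back-and-forth argument

module BackAndForth (G : OrientedAbelianGroup) (em : ExcludedMiddle 0ℓ) (Ũ : UniversalCover G em)
  (regularlyDense : RegularlyDense G) (primeDivisible : ∀ p → Prime p → ∀ a → ∃ λ c → a ≡ _·_ G p c)
  (nontrivial : ∃ λ a → a ≢ OrientedAbelianGroup.𝟘 G) where
  open CoverProperties G em Ũ
  open Density G em Ũ regularlyDense primeDivisible nontrivial

  -- For `M ≥ 1` this is `x - y ∈ M U`, because every element is congruent modulo M U to an integral
  -- multiple of `𝟙`.
  record Congruent (M : ℕ) (x y : Carrier) : Set where
    constructor congruentBy
    field
      residue : ℤ
      quotientˡ quotientʳ : Carrier
      decompositionˡ : x ≡ residue • 𝟙 + + M • quotientˡ
      decompositionʳ : y ≡ residue • 𝟙 + + M • quotientʳ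

  congruent-sym : ∀ {M x y} → Congruent M x y → Congruent M y x
  congruent-sym (congruentBy k w w' p q) = congruentBy k w' w q p

  congruent-∣ : ∀ {M M' x y} → M ∣ M' → Congruent M' x y → Congruent M x y
  congruent-∣ {M} (divides q refl) (congruentBy k w w' p p') = congruentBy k (+ q • w) (+ q • w') (trans p (eq w)) (trans p' (eq w'))
    where
    eq : ∀ w → k • 𝟙 + + (q ℕ.* M) • w ≡ k • 𝟙 + + M • (+ q • w)
    eq w = cong (λ z → k • 𝟙 + z) (trans (cong (λ n → + n • w) (ℕ.*-comm q M)) (pos-*-• M q w))

  congruent-refl : ∀ M .{{_ : ℕ.NonZero M}} x → Congruent M x x
  congruent-refl M x with divisible M x
  ... | w , k , e = congruentBy k w w e' e'
    where e' = trans e (solve ((+ M • w) ∷ (k • 𝟙) ∷ []) (v0 ⊞ v1) (v1 ⊞ v0) refl)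

  congruent-+ : ∀ {M x x' y y'} → Congruent M x x' → Congruent M y y' → Congruent M (x + y) (x' + y')
  congruent-+ {M} (congruentBy k w w' refl refl) (congruentBy j v v' refl refl) =
    congruentBy (k ℤ.+ j) (w + v) (w' + v') (eq w v) (eq w' v')
    where
    eq : ∀ w v → (k • 𝟙 + + M • w) + (j • 𝟙 + + M • v) ≡ (k ℤ.+ j) • 𝟙 + + M • (w + v)
    eq w v = trans (solve ((k • 𝟙) ∷ (+ M • w) ∷ (j • 𝟙) ∷ (+ M • v) ∷ []) ((v0 ⊞ v1) ⊞ (v2 ⊞ v3)) ((v0 ⊞ v2) ⊞ (v1 ⊞ v3)) refl)
      (sym (cong₂ _+_ (+-• k j 𝟙) (•-+ (+ M) w v)))

  congruent-• : ∀ {M x x'} j → Congruent M x x' → Congruent M (j • x) (j • x')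
  congruent-• {M} j (congruentBy k w w' refl refl) = congruentBy (j ℤ.* k) (j • w) (j • w') (eq w) (eq w')
    where
    eq : ∀ w → j • (k • 𝟙 + + M • w) ≡ (j ℤ.* k) • 𝟙 + + M • (j • w)
    eq w = trans (•-+ j (k • 𝟙) (+ M • w)) (cong₂ _+_ (sym (*-• j k 𝟙))
      (trans (sym (*-• j (+ M) w)) (trans (cong (_• w) (ℤ.*-comm j (+ M))) (*-• (+ M) j w))))

  congruent-eval : ∀ {n M} (m : Vec ℤ n) {e e'} → (∀ i → Congruent M (e i) (e' i)) → Congruent M (eval m e) (eval m e')
  congruent-eval {M = M} [] c = congruentBy 0ℤ 0# 0# eq eq
    where
    eq : 0# ≡ 0ℤ • 𝟙 + + M • 0#
    eq = sym (trans (cong (λ z → 0# + z) (•-0 (+ M))) (solve [] (zer ⊞ zer) zer refl))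
  congruent-eval (k ∷ m) c = congruent-+ (congruent-• k (c 0)) (congruent-eval m (λ i → c (suc i)))

  -- The back-and-forth relation. The bound `N` and the modulus `M` take the place of a quantifier
  -- rank: each quantifier consumes larger ones and leaves smaller ones.
  record Similar (V N M : ℕ) (e e' : ℕ → Carrier) : Set where
    field
      signs : (m : Vec ℤ V) → Bounded N m → SameSign (eval m e) (eval m e')
      congruent : ∀ i → Congruent M (e i) (e' i)
  open Similar

  similar-sym : ∀ {V N M e e'} → Similar V N M e e' → Similar V N M e' e
  similar-sym s .signs m b = sameSign-sym (signs s m b)
  similar-sym s .congruent i = congruent-sym (congruent s i)

  similar-mono : ∀ {V N N' M M' e e'} → N ℕ.≤ N' → M ∣ M' → Similar V N' M' e e' → Similar V N M e e'
  similar-mono N≤N' M∣M' s .signs m b = signs s m (bounded-mono N≤N' b)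
  similar-mono N≤N' M∣M' s .congruent i = congruent-∣ M∣M' (congruent s i)

  eval-difference : ∀ {n} (m m' : Vec ℤ n) ρ → eval (m +ᵛ -ᵛ m') ρ ≡ eval m ρ + - eval m' ρ
  eval-difference m m' ρ = trans (eval-+ m (-ᵛ m') ρ) (cong (λ z → eval m ρ + z) (eval-neg m' ρ))

  -- Finds the partner of `a` as far as forms with the fixed coefficient `Q` at `a` can tell.
  -- Coefficients up to `L + L` are needed because differences of two admissible forms are compared,
  -- and the modulus `Q * M` because an equation for `Q a'` has to be solved within a residue class
  -- modulo `M`.
  module Transfer (n Q M L : ℕ) {{Q≢0 : ℕ.NonZero Q}} {{M≢0 : ℕ.NonZero M}} (Q≤L : Q ℕ.≤ L)
    {e e' : ℕ → Carrier} (sim : Similar (suc n) (L ℕ.+ L) (Q ℕ.* M) e e') (e0 : e 0 ≡ 𝟙) (e'0 : e' 0 ≡ 𝟙)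
    {a : Carrier} (0≤a : NonNeg a) (a<𝟙 : Pos (𝟙 + - a)) where

    Form : Set
    Form = Vec ℤ (suc n)

    _⟪_⟫_ : Carrier → (ℕ → Carrier) → Form → Carrier
    a ⟪ e ⟫ s = + Q • a + eval s e

    Answer : Set
    Answer = ∃ λ a' → Congruent M a a' × (∀ s → Bounded L s → SameSign (a ⟪ e ⟫ s) (a' ⟪ e' ⟫ s))

    difference-sign : ∀ {s t} → Bounded L s → Bounded L t →
      SameSign (eval s e + - eval t e) (eval s e' + - eval t e')
    difference-sign {s} {t} bs bt = sameSign-resp (eval-difference s t e) (eval-difference s t e')
      (signs sim (s +ᵛ -ᵛ t) (bounded-+ bs (bounded-neg bt)))

    -- If some form `t` vanishes, it pins down `Q a`. By congruence `t` changes from `e` to `e'` by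
    -- a multiple of `Q M`, so moving `a` by `M (v - v')` compensates this exactly and keeps the
    -- residue modulo `M`. Every other sign is then that of a difference `s - t`.
    on-boundary : (∃ λ t → t ∈ box (suc n) L × a ⟪ e ⟫ t ≡ 0#) → Answer
    on-boundary (t , t∈ , zero-at-t) = a' , congruentBy j w w' a≡ refl , same
      where
      open ≡-Reasoning
      decomposition = divisible M a
      w = proj₁ decomposition
      j = proj₁ (proj₂ decomposition)
      a≡ : a ≡ j • 𝟙 + + M • w
      a≡ = trans (proj₂ (proj₂ decomposition)) (solve ((+ M • w) ∷ (j • 𝟙) ∷ []) (v0 ⊞ v1) (v1 ⊞ v0) refl)
      tc : Congruent (Q ℕ.* M) (eval t e) (eval t e')
      tc = congruent-eval t (congruent sim)
      k = Congruent.residue tc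
      v = Congruent.quotientˡ tc
      v' = Congruent.quotientʳ tc
      w' = (w + v) + - v'
      a' = j • 𝟙 + + M • w'
      f : Carrier → Carrier
      f z = + Q • (+ M • z)
      f-+ : ∀ x y → f (x + y) ≡ f x + f y
      f-+ x y = trans (cong (+ Q •_) (•-+ (+ M) x y)) (•-+ (+ Q) _ _)
      f-neg : ∀ x → f (- x) ≡ - f x
      f-neg x = trans (cong (+ Q •_) (•-neg (+ M) x)) (•-neg (+ Q) _)
      F = + Q • (j • 𝟙)
      K = k • 𝟙
      f-w' : f w' ≡ (f w + f v) + - f v'
      f-w' = trans (f-+ (w + v) (- v')) (cong₂ _+_ (f-+ w v) (f-neg v'))
      zero-at-t' : a' ⟪ e' ⟫ t ≡ 0#
      zero-at-t' = begin
        + Q • a' + eval t e'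
          ≡⟨ cong₂ _+_ (•-+ (+ Q) _ _) (Congruent.decompositionʳ tc) ⟩
        (F + f w') + (K + + (Q ℕ.* M) • v')
          ≡⟨ cong₂ (λ y z → (F + y) + (K + z)) f-w' (pos-*-• Q M v') ⟩
        (F + ((f w + f v) + - f v')) + (K + f v')
          ≡⟨ solve (F ∷ f w ∷ f v ∷ f v' ∷ K ∷ []) ((v0 ⊞ ((v1 ⊞ v2) ⊟ v3)) ⊞ (v4 ⊞ v3)) ((v0 ⊞ v1) ⊞ (v4 ⊞ v2)) refl ⟩
        (F + f w) + (K + f v)
          ≡⟨ cong₂ (λ y z → y + (K + z)) (•-+ (+ Q) _ _) (pos-*-• Q M v) ⟨
        + Q • (j • 𝟙 + + M • w) + (K + + (Q ℕ.* M) • v)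
          ≡⟨ cong₂ (λ y z → + Q • y + z) (sym a≡) (sym (Congruent.decompositionˡ tc)) ⟩
        + Q • a + eval t e
          ≡⟨ zero-at-t ⟩
        0# ∎
      shift : ∀ x ρ s → x ⟪ ρ ⟫ t ≡ 0# → eval s ρ + - eval t ρ ≡ x ⟪ ρ ⟫ s
      shift x ρ s zr = begin
        eval s ρ + - eval t ρ
          ≡⟨ solve (eval s ρ ∷ eval t ρ ∷ (+ Q • x) ∷ []) (v0 ⊟ v1) ((v2 ⊞ v0) ⊟ (v2 ⊞ v1)) refl ⟩
        x ⟪ ρ ⟫ s + - (x ⟪ ρ ⟫ t)
          ≡⟨ cong (λ z → x ⟪ ρ ⟫ s + - z) zr ⟩
        x ⟪ ρ ⟫ s + - 0#
          ≡⟨ solve ((x ⟪ ρ ⟫ s) ∷ []) (v0 ⊟ zer) v0 refl ⟩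
        x ⟪ ρ ⟫ s ∎
      same : ∀ s → Bounded L s → SameSign (a ⟪ e ⟫ s) (a' ⟪ e' ⟫ s)
      same s bs = sameSign-resp (shift a e s zero-at-t) (shift a' e' s zero-at-t')
        (difference-sign bs (∈-box⁻ (suc n) t∈))

    module _ (generic : ¬ (∃ λ t → t ∈ box (suc n) L × a ⟪ e ⟫ t ≡ 0#)) where

      Above Below : Form → Set
      Above s = Pos (a ⟪ e ⟫ s)
      Below s = Pos (- (a ⟪ e ⟫ s))

      above-or-below : ∀ {s} → Bounded L s → Above s ⊎ Below s
      above-or-below {s} bs = Sum.map (λ p → nonNeg∧≢0⇒pos p ne)
        (λ p → nonNeg∧≢0⇒pos p λ z → ne (trans (solve ((a ⟪ e ⟫ s) ∷ []) v0 (⊟ (⊟ v0)) refl)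
          (trans (cong -_ z) (solve [] (⊟ zer) zer refl)))) (nonNeg-total (a ⟪ e ⟫ s))
        where
        ne : a ⟪ e ⟫ s ≢ 0#
        ne z = generic (s , ∈-box⁺ bs , z)

      bounded-0ᵛ : Bounded L (0ᵛ {suc n})
      bounded-0ᵛ = bounded-0 (suc n)

      above-0 : Above 0ᵛ
      above-0 with above-or-below bounded-0ᵛ
      ... | inj₁ p = p
      ... | inj₂ p = contradiction (nonNeg-resp (trans (solve ((+ Q • a) ∷ []) v0 (⊟ (⊟ (v0 ⊞ zer))) refl)
              (cong (λ z → - (- (+ Q • a + z))) (sym (eval-0 (suc n) e)))) (nonNeg-• Q 0≤a)) p

      -- The zero form and this one witness that forms occur on both sides of `a`, by `0 ≤ a` and
      -- `a < 𝟙`; admitting it requires `Q ≤ L`.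
      -Q𝟙 : Form
      -Q𝟙 = ℤ.- + Q ∷ 0ᵛ

      bounded--Q𝟙 : Bounded L -Q𝟙
      bounded--Q𝟙 = subst (ℕ._≤ L) (sym (ℤ.∣-i∣≡∣i∣ (+ Q))) Q≤L ∷ bounded-0 n

      below--Q𝟙 : Below -Q𝟙
      below--Q𝟙 = pos-resp eq (pos-• Q a<𝟙)
        where
        open ≡-Reasoning
        eq : + Q • (𝟙 + - a) ≡ - (a ⟪ e ⟫ -Q𝟙)
        eq = begin
          + Q • (𝟙 + - a)
            ≡⟨ trans (•-+ (+ Q) 𝟙 (- a)) (cong (λ z → + Q • 𝟙 + z) (•-neg (+ Q) a)) ⟩
          + Q • 𝟙 + - (+ Q • a)
            ≡⟨ solve ((+ Q • 𝟙) ∷ (+ Q • a) ∷ []) (v0 ⊟ v1) (⊟ (v1 ⊞ (⊟ v0 ⊞ zer))) refl ⟩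
          - (+ Q • a + (- (+ Q • 𝟙) + 0#))
            ≡⟨ cong₂ (λ y z → - (+ Q • a + (y + z))) (trans (sym (neg-• (+ Q) 𝟙)) (cong (ℤ.- + Q •_) (sym e0))) (sym (eval-0 n _)) ⟩
          - (a ⟪ e ⟫ -Q𝟙) ∎

      infix 4 _≤ᵉ_
      _≤ᵉ_ : Form → Form → Set
      s ≤ᵉ t = NonNeg (eval t e + - eval s e)

      ≤ᵉ-trans : ∀ {r s t} → r ≤ᵉ s → s ≤ᵉ t → r ≤ᵉ t
      ≤ᵉ-trans {r} {s} {t} p q = nonNeg-resp
        (solve (eval r e ∷ eval s e ∷ eval t e ∷ []) ((v1 ⊟ v0) ⊞ (v2 ⊟ v1)) (v2 ⊟ v0) refl) (nonNeg-+ p q)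

      ≤ᵉ-total : ∀ s t → s ≤ᵉ t ⊎ t ≤ᵉ s
      ≤ᵉ-total s t = Sum.map₂ (nonNeg-resp (solve (eval s e ∷ eval t e ∷ []) (⊟ (v1 ⊟ v0)) (v0 ⊟ v1) refl))
        (nonNeg-total (eval t e + - eval s e))

      -- `s` is above if `- s(e) < Q a`, so the smallest value of such a form yields the best lower
      -- bound; hence the reversed order in `maximum`.
      lowest : ∃ λ lo → lo ∈ box (suc n) L × Above lo × (∀ {s} → s ∈ box (suc n) L → Above s → lo ≤ᵉ s)
      lowest = maximum em (λ s t → t ≤ᵉ s) (λ {r} {s} {t} p q → ≤ᵉ-trans {t} {s} {r} q p) (λ s t → ≤ᵉ-total t s) Above (box (suc n) L)
        (0ᵛ , ∈-box⁺ bounded-0ᵛ , above-0)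

      highest : ∃ λ hi → hi ∈ box (suc n) L × Below hi × (∀ {s} → s ∈ box (suc n) L → Below s → s ≤ᵉ hi)
      highest = maximum em _≤ᵉ_ (λ {r} {s} {t} → ≤ᵉ-trans {r} {s} {t}) ≤ᵉ-total Below (box (suc n) L)
        (-Q𝟙 , ∈-box⁺ bounded--Q𝟙 , below--Q𝟙)

      -- `Q a` lies in the gap between its neighbours `- lo(e)` and `- hi(e)`. The gap remains
      -- non-empty at `e'`, and density of QM U, applied after subtracting `F = Q j 𝟙`, puts some
      -- `Q (j 𝟙 + M c)` into it; the residue `j` of `a` is kept. All other forms lie outside the
      -- gap on the same side as before.
      off-boundary : Answer
      off-boundary = a' , congruentBy j w c a≡ refl , same
        where
        lo = proj₁ lowest
        lo-bounded = ∈-box⁻ (suc n) (proj₁ (proj₂ lowest))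
        hi = proj₁ highest
        hi-bounded = ∈-box⁻ (suc n) (proj₁ (proj₂ highest))
        hi<lo : Pos (eval lo e' + - eval hi e')
        hi<lo = transfer-pos (difference-sign lo-bounded hi-bounded)
          (pos-resp (solve ((+ Q • a) ∷ eval lo e ∷ eval hi e ∷ []) ((v0 ⊞ v1) ⊞ (⊟ (v0 ⊞ v2))) (v1 ⊟ v2) refl)
            (pos-+ (proj₁ (proj₂ (proj₂ lowest))) (proj₁ (proj₂ (proj₂ highest)))))
        decomposition = divisible M a
        w = proj₁ decomposition
        j = proj₁ (proj₂ decomposition)
        a≡ : a ≡ j • 𝟙 + + M • w
        a≡ = trans (proj₂ (proj₂ decomposition)) (solve ((+ M • w) ∷ (j • 𝟙) ∷ []) (v0 ⊞ v1) (v1 ⊞ v0) refl)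
        F = + Q • (j • 𝟙)
        cut : ∃ λ c → Pos (+ (Q ℕ.* M) • c + - (- eval lo e' + - F)) × Pos ((- eval hi e' + - F) + - (+ (Q ℕ.* M) • c))
        cut = dense (Q ℕ.* M) {{ℕ.m*n≢0 Q M}}
          (pos-resp (solve (eval lo e' ∷ eval hi e' ∷ F ∷ []) (v0 ⊟ v1) ((⊟ v1 ⊟ v2) ⊟ (⊟ v0 ⊟ v2)) refl) hi<lo)
        c = proj₁ cut
        a' = j • 𝟙 + + M • c
        Qa' : + (Q ℕ.* M) • c ≡ + Q • a' + - F
        Qa' = trans (pos-*-• Q M c) (trans (solve (F ∷ (+ Q • (+ M • c)) ∷ []) v1 ((v0 ⊞ v1) ⊟ v0) refl)
                (cong (λ z → z + - F) (sym (•-+ (+ Q) _ _))))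
        above-lo : Pos (a' ⟪ e' ⟫ lo)
        above-lo = pos-resp (trans (cong (λ z → z + - (- eval lo e' + - F)) Qa')
          (solve ((+ Q • a') ∷ F ∷ eval lo e' ∷ []) ((v0 ⊟ v1) ⊟ (⊟ v2 ⊟ v1)) (v0 ⊞ v2) refl)) (proj₁ (proj₂ cut))
        below-hi : Pos (- (a' ⟪ e' ⟫ hi))
        below-hi = pos-resp (trans (cong (λ z → (- eval hi e' + - F) + - z) Qa')
          (solve ((+ Q • a') ∷ F ∷ eval hi e' ∷ []) ((⊟ v2 ⊟ v1) ⊟ (v0 ⊟ v1)) (⊟ (v0 ⊞ v2)) refl)) (proj₂ (proj₂ cut))
        same : ∀ s → Bounded L s → SameSign (a ⟪ e ⟫ s) (a' ⟪ e' ⟫ s)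
        same s bs with above-or-below bs
        ... | inj₁ above = pos-pos⇒sameSign above (pos-resp
                (solve ((+ Q • a') ∷ eval lo e' ∷ eval s e' ∷ []) ((v0 ⊞ v1) ⊞ (v2 ⊟ v1)) (v0 ⊞ v2) refl)
                (pos-+ʳ above-lo (transfer-nonNeg (difference-sign bs lo-bounded) (proj₂ (proj₂ (proj₂ lowest)) (∈-box⁺ bs) above))))
        ... | inj₂ below = neg-neg⇒sameSign below (pos-resp
                (solve ((+ Q • a') ∷ eval hi e' ∷ eval s e' ∷ []) (⊟ (v0 ⊞ v1) ⊞ (v1 ⊟ v2)) (⊟ (v0 ⊞ v2)) refl)
                (pos-+ʳ below-hi (transfer-nonNeg (difference-sign hi-bounded bs) (proj₂ (proj₂ (proj₂ highest)) (∈-box⁺ bs) below))))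

    transfer : Answer
    transfer with em {∃ λ t → t ∈ box (suc n) L × a ⟪ e ⟫ t ≡ 0#}
    ... | yes boundary = on-boundary boundary
    ... | no generic = off-boundary generic

-- Invariance of formulas under similarity

varsᵗ : Term → ℕ
varsᵗ (var n) = suc n
varsᵗ zer = 0
varsᵗ (s +ᵗ t) = varsᵗ s ℕ.⊔ varsᵗ t
varsᵗ (negᵗ t) = varsᵗ t

-- Bound variables count as well, because a quantifier updates the environment at its variable, and
-- that coordinate must be seen by the forms.
vars : Formula → ℕ
vars (s ≐ t) = varsᵗ s ℕ.⊔ varsᵗ t
vars (ord s t u) = varsᵗ s ℕ.⊔ (varsᵗ t ℕ.⊔ varsᵗ u)
vars ⊥ᶠ = 0
vars (¬ᶠ φ) = vars φ
vars (φ ∧ᶠ ψ) = vars φ ℕ.⊔ vars ψ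
vars (φ ∨ᶠ ψ) = vars φ ℕ.⊔ vars ψ
vars (φ ⇒ᶠ ψ) = vars φ ℕ.⊔ vars ψ
vars (∀ᶠ n φ) = suc n ℕ.⊔ vars φ
vars (∃ᶠ n φ) = suc n ℕ.⊔ vars φ

m⊔n≤o⇒m≤o×n≤o : ∀ m n {o} → m ℕ.⊔ n ℕ.≤ o → m ℕ.≤ o × n ℕ.≤ o
m⊔n≤o⇒m≤o×n≤o m n h = ℕ.m⊔n≤o⇒m≤o m n h , ℕ.m⊔n≤o⇒n≤o m n h

∣! : ∀ {k N} .{{_ : ℕ.NonZero k}} → k ℕ.≤ N → k ∣ N !
∣! {suc k} k≤N = ℕ.∣-trans (m∣m*n (k !)) (m≤n⇒m!∣n! k≤N)

module Invariance (G : OrientedAbelianGroup) (em : ExcludedMiddle 0ℓ) (Ũ : UniversalCover G em)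
  (regularlyDense : RegularlyDense G) (primeDivisible : ∀ p → Prime p → ∀ a → ∃ λ c → a ≡ _·_ G p c)
  (nontrivial : ∃ λ a → a ≢ OrientedAbelianGroup.𝟘 G) where
  open CoverProperties G em Ũ
  open Density G em Ũ regularlyDense primeDivisible nontrivial
  open BackAndForth G em Ũ regularlyDense primeDivisible nontrivial public
  open Similar
  private
    module 𝔾 = CyclicOrder G em
    module A = OrientedAbelianGroup G
  open A using (_⊕_; ⊖_; 𝟘; O)
  open Semantics G

  -- The updated tuples are any functions with the prescribed values, so that this applies to lifts
  -- of updated environments and also to a partner not yet known to be a lift.
  record Extended (V N M : ℕ) (e e' : ℕ → Carrier) (i : ℕ) (a : Carrier) : Set where
    field
      partner : Carrier
      similar : ∀ {e₁ e'₁} → e₁ i ≡ a → (∀ j → i ≢ j → e₁ j ≡ e j) →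
                e'₁ i ≡ partner → (∀ j → i ≢ j → e'₁ j ≡ e' j) → Similar V N M e₁ e'₁

  -- Multiplying every condition k a + s(e) ≥ 0 with 0 < k ≤ N up to the common coefficient N!
  -- reduces the choice of a' to comparisons of N! a' with elements of the cover.
  module Forth (n N M : ℕ) (1≤N : 1 ℕ.≤ N) {{M≢0 : ℕ.NonZero M}} where
    Q L : ℕ
    Q = N !
    L = Q ℕ.* N

    instance
      Q≢0 : ℕ.NonZero Q
      Q≢0 = N ℕ.!≢0

    Q≤L : Q ℕ.≤ L
    Q≤L = ℕ.≤-trans (ℕ.≤-reflexive (sym (ℕ.*-identityʳ Q))) (ℕ.*-monoʳ-≤ Q 1≤N)

    N≤L : N ℕ.≤ L
    N≤L = ℕ.≤-trans (ℕ.≤-reflexive (sym (ℕ.*-identityˡ N))) (ℕ.*-monoˡ-≤ N (ℕ.1≤n! N))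

    module _ {e e' : ℕ → Carrier} {a a' : Carrier} (sim : Similar (suc n) (L ℕ.+ L) (Q ℕ.* M) e e')
      (a≡a' : Congruent M a a')
      (same : ∀ (s : Vec ℤ (suc n)) → Bounded L s → SameSign (+ Q • a + eval s e) (+ Q • a' + eval s e')) where

      -- Multiplying by `q = Q / (k + 1)` preserves the sign, brings the coefficient of `a` to `Q`,
      -- and takes `s` to a form bounded by `Q * N = L`.
      sameSign-positive : ∀ k (s : Vec ℤ (suc n)) → suc k ℕ.≤ N → Bounded N s →
        SameSign (+ suc k • a + eval s e) (+ suc k • a' + eval s e')
      sameSign-positive k s k<N bs = descend (∣! {suc k} k<N)
        where
        descend : suc k ∣ Q → SameSign (+ suc k • a + eval s e) (+ suc k • a' + eval s e')
        descend (divides q Q≡) = sameSign-•⁻¹ q {{q≢0}} (sameSign-resp (scale a e) (scale a' e')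
            (same (+ q *ᵛ s) (bounded-* (+ q) q≤Q bs)))
          where
          q≢0 : ℕ.NonZero q
          q≢0 = ℕ.m*n≢0⇒m≢0 q {suc k} {{subst ℕ.NonZero Q≡ Q≢0}}
          q≤Q : q ℕ.≤ Q
          q≤Q = subst (q ℕ.≤_) (sym Q≡) (ℕ.m≤m*n q (suc k))
          scale : ∀ x ρ → + Q • x + eval (+ q *ᵛ s) ρ ≡ + q • (+ suc k • x + eval s ρ)
          scale x ρ = trans (cong₂ _+_ (trans (cong (λ z → + z • x) Q≡) (pos-*-• q (suc k) x)) (eval-* (+ q) s ρ))
            (sym (•-+ (+ q) _ _))

      sameSign-multiple : ∀ k (s : Vec ℤ (suc n)) → ∣ k ∣ ℕ.≤ N → Bounded N s →
        SameSign (k • a + eval s e) (k • a' + eval s e')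
      sameSign-multiple (+ zero) s _ bs = sameSign-resp (sym (+-identityˡ _)) (sym (+-identityˡ _))
        (signs sim s (bounded-mono (ℕ.≤-trans N≤L (ℕ.m≤m+n L L)) bs))
        where
        +-identityˡ : ∀ x → 0# + x ≡ x
        +-identityˡ x = solve (x ∷ []) (zer ⊞ v0) v0 refl
      sameSign-multiple (+ suc k) s k≤N bs = sameSign-positive k s k≤N bs
      sameSign-multiple -[1+ k ] s k≤N bs = sameSign-resp (negate a e) (negate a' e')
        (sameSign-neg (sameSign-positive k (-ᵛ s) k≤N (bounded-neg bs)))
        where
        negate : ∀ x ρ → - (+ suc k • x + eval (-ᵛ s) ρ) ≡ -[1+ k ] • x + eval s ρ
        negate x ρ = trans (cong (λ z → - (+ suc k • x + z)) (eval-neg s ρ))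
          (solve ((+ suc k • x) ∷ eval s ρ ∷ []) (⊟ (v0 ⊟ v1)) (⊟ v0 ⊞ v1) refl)

      extend-similar : (i : Fin (suc n)) → ∀ {e₁ e'₁} →
        e₁ (Fin.toℕ i) ≡ a → (∀ j → Fin.toℕ i ≢ j → e₁ j ≡ e j) →
        e'₁ (Fin.toℕ i) ≡ a' → (∀ j → Fin.toℕ i ≢ j → e'₁ j ≡ e' j) → Similar (suc n) N M e₁ e'₁
      extend-similar i {e₁} {e'₁} refl old refl old' .signs m bm = sameSign-resp
        (sym (eval-update m i old)) (sym (eval-update m i old'))
        (sameSign-multiple (Vec.lookup m i) (m Vec.[ i ]≔ 0ℤ) (VecAll.lookup⁺ bm i) (bounded-erase i bm))
      extend-similar i {e₁} {e'₁} refl old refl old' .congruent j with Fin.toℕ i ℕ.≟ j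
      ... | yes refl = a≡a'
      ... | no i≢j = subst₂ (Congruent M) (sym (old j i≢j)) (sym (old' j i≢j))
              (congruent-∣ (divides Q refl) (congruent sim j))

    extend : ∀ {e e'} → Similar (suc n) (L ℕ.+ L) (Q ℕ.* M) e e' → e 0 ≡ 𝟙 → e' 0 ≡ 𝟙 →
      (i : Fin (suc n)) → ∀ {a} → NonNeg a → Pos (𝟙 + - a) → Extended (suc n) N M e e' (Fin.toℕ i) a
    extend sim e0 e'0 i 0≤a a<𝟙 = record { partner = proj₁ t ; similar = extend-similar sim (proj₁ (proj₂ t)) (proj₂ (proj₂ t)) i }
      where t = Transfer.transfer n Q M L Q≤L sim e0 e'0 0≤a a<𝟙

  -- Coordinate 0 holds `𝟙`, so that integral forms have constant terms; variable `n` therefore sits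
  -- at coordinate `n + 1`.
  lifted : Env → ℕ → Carrier
  lifted ρ zero = 𝟙
  lifted ρ (suc i) = lift (ρ i)

  module _ (V : ℕ) where

    form-nonNeg : ∀ {N M e e'} → Similar (suc V) N M e e' → ∀ {m : Vec ℤ (suc V)} → Bounded N m → NonNeg (eval m e) → NonNeg (eval m e')
    form-nonNeg sim bm = transfer-nonNeg (signs sim _ bm)

    -- The condition is the sign of `𝟙 - m`, a form whose coefficients may be larger by one than
    -- those of `m`.
    form-<𝟙 : ∀ {N M e e'} → e 0 ≡ 𝟙 → e' 0 ≡ 𝟙 → Similar (suc V) (suc N) M e e' → ∀ {m : Vec ℤ (suc V)} → Bounded N m →
      Pos (𝟙 + - eval m e) → Pos (𝟙 + - eval m e')
    form-<𝟙 {N} {e = e} {e'} e0 e'0 sim {m} bm p = pos-resp (eq e' e'0)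
      (transfer-pos (signs sim (unit zero +ᵛ -ᵛ m) (bounded-+ (bounded-unit {suc V} zero) (bounded-neg bm))) (pos-resp (sym (eq e e0)) p))
      where
      eq : ∀ ρ → ρ 0 ≡ 𝟙 → eval (unit {suc V} zero +ᵛ -ᵛ m) ρ ≡ 𝟙 + - eval m ρ
      eq ρ ρ0 = trans (eval-difference (unit zero) m ρ) (cong (λ z → z + - eval m ρ) (trans (eval-unit {suc V} zero ρ) ρ0))

    -- Bounds the coefficients of the form of a term: one for each occurrence of a variable, and one
    -- for the possible carry of each sum or negation.
    size : Term → ℕ
    size (var n) = 1
    size zer = 0
    size (s +ᵗ t) = (size s ℕ.+ size t) ℕ.+ 1
    size (negᵗ t) = size t ℕ.+ 1

    -- The form depends on `ρ` through the carries, but modulo ℤ𝟙 it represents `t` at every `ρ'`.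
    -- Hence it gives the lift of `t` at `ρ'` as soon as its value there lies in [0, 𝟙), which signs
    -- decide.
    record LinearForm (t : Term) (ρ : Env) : Set where
      field
        form : Vec ℤ (suc V)
        bounded : Bounded (size t) form
        represents : lift (⟦ t ⟧ᵗ ρ) ≡ eval form (lifted ρ)
        uniform : ∀ ρ' → π (eval form (lifted ρ')) ≡ ⟦ t ⟧ᵗ ρ'

    turns : ℕ → Vec ℤ (suc V)
    turns w = + w *ᵛ unit zero

    eval-turns : ∀ w ρ → eval (turns w) (lifted ρ) ≡ + w • 𝟙
    eval-turns w ρ = trans (eval-* (+ w) (unit {suc V} zero) (lifted ρ)) (cong (+ w •_) (eval-unit {suc V} zero (lifted ρ)))

    bounded-turns : ∀ {w} → w ≡ 0 ⊎ w ≡ 1 → Bounded 1 (turns w)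
    bounded-turns {w} w≤1 = bounded-* (+ w) (bound w≤1) (bounded-unit {suc V} zero)
      where
      bound : ∀ {w} → w ≡ 0 ⊎ w ≡ 1 → w ℕ.≤ 1
      bound (inj₁ refl) = ℕ.z≤n
      bound (inj₂ refl) = ℕ.≤-refl

    linearForm : ∀ t → varsᵗ t ℕ.≤ V → ∀ ρ → LinearForm t ρ
    linearForm (var n) n<V ρ = record
      { form = unit i
      ; bounded = bounded-unit i
      ; represents = sym (value ρ)
      ; uniform = λ ρ' → trans (cong π (value ρ')) (π-lift (ρ' n)) }
      where
      i = suc (Fin.fromℕ< n<V)
      value : ∀ ρ → eval (unit i) (lifted ρ) ≡ lift (ρ n)
      value ρ = trans (eval-unit i (lifted ρ)) (cong (λ j → lift (ρ j)) (Fin.toℕ-fromℕ< n<V))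
    linearForm zer _ ρ = record
      { form = 0ᵛ
      ; bounded = bounded-0 (suc V)
      ; represents = trans lift-𝟘 (sym (eval-0 (suc V) (lifted ρ)))
      ; uniform = λ ρ' → trans (cong π (eval-0 (suc V) (lifted ρ'))) π-0 }
    linearForm (s +ᵗ t) st≤V ρ = record
      { form = (S.form +ᵛ T.form) +ᵛ -ᵛ turns w
      ; bounded = bounded-+ (bounded-+ S.bounded T.bounded) (bounded-neg (bounded-turns w≤1))
      ; represents = begin
          lift (⟦ s ⟧ᵗ ρ ⊕ ⟦ t ⟧ᵗ ρ)
            ≡⟨ solve (lift (⟦ s ⟧ᵗ ρ ⊕ ⟦ t ⟧ᵗ ρ) ∷ (+ w • 𝟙) ∷ []) v0 ((v0 ⊞ v1) ⊟ v1) refl ⟩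
          (lift (⟦ s ⟧ᵗ ρ ⊕ ⟦ t ⟧ᵗ ρ) + + w • 𝟙) + - (+ w • 𝟙)
            ≡⟨ cong (λ z → z + - (+ w • 𝟙)) (sym sum≡) ⟩
          (lift (⟦ s ⟧ᵗ ρ) + lift (⟦ t ⟧ᵗ ρ)) + - (+ w • 𝟙)
            ≡⟨ cong₂ (λ y z → (y + z) + - (+ w • 𝟙)) S.represents T.represents ⟩
          (eval S.form (lifted ρ) + eval T.form (lifted ρ)) + - (+ w • 𝟙)
            ≡⟨ value ρ ⟨
          eval ((S.form +ᵛ T.form) +ᵛ -ᵛ turns w) (lifted ρ) ∎
      ; uniform = λ ρ' → begin
          π (eval ((S.form +ᵛ T.form) +ᵛ -ᵛ turns w) (lifted ρ'))
            ≡⟨ cong π (value ρ') ⟩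
          π ((eval S.form (lifted ρ') + eval T.form (lifted ρ')) + - (+ w • 𝟙))
            ≡⟨ trans (π-+ _ _) (cong₂ _⊕_ (π-+ _ _) (trans (π-neg _) (cong ⊖_ (π-•𝟙 (+ w))))) ⟩
          (π (eval S.form (lifted ρ')) ⊕ π (eval T.form (lifted ρ'))) ⊕ ⊖ 𝟘
            ≡⟨ cong₂ (λ y z → (y ⊕ z) ⊕ ⊖ 𝟘) (S.uniform ρ') (T.uniform ρ') ⟩
          (⟦ s ⟧ᵗ ρ' ⊕ ⟦ t ⟧ᵗ ρ') ⊕ ⊖ 𝟘
            ≡⟨ 𝔾.solve ((⟦ s ⟧ᵗ ρ' ⊕ ⟦ t ⟧ᵗ ρ') ∷ []) (𝔾.v0 𝔾.⊟ 𝔾.zer) 𝔾.v0 refl ⟩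
          ⟦ s ⟧ᵗ ρ' ⊕ ⟦ t ⟧ᵗ ρ' ∎ }
      where
      open ≡-Reasoning
      le = m⊔n≤o⇒m≤o×n≤o (varsᵗ s) (varsᵗ t) st≤V
      module S = LinearForm (linearForm s (proj₁ le) ρ)
      module T = LinearForm (linearForm t (proj₂ le) ρ)
      carry = lift-⊕ (⟦ s ⟧ᵗ ρ) (⟦ t ⟧ᵗ ρ)
      w = proj₁ carry
      w≤1 = proj₁ (proj₂ carry)
      sum≡ = proj₂ (proj₂ carry)
      value : ∀ ρ' → eval ((S.form +ᵛ T.form) +ᵛ -ᵛ turns w) (lifted ρ')
        ≡ (eval S.form (lifted ρ') + eval T.form (lifted ρ')) + - (+ w • 𝟙)
      value ρ' = trans (eval-difference (S.form +ᵛ T.form) (turns w) (lifted ρ'))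
        (cong₂ (λ y z → y + - z) (eval-+ S.form T.form (lifted ρ')) (eval-turns w ρ'))
    linearForm (negᵗ t) t≤V ρ = record
      { form = -ᵛ T.form +ᵛ turns w
      ; bounded = bounded-+ (bounded-neg T.bounded) (bounded-turns w≤1)
      ; represents = trans neg≡ (trans (cong (λ z → - z + + w • 𝟙) T.represents) (sym (value ρ)))
      ; uniform = λ ρ' → begin
          π (eval (-ᵛ T.form +ᵛ turns w) (lifted ρ'))
            ≡⟨ cong π (value ρ') ⟩
          π (- eval T.form (lifted ρ') + + w • 𝟙)
            ≡⟨ trans (π-+ _ _) (cong₂ _⊕_ (trans (π-neg _) (cong ⊖_ (T.uniform ρ'))) (π-•𝟙 (+ w))) ⟩
          ⊖ ⟦ t ⟧ᵗ ρ' ⊕ 𝟘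
            ≡⟨ 𝔾.⊕-identityʳ _ ⟩
          ⊖ ⟦ t ⟧ᵗ ρ' ∎ }
      where
      open ≡-Reasoning
      module T = LinearForm (linearForm t t≤V ρ)
      carry = lift-⊖ (⟦ t ⟧ᵗ ρ)
      w = proj₁ carry
      w≤1 = proj₁ (proj₂ carry)
      neg≡ = proj₂ (proj₂ carry)
      value : ∀ ρ' → eval (-ᵛ T.form +ᵛ turns w) (lifted ρ') ≡ - eval T.form (lifted ρ') + + w • 𝟙
      value ρ' = trans (eval-+ (-ᵛ T.form) (turns w) (lifted ρ')) (cong₂ _+_ (eval-neg T.form (lifted ρ')) (eval-turns w ρ'))

    module _ {N M ρ ρ'} (sim : Similar (suc V) (suc N) M (lifted ρ) (lifted ρ')) where

      represents' : ∀ {t} → size t ℕ.≤ N → (F : LinearForm t ρ) →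
        lift (⟦ t ⟧ᵗ ρ') ≡ eval (LinearForm.form F) (lifted ρ')
      represents' {t} t≤N F = trans (cong lift (sym (uniform ρ'))) (lift-π
          (form-nonNeg sim (bounded-mono (ℕ.n≤1+n N) b) (nonNeg-resp represents (lift-nonNeg _)))
          (form-<𝟙 refl refl sim b (pos-resp (cong (λ z → 𝟙 + - z) represents) (lift<𝟙 _))))
        where
        open LinearForm F
        b : Bounded N form
        b = bounded-mono t≤N bounded

      difference-sameSign : ∀ s t → varsᵗ s ℕ.≤ V → varsᵗ t ℕ.≤ V → size s ℕ.+ size t ℕ.≤ N →
        SameSign (lift (⟦ t ⟧ᵗ ρ) + - lift (⟦ s ⟧ᵗ ρ)) (lift (⟦ t ⟧ᵗ ρ') + - lift (⟦ s ⟧ᵗ ρ'))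
      difference-sameSign s t s≤V t≤V st≤N = sameSign-resp
        (trans (eval-difference T.form S.form (lifted ρ)) (sym (cong₂ (λ y z → y + - z) T.represents S.represents)))
        (trans (eval-difference T.form S.form (lifted ρ')) (sym (cong₂ (λ y z → y + - z)
          (represents' (ℕ.≤-trans (ℕ.m≤n+m (size t) (size s)) st≤N) T)
          (represents' (ℕ.≤-trans (ℕ.m≤m+n (size s) (size t)) st≤N) S))))
        (signs sim (T.form +ᵛ -ᵛ S.form) (bounded-mono
          (ℕ.≤-trans (ℕ.≤-reflexive (ℕ.+-comm (size t) (size s))) (ℕ.≤-trans st≤N (ℕ.n≤1+n N)))
          (bounded-+ T.bounded (bounded-neg S.bounded))))
        where
        S = linearForm s s≤V ρ
        T = linearForm t t≤V ρ
        module S = LinearForm S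
        module T = LinearForm T

      transfer-≺ : ∀ s t → varsᵗ s ℕ.≤ V → varsᵗ t ℕ.≤ V → size s ℕ.+ size t ℕ.≤ N →
        ⟦ s ⟧ᵗ ρ 𝔾.≺ ⟦ t ⟧ᵗ ρ → ⟦ s ⟧ᵗ ρ' 𝔾.≺ ⟦ t ⟧ᵗ ρ'
      transfer-≺ s t s≤V t≤V st≤N h = lift⇒≺ (transfer-pos (difference-sameSign s t s≤V t≤V st≤N) (≺⇒lift h))

      transfer-≡ : ∀ s t → varsᵗ s ℕ.≤ V → varsᵗ t ℕ.≤ V → size s ℕ.+ size t ℕ.≤ N →
        ⟦ s ⟧ᵗ ρ ≡ ⟦ t ⟧ᵗ ρ → ⟦ s ⟧ᵗ ρ' ≡ ⟦ t ⟧ᵗ ρ'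
      transfer-≡ s t s≤V t≤V st≤N h = begin
        ⟦ s ⟧ᵗ ρ'         ≡⟨ π-lift _ ⟨
        π y               ≡⟨ cong π (solve (x ∷ y ∷ []) v1 (v0 ⊟ (v0 ⊟ v1)) refl) ⟩
        π (x + - (x + - y)) ≡⟨ cong (λ z → π (x + - z)) zero-difference ⟩
        π (x + - 0#)      ≡⟨ cong π (solve (x ∷ []) (v0 ⊟ zer) v0 refl) ⟩
        π x               ≡⟨ π-lift _ ⟩
        ⟦ t ⟧ᵗ ρ'         ∎
        where
        open ≡-Reasoning
        x = lift (⟦ t ⟧ᵗ ρ')
        y = lift (⟦ s ⟧ᵗ ρ')
        zero-difference : x + - y ≡ 0#
        zero-difference = transfer-0 (difference-sameSign s t s≤V t≤V st≤N)
          (trans (cong (λ z → lift (⟦ t ⟧ᵗ ρ) + - lift z) h) (solve (lift (⟦ t ⟧ᵗ ρ) ∷ []) (v0 ⊟ v0) zer refl))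

      transfer-O : ∀ s t u → varsᵗ s ℕ.≤ V → varsᵗ t ℕ.≤ V → varsᵗ u ℕ.≤ V → size s ℕ.+ size t ℕ.+ size u ℕ.≤ N →
        O (⟦ s ⟧ᵗ ρ) (⟦ t ⟧ᵗ ρ) (⟦ u ⟧ᵗ ρ) → O (⟦ s ⟧ᵗ ρ') (⟦ t ⟧ᵗ ρ') (⟦ u ⟧ᵗ ρ')
      transfer-O s t u s≤V t≤V u≤V stu≤N h = 𝔾.cyclic⇒O (Sum.map (λ (p , q) → st p , tu q)
          (Sum.map (λ (p , q) → tu p , us q) (λ (p , q) → us p , st q)) (𝔾.O⇒cyclic h))
        where
        st = transfer-≺ s t s≤V t≤V (ℕ.≤-trans (ℕ.m≤m+n (size s ℕ.+ size t) (size u)) stu≤N)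
        tu = transfer-≺ t u t≤V u≤V (ℕ.≤-trans (ℕ.+-monoˡ-≤ (size u) (ℕ.m≤n+m (size t) (size s))) stu≤N)
        us = transfer-≺ u s u≤V s≤V (ℕ.≤-trans (ℕ.≤-reflexive (ℕ.+-comm (size u) (size s)))
               (ℕ.≤-trans (ℕ.+-monoˡ-≤ (size u) (ℕ.m≤m+n (size s) (size t))) stu≤N))

    record Invariant (φ : Formula) : Set where
      field
        N M : ℕ
        M≢0 : ℕ.NonZero M
        invariant : ∀ {ρ ρ'} → Similar (suc V) N M (lifted ρ) (lifted ρ') → ⟦ φ ⟧ ρ → ⟦ φ ⟧ ρ'
    open Invariant

    lifted-update : ∀ ρ n a → lifted (ρ [ n ↦ a ]) (suc n) ≡ lift a
    lifted-update ρ n a with n ℕ.≟ n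
    ... | yes _ = refl
    ... | no n≢n = contradiction refl n≢n

    lifted-other : ∀ ρ n a j → suc n ≢ j → lifted (ρ [ n ↦ a ]) j ≡ lifted ρ j
    lifted-other ρ n a zero _ = refl
    lifted-other ρ n a (suc j) ne with n ℕ.≟ j
    ... | yes refl = contradiction refl ne
    ... | no _ = refl

    module Quantifier {φ} (I : Invariant φ) (n : ℕ) (n<V : n ℕ.< V) where
      -- The form `𝟙 - a` is estimated by the coefficient bound 2, so adding 2 keeps the bounds on
      -- the partner available even for `N I = 0`.
      open Forth V (2 ℕ.+ N I) (M I) (ℕ.s≤s ℕ.z≤n) {{M≢0 I}} public

      i : Fin (suc V)
      i = suc (Fin.fromℕ< n<V)

      toℕ-i : Fin.toℕ i ≡ suc n
      toℕ-i = cong suc (Fin.toℕ-fromℕ< n<V)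

      step : ∀ {ρ ρ'} → Similar (suc V) (L ℕ.+ L) (Q ℕ.* M I) (lifted ρ) (lifted ρ') → ∀ a →
        ∃ λ a' → Similar (suc V) (N I) (M I) (lifted (ρ [ n ↦ a ])) (lifted (ρ' [ n ↦ a' ]))
      step {ρ} {ρ'} sim a = π partner , similar-mono (ℕ.m≤n+m (N I) 2) ℕ.∣-refl
        (similar (at-i ρ a) (off-i ρ a) (trans (at-i ρ' (π partner)) lift-partner) (off-i ρ' (π partner)))
        where
        ext = extend sim refl refl i (lift-nonNeg a) (lift<𝟙 a)
        open Extended ext
        at-i : ∀ ρ a → lifted (ρ [ n ↦ a ]) (Fin.toℕ i) ≡ lift a
        at-i ρ a = trans (cong (lifted (ρ [ n ↦ a ])) toℕ-i) (lifted-update ρ n a)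
        off-i : ∀ ρ a j → Fin.toℕ i ≢ j → lifted (ρ [ n ↦ a ]) j ≡ lifted ρ j
        off-i ρ a j ne = lifted-other ρ n a j (λ e → ne (trans toℕ-i e))
        -- The bounds 0 ≤ a < 𝟙 are signs of linear forms, hence shared by the partner.
        put : (ℕ → Carrier) → Carrier → ℕ → Carrier
        put e b j with Fin.toℕ i ℕ.≟ j
        ... | yes _ = b
        ... | no _ = e j
        put-i : ∀ e b → put e b (Fin.toℕ i) ≡ b
        put-i e b with Fin.toℕ i ℕ.≟ Fin.toℕ i
        ... | yes _ = refl
        ... | no ne = contradiction refl ne
        put-other : ∀ e b j → Fin.toℕ i ≢ j → put e b j ≡ e j
        put-other e b j ne with Fin.toℕ i ℕ.≟ j
        ... | yes eq = contradiction eq ne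
        ... | no _ = refl
        sim₁ : Similar (suc V) (2 ℕ.+ N I) (M I) (put (lifted ρ) (lift a)) (put (lifted ρ') partner)
        sim₁ = similar (put-i _ _) (put-other _ _) (put-i _ _) (put-other _ _)
        value : ∀ e b → eval (unit i) (put e b) ≡ b
        value e b = trans (eval-unit i (put e b)) (put-i e b)
        lift-partner : lift (π partner) ≡ partner
        lift-partner = lift-π
          (nonNeg-resp (value _ _) (form-nonNeg sim₁ (bounded-mono (ℕ.s≤s ℕ.z≤n) (bounded-unit i)) (nonNeg-resp (sym (value _ _)) (lift-nonNeg a))))
          (pos-resp (cong (λ z → 𝟙 + - z) (value _ _)) (form-<𝟙 {N = 1 ℕ.+ N I} refl refl sim₁ (bounded-mono (ℕ.s≤s ℕ.z≤n) (bounded-unit i))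
            (pos-resp (cong (λ z → 𝟙 + - z) (sym (value _ _))) (lift<𝟙 a))))

    -- The backward implication for `φ` serves the case where `φ` is the premise of an implication.
    combine : ∀ {φ ψ χ} (I : Invariant φ) (J : Invariant ψ) →
      ((∀ {ρ ρ'} → Similar (suc V) (N I ℕ.+ N J) (M I ℕ.* M J) (lifted ρ) (lifted ρ') →
         (⟦ φ ⟧ ρ → ⟦ φ ⟧ ρ') × (⟦ φ ⟧ ρ' → ⟦ φ ⟧ ρ) × (⟦ ψ ⟧ ρ → ⟦ ψ ⟧ ρ') → ⟦ χ ⟧ ρ → ⟦ χ ⟧ ρ')) → Invariant χ
    combine I J f = record
      { M≢0 = ℕ.m*n≢0 (M I) (M J) {{M≢0 I}} {{M≢0 J}}
      ; invariant = λ sim → f sim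
          ( invariant I (restrictˡ sim) , invariant I (similar-sym (restrictˡ sim))
          , invariant J (similar-mono (ℕ.m≤n+m (N J) (N I)) (divides (M I) refl) sim)) }
      where
      restrictˡ : ∀ {e e'} → Similar (suc V) (N I ℕ.+ N J) (M I ℕ.* M J) e e' → Similar (suc V) (N I) (M I) e e'
      restrictˡ = similar-mono (ℕ.m≤m+n (N I) (N J)) (m∣m*n (M J))

    formula-invariant : ∀ φ → vars φ ℕ.≤ V → Invariant φ
    formula-invariant (s ≐ t) le = record
      { N = suc (size s ℕ.+ size t) ; M = 1 ; M≢0 = _
      ; invariant = λ sim → transfer-≡ sim s t (proj₁ le') (proj₂ le') ℕ.≤-refl }
      where le' = m⊔n≤o⇒m≤o×n≤o (varsᵗ s) (varsᵗ t) le
    formula-invariant (ord s t u) le = record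
      { N = suc (size s ℕ.+ size t ℕ.+ size u) ; M = 1 ; M≢0 = _
      ; invariant = λ sim → transfer-O sim s t u (proj₁ le') (proj₁ le'') (proj₂ le'') ℕ.≤-refl }
      where
      le' = m⊔n≤o⇒m≤o×n≤o (varsᵗ s) (varsᵗ t ℕ.⊔ varsᵗ u) le
      le'' = m⊔n≤o⇒m≤o×n≤o (varsᵗ t) (varsᵗ u) (proj₂ le')
    formula-invariant ⊥ᶠ _ = record { N = 0 ; M = 1 ; M≢0 = _ ; invariant = λ _ () }
    formula-invariant (¬ᶠ φ) le = record
      { M≢0 = M≢0 I ; invariant = λ sim ¬h h → ¬h (invariant I (similar-sym sim) h) }
      where I = formula-invariant φ le
    formula-invariant (φ ∧ᶠ ψ) le = combine (formula-invariant φ (proj₁ le')) (formula-invariant ψ (proj₂ le'))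
      λ _ (f , _ , g) (h , k) → f h , g k
      where le' = m⊔n≤o⇒m≤o×n≤o (vars φ) (vars ψ) le
    formula-invariant (φ ∨ᶠ ψ) le = combine (formula-invariant φ (proj₁ le')) (formula-invariant ψ (proj₂ le'))
      λ _ (f , _ , g) → Sum.map f g
      where le' = m⊔n≤o⇒m≤o×n≤o (vars φ) (vars ψ) le
    formula-invariant (φ ⇒ᶠ ψ) le = combine (formula-invariant φ (proj₁ le')) (formula-invariant ψ (proj₂ le'))
      λ _ (_ , f⁻¹ , g) h k → g (h (f⁻¹ k))
      where le' = m⊔n≤o⇒m≤o×n≤o (vars φ) (vars ψ) le
    formula-invariant (∀ᶠ n φ) le = record
      { N = L ℕ.+ L ; M = Q ℕ.* M I ; M≢0 = ℕ.m*n≢0 Q (M I) {{it}} {{M≢0 I}}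
      -- The step runs from `ρ'` to `ρ`: the universal hypothesis is used at the partner of `a'`.
      ; invariant = λ sim h a' → let a , sim' = step (similar-sym sim) a' in invariant I (similar-sym sim') (h a) }
      where
      le' = m⊔n≤o⇒m≤o×n≤o (suc n) (vars φ) le
      I = formula-invariant φ (proj₂ le')
      open Quantifier I n (proj₁ le')
    formula-invariant (∃ᶠ n φ) le = record
      { N = L ℕ.+ L ; M = Q ℕ.* M I ; M≢0 = ℕ.m*n≢0 Q (M I) {{it}} {{M≢0 I}}
      ; invariant = λ sim (a , h) → let a' , sim' = step sim a in a' , invariant I sim' h }
      where
      le' = m⊔n≤o⇒m≤o×n≤o (suc n) (vars φ) le
      I = formula-invariant φ (proj₂ le')
      open Quantifier I n (proj₁ le')

-- Renaming of variables and definable predicates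

redirect : (ℕ → ℕ) → ℕ → ℕ → ℕ → ℕ
redirect σ n k v with n ℕ.≟ v
... | yes _ = k
... | no _ = σ v

-- Exceeds the images under `σ` of all variables below `b`, so a binder with this name captures none
-- of them.
fresh : (ℕ → ℕ) → ℕ → ℕ
fresh σ zero = 0
fresh σ (suc b) = suc (σ b) ℕ.⊔ fresh σ b

fresh-> : ∀ σ b {v} → v ℕ.< b → σ v ℕ.< fresh σ b
fresh-> σ (suc b) {v} v<b with ℕ.m≤n⇒m<n∨m≡n (ℕ.≤-pred v<b)
... | inj₁ v<b' = ℕ.≤-trans (fresh-> σ b v<b') (ℕ.m≤n⊔m (suc (σ b)) (fresh σ b))
... | inj₂ refl = ℕ.m≤m⊔n (suc (σ b)) (fresh σ b)

renameᵗ : (ℕ → ℕ) → Term → Term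
renameᵗ σ (var n) = var (σ n)
renameᵗ σ zer = zer
renameᵗ σ (s +ᵗ t) = renameᵗ σ s +ᵗ renameᵗ σ t
renameᵗ σ (negᵗ t) = negᵗ (renameᵗ σ t)

rename : (ℕ → ℕ) → Formula → Formula
rename σ (s ≐ t) = renameᵗ σ s ≐ renameᵗ σ t
rename σ (ord s t u) = ord (renameᵗ σ s) (renameᵗ σ t) (renameᵗ σ u)
rename σ ⊥ᶠ = ⊥ᶠ
rename σ (¬ᶠ φ) = ¬ᶠ (rename σ φ)
rename σ (φ ∧ᶠ ψ) = rename σ φ ∧ᶠ rename σ ψ
rename σ (φ ∨ᶠ ψ) = rename σ φ ∨ᶠ rename σ ψ
rename σ (φ ⇒ᶠ ψ) = rename σ φ ⇒ᶠ rename σ ψ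
rename σ (∀ᶠ n φ) = ∀ᶠ k (rename (redirect σ n k) φ)
  where k = fresh σ (vars φ)
rename σ (∃ᶠ n φ) = ∃ᶠ k (rename (redirect σ n k) φ)
  where k = fresh σ (vars φ)

module Definability (G : OrientedAbelianGroup) where
  open OrientedAbelianGroup G
  open Semantics G
  open Equivalence using (to; from)

  update-same : ∀ ρ k a → (ρ [ k ↦ a ]) k ≡ a
  update-same ρ k a with k ℕ.≟ k
  ... | yes _ = refl
  ... | no k≢k = contradiction refl k≢k

  update-other : ∀ ρ {k j} a → k ≢ j → (ρ [ k ↦ a ]) j ≡ ρ j
  update-other ρ {k} {j} a k≢j with k ℕ.≟ j
  ... | yes k≡j = contradiction k≡j k≢j
  ... | no _ = refl

  Agree : ℕ → (ℕ → ℕ) → Env → Env → Set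
  Agree b σ ρ ρ' = ∀ {v} → v ℕ.< b → ρ (σ v) ≡ ρ' v

  agree-≤ : ∀ {b c σ ρ ρ'} → b ℕ.≤ c → Agree c σ ρ ρ' → Agree b σ ρ ρ'
  agree-≤ b≤c h v<b = h (ℕ.≤-trans v<b b≤c)

  renameᵗ-correct : ∀ t {σ ρ ρ'} → Agree (varsᵗ t) σ ρ ρ' → ⟦ renameᵗ σ t ⟧ᵗ ρ ≡ ⟦ t ⟧ᵗ ρ'
  renameᵗ-correct (var n) h = h ℕ.≤-refl
  renameᵗ-correct zer h = refl
  renameᵗ-correct (s +ᵗ t) {σ} {ρ} {ρ'} h = cong₂ _⊕_
    (renameᵗ-correct s (agree-≤ {σ = σ} {ρ} {ρ'} (ℕ.m≤m⊔n (varsᵗ s) (varsᵗ t)) h))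
    (renameᵗ-correct t (agree-≤ {σ = σ} {ρ} {ρ'} (ℕ.m≤n⊔m (varsᵗ s) (varsᵗ t)) h))
  renameᵗ-correct (negᵗ t) h = cong ⊖_ (renameᵗ-correct t h)

  agree-bind : ∀ {b σ ρ ρ'} n a → Agree b σ ρ ρ' →
    Agree b (redirect σ n (fresh σ b)) (ρ [ fresh σ b ↦ a ]) (ρ' [ n ↦ a ])
  agree-bind {b} {σ} {ρ} {ρ'} n a h {v} v<b with n ℕ.≟ v
  ... | yes _ = update-same ρ (fresh σ b) a
  ... | no _ = trans (update-other ρ a λ e → ℕ.<⇒≢ (fresh-> σ b v<b) (sym e)) (h v<b)

  rename-correct : ∀ φ {σ ρ ρ'} → Agree (vars φ) σ ρ ρ' → ⟦ rename σ φ ⟧ ρ ⇔ ⟦ φ ⟧ ρ'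
  rename-correct (s ≐ t) {σ} {ρ} {ρ'} h = mk⇔
    (λ e → trans (sym s≡) (trans e t≡)) (λ e → trans s≡ (trans e (sym t≡)))
    where
    s≡ = renameᵗ-correct s (agree-≤ {σ = σ} {ρ} {ρ'} (ℕ.m≤m⊔n (varsᵗ s) (varsᵗ t)) h)
    t≡ = renameᵗ-correct t (agree-≤ {σ = σ} {ρ} {ρ'} (ℕ.m≤n⊔m (varsᵗ s) (varsᵗ t)) h)
  rename-correct (ord s t u) {σ} {ρ} {ρ'} h = mk⇔ (resp s≡ t≡ u≡) (resp (sym s≡) (sym t≡) (sym u≡))
    where
    resp : ∀ {a a' b b' c c'} → a ≡ a' → b ≡ b' → c ≡ c' → O a b c → O a' b' c'
    resp refl refl refl o = o
    tu≤ = ℕ.m≤n⊔m (varsᵗ s) (varsᵗ t ℕ.⊔ varsᵗ u)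
    s≡ = renameᵗ-correct s (agree-≤ {σ = σ} {ρ} {ρ'} (ℕ.m≤m⊔n (varsᵗ s) (varsᵗ t ℕ.⊔ varsᵗ u)) h)
    t≡ = renameᵗ-correct t (agree-≤ {σ = σ} {ρ} {ρ'} (ℕ.≤-trans (ℕ.m≤m⊔n (varsᵗ t) (varsᵗ u)) tu≤) h)
    u≡ = renameᵗ-correct u (agree-≤ {σ = σ} {ρ} {ρ'} (ℕ.≤-trans (ℕ.m≤n⊔m (varsᵗ t) (varsᵗ u)) tu≤) h)
  rename-correct ⊥ᶠ h = mk⇔ id id
  rename-correct (¬ᶠ φ) h = mk⇔ (λ f x → f (from I x)) (λ f x → f (to I x))
    where I = rename-correct φ h
  rename-correct (φ ∧ᶠ ψ) {σ} {ρ} {ρ'} h = mk⇔ (λ (x , y) → to I x , to J y) (λ (x , y) → from I x , from J y)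
    where
    I = rename-correct φ (agree-≤ {σ = σ} {ρ} {ρ'} (ℕ.m≤m⊔n (vars φ) (vars ψ)) h)
    J = rename-correct ψ (agree-≤ {σ = σ} {ρ} {ρ'} (ℕ.m≤n⊔m (vars φ) (vars ψ)) h)
  rename-correct (φ ∨ᶠ ψ) {σ} {ρ} {ρ'} h = mk⇔ (Sum.map (to I) (to J)) (Sum.map (from I) (from J))
    where
    I = rename-correct φ (agree-≤ {σ = σ} {ρ} {ρ'} (ℕ.m≤m⊔n (vars φ) (vars ψ)) h)
    J = rename-correct ψ (agree-≤ {σ = σ} {ρ} {ρ'} (ℕ.m≤n⊔m (vars φ) (vars ψ)) h)
  rename-correct (φ ⇒ᶠ ψ) {σ} {ρ} {ρ'} h = mk⇔ (λ f x → to J (f (from I x))) (λ f x → from J (f (to I x)))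
    where
    I = rename-correct φ (agree-≤ {σ = σ} {ρ} {ρ'} (ℕ.m≤m⊔n (vars φ) (vars ψ)) h)
    J = rename-correct ψ (agree-≤ {σ = σ} {ρ} {ρ'} (ℕ.m≤n⊔m (vars φ) (vars ψ)) h)
  rename-correct (∀ᶠ n φ) {σ} {ρ} {ρ'} h = mk⇔ (λ f a → to (I a) (f a)) (λ f a → from (I a) (f a))
    where I = λ a → rename-correct φ (agree-bind {σ = σ} {ρ} {ρ'} n a (agree-≤ {σ = σ} {ρ} {ρ'} (ℕ.m≤n⊔m (suc n) (vars φ)) h))
  rename-correct (∃ᶠ n φ) {σ} {ρ} {ρ'} h = mk⇔ (λ (a , x) → a , to (I a) x) (λ (a , x) → a , from (I a) x)
    where I = λ a → rename-correct φ (agree-bind {σ = σ} {ρ} {ρ'} n a (agree-≤ {σ = σ} {ρ} {ρ'} (ℕ.m≤n⊔m (suc n) (vars φ)) h))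

  -- Both sides are equivalent to the truth of `rename id φ` at `ρ`; function extensionality is
  -- thereby avoided.
  formula-resp : ∀ φ {ρ ρ'} → (∀ i → ρ i ≡ ρ' i) → ⟦ φ ⟧ ρ → ⟦ φ ⟧ ρ'
  formula-resp φ {ρ} {ρ'} h x = to (rename-correct φ {id} {ρ} {ρ'} (λ {v} _ → h v))
    (from (rename-correct φ {id} {ρ} {ρ} (λ _ → refl)) x)

  infixr 5 _◂_
  _◂_ : Carrier → Env → Env
  (a ◂ ρ) zero = a
  (a ◂ ρ) (suc i) = ρ i

  record Definable (P : Env → Set) : Set where
    field
      formula : Formula
      defines : ∀ {ρ} → P ρ ⇔ ⟦ formula ⟧ ρ

    resp : ∀ {ρ ρ'} → (∀ i → ρ i ≡ ρ' i) → P ρ → P ρ'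
    resp h p = from defines (formula-resp formula h (to defines p))
  open Definable

  definable-⇔ : ∀ {P Q} → (∀ {ρ} → P ρ ⇔ Q ρ) → Definable P → Definable Q
  definable-⇔ h D = record { formula = formula D
    ; defines = mk⇔ (λ q → to (defines D) (from h q)) (λ x → to h (from (defines D) x)) }

  definable-formula : ∀ φ → Definable ⟦ φ ⟧
  definable-formula φ = record { formula = φ ; defines = mk⇔ id id }

  definable-⊥ : Definable (λ _ → ⊥)
  definable-⊥ = definable-formula ⊥ᶠ

  definable-¬ : ∀ {P} → Definable P → Definable (λ ρ → ¬ P ρ)
  definable-¬ D = record { formula = ¬ᶠ (formula D)
    ; defines = mk⇔ (λ f x → f (from (defines D) x)) (λ f x → f (to (defines D) x)) }

  definable-× : ∀ {P Q} → Definable P → Definable Q → Definable (λ ρ → P ρ × Q ρ)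
  definable-× D E = record { formula = formula D ∧ᶠ formula E
    ; defines = mk⇔ (λ (x , y) → to (defines D) x , to (defines E) y) (λ (x , y) → from (defines D) x , from (defines E) y) }

  definable-→ : ∀ {P Q} → Definable P → Definable Q → Definable (λ ρ → P ρ → Q ρ)
  definable-→ D E = record { formula = formula D ⇒ᶠ formula E
    ; defines = mk⇔ (λ f x → to (defines E) (f (from (defines D) x))) (λ f x → from (defines E) (f (to (defines D) x))) }

  definable-rename : ∀ {P} σ → Definable P → Definable (λ ρ → P (λ i → ρ (σ i)))
  definable-rename σ D = record { formula = rename σ (formula D)
    ; defines = mk⇔ (λ x → from R (to (defines D) x)) (λ x → from (defines D) (to R x)) }
    where
    R : ∀ {ρ} → ⟦ rename σ (formula D) ⟧ ρ ⇔ ⟦ formula D ⟧ (λ i → ρ (σ i))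
    R = rename-correct (formula D) λ _ → refl

  -- Predicates are built in de Bruijn style, with the bound element at 0, while formulas bind by
  -- name. The name chosen for the binder is `vars F`, which no shifted variable of `F` reaches.
  bindFirst : ℕ → ℕ → ℕ
  bindFirst k zero = k
  bindFirst k (suc i) = i

  bindFirst-correct : ∀ φ {ρ a} → ⟦ rename (bindFirst (vars φ)) φ ⟧ (ρ [ vars φ ↦ a ]) ⇔ ⟦ φ ⟧ (a ◂ ρ)
  bindFirst-correct φ {ρ} {a} = rename-correct φ λ { {zero} _ → update-same ρ (vars φ) a
    ; {suc i} i<b → update-other ρ a (λ e → ℕ.<⇒≢ (ℕ.<⇒≤ i<b) (sym e)) }

  definable-∀ : ∀ {P} → Definable P → Definable (λ ρ → ∀ a → P (a ◂ ρ))
  definable-∀ D = record { formula = ∀ᶠ (vars F) (rename (bindFirst (vars F)) F)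
    ; defines = mk⇔ (λ f a → from (bindFirst-correct F) (to (defines D) (f a)))
                    (λ f a → from (defines D) (to (bindFirst-correct F) (f a))) }
    where F = formula D

  definable-∃ : ∀ {P} → Definable P → Definable (λ ρ → ∃ λ a → P (a ◂ ρ))
  definable-∃ D = record { formula = ∃ᶠ (vars F) (rename (bindFirst (vars F)) F)
    ; defines = mk⇔ (λ (a , x) → a , from (bindFirst-correct F) (to (defines D) x))
                    (λ (a , x) → a , from (defines D) (to (bindFirst-correct F) x)) }
    where F = formula D

  multiple : ℕ → Term → Term
  multiple zero t = zer
  multiple (suc n) t = t +ᵗ multiple n t

  ⟦multiple⟧ : ∀ n t ρ → ⟦ multiple n t ⟧ᵗ ρ ≡ _·_ G n (⟦ t ⟧ᵗ ρ)
  ⟦multiple⟧ zero t ρ = refl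
  ⟦multiple⟧ (suc n) t ρ = cong (⟦ t ⟧ᵗ ρ ⊕_) (⟦multiple⟧ n t ρ)

  -- The point is variable 0, the parameters are the variables 1, 2, …
  Definable₁ : (Carrier → Env → Set) → Set
  Definable₁ X = Definable (λ ρ → X (ρ 0) (λ i → ρ (suc i)))

  resp₁ : ∀ {X} → Definable₁ X → ∀ {x ρ ρ'} → (∀ i → ρ i ≡ ρ' i) → X x ρ → X x ρ'
  resp₁ D {x} h p = resp D {x ◂ _} {x ◂ _} (λ { zero → refl ; (suc i) → h i }) p

  definable-scaled : ∀ M φ → Definable₁ (λ z ρ → ⟦ φ ⟧ (_·_ G M z ◂ ρ))
  definable-scaled M φ = definable-⇔
    (λ {ρ} → mk⇔
      (λ { (y , e , h) → formula-resp φ (λ { zero → trans e (⟦multiple⟧ M (var 1) (y ◂ ρ)) ; (suc i) → refl }) h })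
      (λ h → _ , sym (⟦multiple⟧ M (var 1) (_ ◂ ρ)) , formula-resp φ (λ { zero → refl ; (suc i) → refl }) h))
    (definable-∃ (definable-× (definable-formula (var 0 ≐ multiple M (var 1)))
      (definable-rename (λ { zero → 0 ; (suc i) → 2 ℕ.+ i }) (definable-formula φ))))

-- Initial segments and uniform definitions of types

+-injective-≤ : ∀ {a b c d} → a ℕ.≤ b → c ℕ.≤ d → a ℕ.+ c ≡ b ℕ.+ d → a ≡ b × c ≡ d
+-injective-≤ {a} {b} {c} {d} a≤b c≤d e = a≡b , ℕ.+-cancelˡ-≡ a c d (trans e (cong (ℕ._+ d) (sym a≡b)))
  where
  a≡b : a ≡ b
  a≡b = ℕ.≤-antisym a≤b (ℕ.+-cancelʳ-≤ d b a (ℕ.≤-trans (ℕ.≤-reflexive (sym e)) (ℕ.+-monoʳ-≤ a c≤d)))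

module InitialSegments (G : OrientedAbelianGroup) (em : ExcludedMiddle 0ℓ) where
  open OrientedAbelianGroup G
  open Semantics G
  open Definability G
  open CyclicOrder G em using (_≺_; ≺-asym; ≺-irrefl; ≺-trans; ≺-connex; indicator)

  private
    dne : ∀ {P : Set} → ¬ ¬ P → P
    dne = em⇒dne em

  infix 4 _≼_
  _≼_ : Carrier → Carrier → Set
  x ≼ y = ¬ y ≺ x

  ≼-total : ∀ x y → x ≼ y ⊎ y ≼ x
  ≼-total x y with em {y ≺ x}
  ... | yes h = inj₂ (≺-asym h)
  ... | no h = inj₁ h

  ≼-trans : ∀ {x y z} → x ≼ y → y ≼ z → x ≼ z
  ≼-trans {x} {y} {z} x≼y y≼z z≺x with em {x ≡ y}
  ... | yes refl = y≼z z≺x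
  ... | no x≢y with ≺-connex x≢y
  ...   | inj₁ x≺y = y≼z (≺-trans z≺x x≺y)
  ...   | inj₂ y≺x = x≼y y≺x

  definable-≼ : ∀ i j → Definable (λ ρ → ρ i ≼ ρ j)
  definable-≼ i j = definable-¬ (definable-formula
    (¬ᶠ (var j ≐ var i) ∧ᶠ ((var j ≐ zer) ∨ᶠ ord zer (var j) (var i))))

  Initial : (Carrier → Set) → Set
  Initial D = ∀ {x y} → x ≼ y → D y → D x

  module Counting {I : Set} (D : I → Carrier → Set) (initial : ∀ i → Initial (D i)) where

    outside : I → Carrier → ℕ
    outside i z = indicator (em {¬ D i z})

    outside-mono : ∀ i {x y} → x ≼ y → outside i x ℕ.≤ outside i y
    outside-mono i {x} {y} x≼y with em {¬ D i x} | em {¬ D i y}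
    ... | yes x∉ | yes y∉ = ℕ.≤-refl
    ... | yes x∉ | no y∈ = contradiction (λ y∈D → x∉ (initial i x≼y y∈D)) y∈
    ... | no _ | _ = ℕ.z≤n

    outside-≡ : ∀ i {x y} → outside i x ≡ outside i y → D i x → D i y
    outside-≡ i {x} {y} e x∈ with em {¬ D i x} | em {¬ D i y}
    ... | yes x∉ | _ = contradiction x∈ x∉
    ... | no _ | yes _ = contradiction e λ ()
    ... | no _ | no y∈ = dne y∈

    -- Numbers the atoms of the segments along the order.
    count : List I → Carrier → ℕ
    count [] z = 0
    count (i ∷ is) z = outside i z ℕ.+ count is z

    count-≤ : ∀ is z → count is z ℕ.≤ List.length is
    count-≤ [] z = ℕ.z≤n
    count-≤ (i ∷ is) z = ℕ.+-mono-≤ (indicator-≤ em) (count-≤ is z)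
      where
      indicator-≤ : ∀ {P : Set} (d : Dec P) → indicator d ℕ.≤ 1
      indicator-≤ (yes _) = ℕ.≤-refl
      indicator-≤ (no _) = ℕ.z≤n

    count-mono : ∀ is {x y} → x ≼ y → count is x ℕ.≤ count is y
    count-mono [] x≼y = ℕ.z≤n
    count-mono (i ∷ is) x≼y = ℕ.+-mono-≤ (outside-mono i x≼y) (count-mono is x≼y)

    -- Every summand is monotone along the order, so equal sums have equal summands.
    count-≡ : ∀ is {x y} → x ≼ y → count is x ≡ count is y → ∀ {i} → i ∈ is → D i x ⇔ D i y
    count-≡ (i ∷ is) x≼y e (here refl) =
      mk⇔ (outside-≡ i (proj₁ (+-injective-≤ (outside-mono i x≼y) (count-mono is x≼y) e))) (initial i x≼y)
    count-≡ (i ∷ is) x≼y e (there i∈) =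
      count-≡ is x≼y (proj₂ (+-injective-≤ (outside-mono i x≼y) (count-mono is x≼y) e)) i∈

  -- If Φ is constant on the atoms of n initial segments, then at most n + 1 of the following segments
  -- are proper; unlike the former they are definable from Φ.
  module Chains (Φ : Carrier → Env → Set) where

    -- Each level adds to the previous one the longest run, starting right above it, on which `Φ`
    -- keeps its truth value.
    Chain : ℕ → Carrier → Env → Set
    Chain zero z ρ = ⊥
    Chain (suc j) z ρ = ∀ w w' → w ≼ z → w' ≼ z → ¬ Chain j w ρ → ¬ Chain j w' ρ → Φ w ρ → Φ w' ρ

    chain-initial : ∀ j {ρ} → Initial (λ z → Chain j z ρ)
    chain-initial (suc j) x≼y h w w' w≼x w'≼x = h w w' (≼-trans w≼x x≼y) (≼-trans w'≼x x≼y)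

    abstract
      definable-chain : Definable₁ Φ → ∀ j → Definable₁ (Chain j)
      definable-chain DΦ zero = definable-⊥
      definable-chain DΦ (suc j) = definable-∀ (definable-∀ (
        definable-→ (definable-≼ 1 2) (definable-→ (definable-≼ 0 2)
        (definable-→ (definable-¬ (at (Chain j) 1 (definable-chain DΦ j)))
        (definable-→ (definable-¬ (at (Chain j) 0 (definable-chain DΦ j)))
        (definable-→ (at Φ 1 DΦ) (at Φ 0 DΦ)))))))
        where
        point : ℕ → ℕ → ℕ
        point k zero = k
        point k (suc i) = 3 ℕ.+ i
        at : ∀ X k → Definable₁ X → Definable (λ ρ → X (ρ k) (λ i → ρ (3 ℕ.+ i)))
        at X k D = definable-rename (point k) D

    module _ {I : Set} (is : List I) (D : I → Carrier → Set) (initial : ∀ i → Initial (D i)) (ρ : Env)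
      (constant : ∀ {x y} → (∀ {i} → i ∈ is → D i x ⇔ D i y) → Φ x ρ → Φ y ρ) where
      open Counting D initial

      -- Suppose the count at `z` is at most `j`. Points below `z` outside level `j` have count at
      -- least `j` by induction, hence the same count as `z`. They share its atom, `Φ` is constant
      -- on them, and `z` lies in level `j + 1`.
      chain-count : ∀ j {z} → ¬ Chain j z ρ → j ℕ.≤ count is z
      chain-count zero _ = ℕ.z≤n
      chain-count (suc j) {z} z∉ = dne λ ≰ → z∉ λ w w' w≼z w'≼z w∉ w'∉ →
        let tight : ∀ {v} → v ≼ z → ¬ Chain j v ρ → count is v ≡ count is z
            tight v≼z v∉ = ℕ.≤-antisym (count-mono is v≼z) (ℕ.≤-trans (ℕ.≤-pred (ℕ.≰⇒> ≰)) (chain-count j v∉))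
            same = λ {i} (i∈ : i ∈ is) → count-≡ is w≼z (tight w≼z w∉) i∈
            same' = λ {i} (i∈ : i ∈ is) → count-≡ is w'≼z (tight w'≼z w'∉) i∈
        in constant λ i∈ → mk⇔ (λ p → Equivalence.from (same' i∈) (Equivalence.to (same i∈) p))
                               (λ p → Equivalence.from (same i∈) (Equivalence.to (same' i∈) p))

      chain-exhausts : ∀ z → Chain (suc (List.length is)) z ρ
      chain-exhausts z = dne λ z∉ → ℕ.<⇒≱ ℕ.≤-refl (ℕ.≤-trans (chain-count _ z∉) (count-≤ is z))

      -- Descend to the least level that contains `x`. Both points lie in it and outside the level
      -- before, that is, in the same run of constancy.
      chain-atoms : ∀ {x y} → (∀ j → j ℕ.≤ suc (List.length is) → Chain j x ρ ⇔ Chain j y ρ) → Φ x ρ → Φ y ρ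
      chain-atoms {x} {y} same = from-level (suc (List.length is)) ℕ.≤-refl (chain-exhausts x)
        where
        open Equivalence using (to; from)
        from-level : ∀ j → j ℕ.≤ suc (List.length is) → Chain j x ρ → Φ x ρ → Φ y ρ
        from-level (suc j) j≤ x∈ with em {Chain j x ρ}
        ... | yes x∈' = from-level j (ℕ.≤-trans (ℕ.n≤1+n j) j≤) x∈'
        ... | no x∉ with ≼-total x y
        ...   | inj₁ x≼y = to (same (suc j) j≤) x∈ x y x≼y ≺-irrefl x∉ (λ y∈ → x∉ (from (same j (ℕ.≤-trans (ℕ.n≤1+n j) j≤)) y∈))
        ...   | inj₂ y≼x = x∈ x y ≺-irrefl y≼x x∉ (λ y∈ → x∉ (from (same j (ℕ.≤-trans (ℕ.n≤1+n j) j≤)) y∈))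

  module TypeDefinition {S : Set} (X : S → Carrier → Env → Set) (X-definable : ∀ s → Definable₁ (X s))
    (X-initial : ∀ s {ρ} → Initial (λ z → X s z ρ)) (m : ℕ) (segments : List S) where

    env : Vec Carrier m → Env
    env b = envOf (Vec.toList b)

    Indexed : Set
    Indexed = S × Vec Carrier m

    infix 4 _⊑_
    _⊑_ : Indexed → Indexed → Set
    (s , b) ⊑ (s' , b') = ∀ z → X s z (env b) → X s' z (env b')

    -- Initial segments over different parameter tuples are still nested; this puts all parameters
    -- of `B` on one scale.
    ⊑-total : ∀ p q → p ⊑ q ⊎ q ⊑ p
    ⊑-total (s , b) (s' , b') with em {∃ λ z → X s z (env b) × ¬ X s' z (env b')}
    ... | no none = inj₁ λ z z∈ → dne λ z∉ → none (z , z∈ , z∉)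
    ... | yes (x , x∈ , x∉) = inj₂ λ y y∈ → X-initial s (λ x≺y → x∉ (X-initial s' (≺-asym x≺y) y∈)) x∈

    module _ (B : List (Vec Carrier m)) (b₀ : Vec Carrier m) (b₀∈B : b₀ ∈ B) (s₀ : S) (s₀∈ : s₀ ∈ segments)
      (s₀-empty : ∀ {z ρ} → ¬ X s₀ z ρ) (z : Carrier) where

      -- The empty segment `s₀` guarantees a candidate, whatever `z` is.
      largest-avoiding : ∃ λ p → p ∈ List.cartesianProduct segments B × ¬ X (proj₁ p) z (env (proj₂ p)) ×
        (∀ {q} → q ∈ List.cartesianProduct segments B → ¬ X (proj₁ q) z (env (proj₂ q)) → q ⊑ p)
      largest-avoiding = maximum em _⊑_ (λ p⊑q q⊑r x x∈ → q⊑r x (p⊑q x x∈)) ⊑-total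
        (λ (s , b) → ¬ X s z (env b)) (List.cartesianProduct segments B)
        ((s₀ , b₀) , ∈-cartesianProduct⁺ s₀∈ b₀∈B , s₀-empty)

    -- The germ of `Φ` at the upper end of the segment. The bound `c` replaces the point `z`, which
    -- a defining formula must not mention.
    JustAbove : S → (Carrier → Env → Set) → Env → Env → Set
    JustAbove s Φ β β₁ = ∃ λ c → ¬ X s c β₁ × (∀ x → x ≼ c → ¬ X s x β₁ → Φ x β)

    -- Every segment over `b` that avoids `z` is contained in the chosen one, so no segment over `b`
    -- separates `z` from a point outside the chosen one. This settles both the points below `z` and
    -- a witness `c` on either side of `z`.
    justAbove-correct : ∀ {B s b₁ z b Φ} →
      ¬ X s z (env b₁) → (∀ {q} → q ∈ List.cartesianProduct segments B → ¬ X (proj₁ q) z (env (proj₂ q)) → q ⊑ (s , b₁)) →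
      b ∈ B → (∀ {x y} → (∀ {t} → t ∈ segments → X t x (env b) ⇔ X t y (env b)) → Φ x (env b) → Φ y (env b)) →
      Φ z (env b) ⇔ JustAbove s Φ (env b) (env b₁)
    justAbove-correct {B} {s} {b₁} {z} {b} {Φ} z∉ largest b∈ constant = mk⇔
      (λ h → z , z∉ , λ x x≼z x∉ → constant (λ t∈ → mk⇔ (X-initial _ x≼z) (up x∉ t∈)) h)
      (λ (c , c∉ , h) → down c c∉ h (≼-total z c))
      where
      up : ∀ {x} → ¬ X s x (env b₁) → ∀ {t} → t ∈ segments → X t x (env b) → X t z (env b)
      up x∉ t∈ x∈ = dne λ z∉' → x∉ (largest (∈-cartesianProduct⁺ t∈ b∈) z∉' _ x∈)
      down : ∀ c → ¬ X s c (env b₁) → (∀ x → x ≼ c → ¬ X s x (env b₁) → Φ x (env b)) → z ≼ c ⊎ c ≼ z → Φ z (env b)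
      down c c∉ h (inj₁ z≼c) = h z z≼c z∉
      down c c∉ h (inj₂ c≼z) = constant (λ t∈ → mk⇔ (up c∉ t∈) (X-initial _ c≼z)) (h c ≺-irrefl c∉)

    -- A formula may mention variables beyond the parameter block, where `envOf` reads the default
    -- `𝟘`. In the concatenated environment `b₁` occupies the next places, so such variables are
    -- sent behind both blocks.
    firstBlock : ℕ → ℕ
    firstBlock i with i ℕ.<? m
    ... | yes _ = i
    ... | no _ = (m ℕ.+ m) ℕ.+ i

    abstract
      definable-justAbove : ∀ s {Φ} → Definable₁ Φ →
        Definable (λ η → JustAbove s Φ (λ i → η (firstBlock i)) (λ i → η (m ℕ.+ i)))
      definable-justAbove s DΦ = definable-∃ (definable-×
        (definable-¬ (definable-rename (λ { zero → 0 ; (suc i) → 1 ℕ.+ (m ℕ.+ i) }) (X-definable s)))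
        (definable-∀ (definable-→ (definable-≼ 0 1) (definable-→
          (definable-¬ (definable-rename (λ { zero → 0 ; (suc i) → 2 ℕ.+ (m ℕ.+ i) }) (X-definable s)))
          (definable-rename (λ { zero → 0 ; (suc i) → 2 ℕ.+ firstBlock i }) DΦ)))))

    envOf-++ : ∀ {n} (b : Vec Carrier n) l i → envOf (Vec.toList b ++ l) (n ℕ.+ i) ≡ envOf l i
    envOf-++ [] l i = refl
    envOf-++ (a ∷ b) l i = envOf-++ b l i

    envOf-++ˡ : ∀ {n} (b : Vec Carrier n) l {i} → i ℕ.< n → envOf (Vec.toList b ++ l) i ≡ envOf (Vec.toList b) i
    envOf-++ˡ (a ∷ b) l {zero} _ = refl
    envOf-++ˡ (a ∷ b) l {suc i} i<n = envOf-++ˡ b l (ℕ.≤-pred i<n)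

    envOf-beyond : ∀ {n} (b : Vec Carrier n) {i} → n ℕ.≤ i → envOf (Vec.toList b) i ≡ 𝟘
    envOf-beyond [] _ = refl
    envOf-beyond (a ∷ b) (ℕ.s≤s n≤i) = envOf-beyond b n≤i

    module _ (b b₁ : Vec Carrier m) where
      η : Env
      η = envOf (Vec.toList b ++ (Vec.toList b₁ ++ []))

      η-second : ∀ i → η (m ℕ.+ i) ≡ env b₁ i
      η-second i = trans (envOf-++ b _ i) (second i)
        where
        second : ∀ i → envOf (Vec.toList b₁ ++ []) i ≡ env b₁ i
        second i with i ℕ.<? m
        ... | yes i<m = envOf-++ˡ b₁ [] i<m
        ... | no i≮m = trans (trans (cong (envOf (Vec.toList b₁ ++ [])) (sym (ℕ.m+[n∸m]≡n (ℕ.≮⇒≥ i≮m)))) (envOf-++ b₁ [] _))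
                (sym (envOf-beyond b₁ (ℕ.≮⇒≥ i≮m)))

      η-first : ∀ i → η (firstBlock i) ≡ env b i
      η-first i with i ℕ.<? m
      ... | yes i<m = envOf-++ˡ b _ i<m
      ... | no i≮m = trans (trans (cong η (ℕ.+-assoc m m i)) (trans (η-second (m ℕ.+ i)) (envOf-beyond b₁ (ℕ.m≤m+n m i))))
              (sym (envOf-beyond b (ℕ.≮⇒≥ i≮m)))

      justAbove-resp : ∀ s {Φ} → Definable₁ Φ →
        JustAbove s Φ (env b) (env b₁) ⇔ JustAbove s Φ (λ i → η (firstBlock i)) (λ i → η (m ℕ.+ i))
      justAbove-resp s {Φ} DΦ = mk⇔
        (λ (c , c∉ , h) → c , (λ c∈ → c∉ (resp₁ {X s} (X-definable s) η-second c∈)) ,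
          λ x x≼c x∉ → resp₁ {Φ} DΦ (λ i → sym (η-first i)) (h x x≼c λ x∈ → x∉ (resp₁ {X s} (X-definable s) (λ i → sym (η-second i)) x∈)))
        (λ (c , c∉ , h) → c , (λ c∈ → c∉ (resp₁ {X s} (X-definable s) (λ i → sym (η-second i)) c∈)) ,
          λ x x≼c x∉ → resp₁ {Φ} DΦ η-first (h x x≼c λ x∈ → x∉ (resp₁ {X s} (X-definable s) η-second x∈)))

  module Scaled {k} (Δ : Vec Formula k) (M : ℕ) where

    Φ : Fin k → Carrier → Env → Set
    Φ l z ρ = ⟦ Vec.lookup Δ l ⟧ (_·_ G M z ◂ ρ)

    Φ-definable : ∀ l → Definable₁ (Φ l)
    Φ-definable l = definable-scaled M (Vec.lookup Δ l)

    module Defining (m : ℕ) {S : Set} (X : S → Carrier → Env → Set) (X-definable : ∀ s → Definable₁ (X s))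
      (X-initial : ∀ s {ρ} → Initial (λ z → X s z ρ)) (segments : List S)
      (constant : ∀ ρ l {x y} → (∀ {s} → s ∈ segments → X s x ρ ⇔ X s y ρ) → Φ l x ρ → Φ l y ρ) where
      open TypeDefinition X X-definable X-initial m segments
      open Equivalence using (to; from)

      ψ : Fin (List.length segments) → Fin k → Formula
      ψ i l = Definable.formula (definable-justAbove (List.lookup segments i) {Φ l} (Φ-definable l))

      Defines : Fin (List.length segments) → List (Vec Carrier m) → Carrier → Vec Carrier m → Set
      Defines i B a b₁ = ∀ l b → b ∈ B →
        ⟦ Vec.lookup Δ l ⟧ (envOf (a ∷ Vec.toList b)) ⇔ ⟦ ψ i l ⟧ (envOf (Vec.toList b ++ (Vec.toList b₁ ++ [])))

      head-env : ∀ a (b : Vec Carrier m) i → envOf (a ∷ Vec.toList b) i ≡ (a ◂ env b) i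
      head-env a b zero = refl
      head-env a b (suc i) = refl

      defines-with : ∀ B z s b₁ → (s∈ : s ∈ segments) → ¬ X s z (env b₁) →
        (∀ {q} → q ∈ List.cartesianProduct segments B → ¬ X (proj₁ q) z (env (proj₂ q)) → q ⊑ (s , b₁)) →
        Defines (Any.index s∈) B (_·_ G M z) b₁
      defines-with B z s b₁ s∈ z∉ largest l b b∈ = mk⇔
          (λ h → to (Definable.defines D {η b b₁}) (to (justAbove-resp b b₁ s' {Φ l} (Φ-definable l))
            (to correct (formula-resp φ (head-env (_·_ G M z) b) h))))
          (λ h → formula-resp φ (λ i → sym (head-env (_·_ G M z) b i))
            (from correct (from (justAbove-resp b b₁ s' {Φ l} (Φ-definable l)) (from (Definable.defines D {η b b₁}) h))))
        where
        φ = Vec.lookup Δ l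
        s' = List.lookup segments (Any.index s∈)
        s≡s' : s ≡ s'
        s≡s' = Any.lookup-index s∈
        D = definable-justAbove s' {Φ l} (Φ-definable l)
        correct : Φ l z (env b) ⇔ JustAbove s' (Φ l) (env b) (env b₁)
        correct = subst (λ t → Φ l z (env b) ⇔ JustAbove t (Φ l) (env b) (env b₁)) s≡s'
          (justAbove-correct {B} {s} {b₁} {z} {b} {Φ l} z∉ largest b∈ (constant (env b) l))

      udtfs : (∀ a → ∃ λ z → a ≡ _·_ G M z) → ∀ {s₀} → s₀ ∈ segments → (∀ {z ρ} → ¬ X s₀ z ρ) → UDTFS m k Δ 1
      udtfs divide {s₀} s₀∈ s₀-empty = List.length segments , ψ , λ B (b₀ , _ , b₀∈ , _) a →
        let z , a≡ = divide a
            (s , b₁) , p∈ , z∉ , largest = largest-avoiding B b₀ b₀∈ s₀ s₀∈ s₀-empty z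
            s∈ , b₁∈ = ∈-cartesianProduct⁻ segments B p∈
        in (λ _ → b₁) , (λ _ → b₁∈) , Any.index s∈ ,
           subst (λ a → Defines (Any.index s∈) B a b₁) (sym a≡) (defines-with B z s b₁ s∈ z∉ (λ {q} → largest {q}))

  -- The segments `D` may depend on the parameters in any way: only their number matters, and the
  -- formulas are built from the chains of `Φ`.
  udtfs-from-segments : ∀ {k} {Δ : Vec Formula (suc k)} {M} m → (∀ a → ∃ λ z → a ≡ _·_ G M z) →
    {I : Set} (is : List I) (D : Env → I → Carrier → Set) → (∀ ρ i → Initial (D ρ i)) →
    (∀ ρ l {x y} → (∀ {i} → i ∈ is → D ρ i x ⇔ D ρ i y) → Scaled.Φ Δ M l x ρ → Scaled.Φ Δ M l y ρ) → UDTFS m (suc k) Δ 1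
  udtfs-from-segments {k} {Δ} {M} m divide is D initial constant =
    Defining.udtfs m X X-definable X-initial segments constant-on-chains divide {zero , 0}
      (∈-cartesianProduct⁺ (∈-allFin {n = suc k} zero) (∈-upTo⁺ {levels} (ℕ.s≤s ℕ.z≤n))) (λ ())
    where
    open Scaled Δ M

    levels : ℕ
    -- Levels from 0, which is empty and serves as `s₀`, to one more than the number of segments,
    -- which is everything.
    levels = 2 ℕ.+ List.length is

    segments : List (Fin (suc k) × ℕ)
    segments = List.cartesianProduct (List.allFin (suc k)) (List.upTo levels)

    X : Fin (suc k) × ℕ → Carrier → Env → Set
    X (l , j) = Chains.Chain (Φ l) j

    X-definable : ∀ s → Definable₁ (X s)
    X-definable (l , j) = Chains.definable-chain (Φ l) (Φ-definable l) j

    X-initial : ∀ s {ρ} → Initial (λ z → X s z ρ)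
    X-initial (l , j) = Chains.chain-initial (Φ l) j

    constant-on-chains : ∀ ρ l {x y} → (∀ {s} → s ∈ segments → X s x ρ ⇔ X s y ρ) → Φ l x ρ → Φ l y ρ
    constant-on-chains ρ l same = Chains.chain-atoms (Φ l) is (D ρ) (initial ρ) ρ (constant ρ l)
      λ j j≤ → same (∈-cartesianProduct⁺ (∈-allFin l) (∈-upTo⁺ (ℕ.s≤s j≤)))

-- The atoms cut out by linear forms in M z

module Atoms (G : OrientedAbelianGroup) (em : ExcludedMiddle 0ℓ) (Ũ : UniversalCover G em)
  (regularlyDense : RegularlyDense G) (primeDivisible : ∀ p → Prime p → ∀ a → ∃ λ c → a ≡ _·_ G p c)
  (nontrivial : ∃ λ a → a ≢ OrientedAbelianGroup.𝟘 G) where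
  open OrientedAbelianGroup G using (𝟘)
  private
    module A = OrientedAbelianGroup G
    module 𝔾 = CyclicOrder G em
    infixr 7 _∙_
    _∙_ = _·_ G
  open CoverProperties G em Ũ
  open Density G em Ũ regularlyDense primeDivisible nontrivial
  open Invariance G em Ũ regularlyDense primeDivisible nontrivial
  open Semantics G
  open Definability G using (_◂_)
  open InitialSegments G em
  open Equivalence using (to; from)

  divide : ∀ M .{{_ : ℕ.NonZero M}} a → ∃ λ z → a ≡ M ∙ z
  divide M a with divisible M (lift a)
  ... | w , k , e = π w , (begin
      a                              ≡⟨ π-lift a ⟨
      π (lift a)                     ≡⟨ cong π e ⟩
      π (+ M • w + k • 𝟙)            ≡⟨ π-+ _ _ ⟩
      π (+ M • w) A.⊕ π (k • 𝟙)      ≡⟨ cong₂ A._⊕_ (π-• M w) (π-•𝟙 k) ⟩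
      M ∙ π w A.⊕ 𝟘                  ≡⟨ 𝔾.⊕-identityʳ _ ⟩
      M ∙ π w                        ∎)
    where open ≡-Reasoning

  module _ (V N M : ℕ) {{M≢0 : ℕ.NonZero M}} where

    Index : Set
    Index = (ℕ × ℕ × Vec ℤ (2 ℕ.+ V)) × Bool

    -- `j` runs over the possible integer parts up to `M` and one further value, because an integer
    -- part `j` is recognised by the signs at `j` and `j + 1`. The bound `suc N` admits `c = 1` even
    -- for `N = 0`. Only `c ≥ 0` occurs, to keep `value` increasing in `z`; the Boolean selects
    -- negative or non-positive values.
    indices : List Index
    indices = List.cartesianProduct
      (List.cartesianProduct (List.upTo (2 ℕ.+ N)) (List.cartesianProduct (List.upTo (2 ℕ.+ M)) (box (2 ℕ.+ V) (suc N))))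
      (true ∷ false ∷ [])

    -- If `j` is the integer part, the bracket is `lift (M ∙ z)`, and this is a linear form in that
    -- lift and the parameters. The entry `𝟘` fills the place of the point, whose coefficient `c` is
    -- kept apart.
    value : Env → ℕ × ℕ × Vec ℤ (2 ℕ.+ V) → A.Carrier → Carrier
    value ρ (c , j , s) z = + c • (+ M • lift z + - (+ j • 𝟙)) + eval s (lifted (𝟘 ◂ ρ))

    Segment : Env → Index → A.Carrier → Set
    Segment ρ (k , true) z = ¬ NonNeg (value ρ k z)
    Segment ρ (k , false) z = NonNeg (- value ρ k z)

    value-mono : ∀ ρ k {x y} → x ≼ y → NonNeg (value ρ k y + - value ρ k x)
    value-mono ρ (c , j , s) {x} {y} x≼y = nonNeg-resp eq (nonNeg-• c (nonNeg-• M
        (nonNeg-resp (solve (lift x ∷ lift y ∷ []) (⊟ (v0 ⊟ v1)) (v1 ⊟ v0) refl) (¬pos⇒nonNeg λ p → x≼y (lift⇒≺ p)))))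
      where
      open ≡-Reasoning
      E = eval s (lifted (𝟘 ◂ ρ))
      J = + j • 𝟙
      X = + M • lift x
      Y = + M • lift y
      eq : + c • (+ M • (lift y + - lift x)) ≡ (+ c • (Y + - J) + E) + - (+ c • (X + - J) + E)
      eq = begin
        + c • (+ M • (lift y + - lift x))
          ≡⟨ cong (+ c •_) (trans (•-+ (+ M) _ _) (cong (λ z → Y + z) (•-neg (+ M) _))) ⟩
        + c • (Y + - X)
          ≡⟨ cong (+ c •_) (solve (Y ∷ X ∷ J ∷ []) (v0 ⊟ v1) ((v0 ⊟ v2) ⊟ (v1 ⊟ v2)) refl) ⟩
        + c • ((Y + - J) + - (X + - J))
          ≡⟨ trans (•-+ (+ c) _ _) (cong (λ z → + c • (Y + - J) + z) (•-neg (+ c) _)) ⟩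
        + c • (Y + - J) + - (+ c • (X + - J))
          ≡⟨ solve ((+ c • (Y + - J)) ∷ (+ c • (X + - J)) ∷ E ∷ []) (v0 ⊟ v1) ((v0 ⊞ v2) ⊟ (v1 ⊞ v2)) refl ⟩
        (+ c • (Y + - J) + E) + - (+ c • (X + - J) + E) ∎

    segment-initial : ∀ ρ i → Initial (Segment ρ i)
    segment-initial ρ (k , true) {x} {y} x≼y y∈ p = y∈ (nonNeg-resp
      (solve (value ρ k x ∷ value ρ k y ∷ []) (v0 ⊞ (v1 ⊟ v0)) v1 refl) (nonNeg-+ p (value-mono ρ k x≼y)))
    segment-initial ρ (k , false) {x} {y} x≼y y∈ = nonNeg-resp
      (solve (value ρ k x ∷ value ρ k y ∷ []) (⊟ v1 ⊞ (v1 ⊟ v0)) (⊟ v0) refl) (nonNeg-+ y∈ (value-mono ρ k x≼y))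

    module _ {ρ : Env} {x y : A.Carrier} (unseparated : ∀ {i} → i ∈ indices → Segment ρ i x ⇔ Segment ρ i y) where

      value-sameSign : ∀ c j s → c ℕ.≤ suc N → j ℕ.≤ suc M → Bounded (suc N) s →
        SameSign (value ρ (c , j , s) x) (value ρ (c , j , s) y)
      value-sameSign c j s c≤ j≤ bs = sameSign
        (mk⇔ (λ p → dne λ q → from (unseparated (k∈ (here refl))) q p)
             (λ p → dne λ q → to (unseparated (k∈ (here refl))) q p))
        (unseparated (k∈ (there (here refl))))
        where
        k∈ : ∀ {b} → b ∈ true ∷ false ∷ [] → ((c , j , s) , b) ∈ indices
        k∈ b∈ = ∈-cartesianProduct⁺ (∈-cartesianProduct⁺ (∈-upTo⁺ (ℕ.s≤s c≤))
          (∈-cartesianProduct⁺ (∈-upTo⁺ (ℕ.s≤s j≤)) (∈-box⁺ bs))) b∈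

      simple-value : ∀ j z → value ρ (1 , j , 0ᵛ) z ≡ + M • lift z + - (+ j • 𝟙)
      simple-value j z = trans (cong₂ _+_ (1-• _) (eval-0 (2 ℕ.+ V) (lifted (𝟘 ◂ ρ))))
        (solve ((+ M • lift z + - (+ j • 𝟙)) ∷ []) (v0 ⊞ zer) v0 refl)

      floor-sameSign : ∀ j → j ℕ.≤ suc M → SameSign (+ M • lift x + - (+ j • 𝟙)) (+ M • lift y + - (+ j • 𝟙))
      floor-sameSign j j≤ = sameSign-resp (simple-value j x) (simple-value j y)
        (value-sameSign 1 j 0ᵛ (ℕ.s≤s ℕ.z≤n) j≤ (bounded-0 (2 ℕ.+ V)))

      -- The signs at `j` and `j + 1` agree for `x` and `y`, so `+ M • lift y - j 𝟙` also lies in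
      -- [0, 𝟙); it projects to `M ∙ y` and is its lift.
      same-floor : ∀ {j} → j ℕ.≤ M → lift (M ∙ x) ≡ + M • lift x + - (+ j • 𝟙) → lift (M ∙ y) ≡ + M • lift y + - (+ j • 𝟙)
      same-floor {j} j≤M e = trans (cong lift (sym π≡)) (lift-π
          (transfer-nonNeg (floor-sameSign j (ℕ.≤-trans j≤M (ℕ.n≤1+n M))) (nonNeg-resp e (lift-nonNeg (M ∙ x))))
          (pos-resp (next y) (transfer-pos (sameSign-neg (floor-sameSign (suc j) (ℕ.s≤s j≤M)))
            (pos-resp (sym (next x)) (pos-resp (cong (λ z → 𝟙 + - z) e) (lift<𝟙 (M ∙ x)))))))
        where
        next : ∀ z → - (+ M • lift z + - (+ suc j • 𝟙)) ≡ 𝟙 + - (+ M • lift z + - (+ j • 𝟙))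
        next z = solve ((+ M • lift z) ∷ 𝟙 ∷ (+ j • 𝟙) ∷ []) (⊟ (v0 ⊟ (v1 ⊞ v2))) (v1 ⊟ (v0 ⊟ v2)) refl
        open ≡-Reasoning
        π≡ : π (+ M • lift y + - (+ j • 𝟙)) ≡ M ∙ y
        π≡ = begin
          π (+ M • lift y + - (+ j • 𝟙))             ≡⟨ π-+ _ _ ⟩
          π (+ M • lift y) A.⊕ π (- (+ j • 𝟙))       ≡⟨ cong₂ A._⊕_ (trans (π-• M _) (cong (M ∙_) (π-lift y)))
                                                         (trans (π-neg _) (cong A.⊖_ (π-•𝟙 (+ j)))) ⟩
          M ∙ y A.⊕ (A.⊖ 𝟘)                          ≡⟨ 𝔾.solve (M ∙ y ∷ []) (𝔾.v0 𝔾.⊟ 𝔾.zer) 𝔾.v0 refl ⟩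
          M ∙ y                                      ∎

      module _ {j : ℕ} (lift-x : lift (M ∙ x) ≡ + M • lift x + - (+ j • 𝟙))
        (lift-y : lift (M ∙ y) ≡ + M • lift y + - (+ j • 𝟙)) (j≤M : j ℕ.≤ M) where

        sameSign-multiple : ∀ k (s : Vec ℤ (2 ℕ.+ V)) → ∣ k ∣ ℕ.≤ suc N → Bounded (suc N) s →
          SameSign (k • lift (M ∙ x) + eval s (lifted (𝟘 ◂ ρ))) (k • lift (M ∙ y) + eval s (lifted (𝟘 ◂ ρ)))
        sameSign-multiple (+ c) s c≤ bs = subst₂ (λ a b → SameSign (+ c • a + E) (+ c • b + E)) (sym lift-x) (sym lift-y)
          (value-sameSign c j s c≤ (ℕ.≤-trans j≤M (ℕ.n≤1+n M)) bs)
          where E = eval s (lifted (𝟘 ◂ ρ))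
        sameSign-multiple -[1+ c ] s c≤ bs = sameSign-resp (eq (lift (M ∙ x))) (eq (lift (M ∙ y)))
          (sameSign-neg (sameSign-multiple (+ suc c) (-ᵛ s) c≤ (bounded-neg bs)))
          where
          E = eval s (lifted (𝟘 ◂ ρ))
          eq : ∀ a → - (+ suc c • a + eval (-ᵛ s) (lifted (𝟘 ◂ ρ))) ≡ -[1+ c ] • a + E
          eq a = trans (cong (λ z → - (+ suc c • a + z)) (eval-neg s (lifted (𝟘 ◂ ρ))))
            (solve ((+ suc c • a) ∷ E ∷ []) (⊟ (v0 ⊟ v1)) (⊟ v0 ⊞ v1) refl)

        scaled-similar : Similar (2 ℕ.+ V) (suc N) M (lifted (M ∙ x ◂ ρ)) (lifted (M ∙ y ◂ ρ))
        scaled-similar = record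
          { signs = λ m bm → sameSign-resp (sym (at-point x m)) (sym (at-point y m))
              (sameSign-multiple (Vec.lookup m (suc zero)) (m Vec.[ suc zero ]≔ 0ℤ)
                (VecAll.lookup⁺ bm (suc zero)) (bounded-erase (suc zero) bm))
          ; congruent = λ { zero → congruent-refl M 𝟙
                          ; (suc zero) → congruentBy (ℤ.- + j) (lift x) (lift y) (trans lift-x (eq x)) (trans lift-y (eq y))
                          ; (suc (suc i)) → congruent-refl M (lift (ρ i)) } }
          where
          at-point : ∀ z m → eval m (lifted (M ∙ z ◂ ρ)) ≡
            Vec.lookup m (suc zero) • lift (M ∙ z) + eval (m Vec.[ suc zero ]≔ 0ℤ) (lifted (𝟘 ◂ ρ))
          at-point z m = eval-update m (suc zero)
            λ { zero _ → refl ; (suc zero) ne → contradiction refl ne ; (suc (suc i)) _ → refl }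
          eq : ∀ z → + M • lift z + - (+ j • 𝟙) ≡ (ℤ.- + j) • 𝟙 + + M • lift z
          eq z = trans (solve ((+ M • lift z) ∷ (+ j • 𝟙) ∷ []) (v0 ⊟ v1) (⊟ v1 ⊞ v0) refl)
            (cong (λ t → t + + M • lift z) (sym (neg-• (+ j) 𝟙)))

      unseparated⇒similar : Similar (2 ℕ.+ V) (suc N) M (lifted (M ∙ x ◂ ρ)) (lifted (M ∙ y ◂ ρ))
      unseparated⇒similar with lift-∙ M x
      ... | j , j≤M , e = scaled-similar e (same-floor j≤M e) j≤M

  record CommonInvariant (V : ℕ) {k} (Δ : Vec Formula k) : Set where
    field
      N M : ℕ
      M≢0 : ℕ.NonZero M
      invariant : ∀ l {ρ ρ'} → Similar (suc V) N M (lifted ρ) (lifted ρ') → ⟦ Vec.lookup Δ l ⟧ ρ → ⟦ Vec.lookup Δ l ⟧ ρ'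

  varsAll : ∀ {k} → Vec Formula k → ℕ
  varsAll [] = 0
  varsAll (φ ∷ Δ) = vars φ ℕ.⊔ varsAll Δ

  commonInvariant : ∀ V {k} (Δ : Vec Formula k) → varsAll Δ ℕ.≤ V → CommonInvariant V Δ
  commonInvariant V [] _ = record { N = 0 ; M = 1 ; M≢0 = _ ; invariant = λ () }
  commonInvariant V (φ ∷ Δ) le = record
    { M≢0 = ℕ.m*n≢0 I.M J.M {{I.M≢0}} {{J.M≢0}}
    ; invariant = λ { zero sim → I.invariant (similar-mono (ℕ.m≤m+n I.N J.N) (m∣m*n J.M) sim)
                    ; (suc l) sim → J.invariant l (similar-mono (ℕ.m≤n+m J.N I.N) (divides I.M refl) sim) } }
    where
    le' = m⊔n≤o⇒m≤o×n≤o (vars φ) (varsAll Δ) le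
    module I = Invariant (formula-invariant V φ (proj₁ le'))
    module J = CommonInvariant (commonInvariant V Δ (proj₂ le'))

  module _ (m k : ℕ) (Δ : Vec Formula (suc k)) where
    private
      V = varsAll Δ
      -- One variable more than occurs, so that the point has a coordinate even if `Δ` mentions no
      -- variable.
      module C = CommonInvariant (commonInvariant (suc V) Δ (ℕ.n≤1+n V))

      instance
        M≢0 : ℕ.NonZero C.M
        M≢0 = C.M≢0

    open Scaled Δ C.M

    constant-on-atoms : ∀ ρ l {x y} →
      (∀ {i} → i ∈ indices V C.N C.M → Segment V C.N C.M ρ i x ⇔ Segment V C.N C.M ρ i y) → Φ l x ρ → Φ l y ρ
    constant-on-atoms ρ l unseparated = C.invariant l
      (similar-mono (ℕ.n≤1+n C.N) ℕ.∣-refl (unseparated⇒similar V C.N C.M {ρ} unseparated))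

    udtfs : UDTFS m (suc k) Δ 1
    udtfs = udtfs-from-segments {Δ = Δ} {C.M} m (divide C.M) (indices V C.N C.M) (Segment V C.N C.M)
      (segment-initial V C.N C.M) constant-on-atoms

-- Index one as divisibility, and the trivial group

vec-trivial : ∀ {A : Set} {z : A} → (∀ a → a ≡ z) → ∀ {n} (b b' : Vec A n) → b ≡ b'
vec-trivial trivial [] [] = refl
vec-trivial trivial (x ∷ b) (y ∷ b') = cong₂ _∷_ (trans (trivial x) (sym (trivial y))) (vec-trivial trivial b b')

-- The single representative need not be `𝟘`; subtracting the decomposition of `𝟘` cancels it.
index-1⇒divisible : ∀ G p → QuotientSize G p 1 → ∀ a → ∃ λ c → a ≡ _·_ G p c
index-1⇒divisible G p (f , cover , _) a with cover a | cover (OrientedAbelianGroup.𝟘 G)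
... | zero , c , a≡ | zero , c₀ , 𝟘≡ = c ⊕ ⊖ c₀ , (begin
    a                                 ≡⟨ a≡ ⟩
    f zero ⊕ p ∙ c                    ≡⟨ cong (λ z → f zero ⊕ p ∙ z) (L.solve (c ∷ c₀ ∷ []) L.v0 ((L.v0 L.⊟ L.v1) L.⊞ L.v1) refl) ⟩
    f zero ⊕ p ∙ (d ⊕ c₀)             ≡⟨ cong (f zero ⊕_) (∙-⊕ p d c₀) ⟩
    f zero ⊕ (p ∙ d ⊕ p ∙ c₀)         ≡⟨ L.solve (f zero ∷ p ∙ d ∷ p ∙ c₀ ∷ []) (L.v0 L.⊞ (L.v1 L.⊞ L.v2)) ((L.v0 L.⊞ L.v2) L.⊞ L.v1) refl ⟩
    (f zero ⊕ p ∙ c₀) ⊕ p ∙ d         ≡⟨ cong (_⊕ p ∙ d) (sym 𝟘≡) ⟩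
    𝟘 ⊕ p ∙ d                         ≡⟨ ⊕-identityˡ _ ⟩
    p ∙ d                             ∎)
  where
  open OrientedAbelianGroup G
  open ≡-Reasoning
  infixr 7 _∙_
  _∙_ = _·_ G
  d = c ⊕ ⊖ c₀
  module L = LinearForms (orientedGroup⇒abelianGroup G)
  ∙-⊕ : ∀ n x y → n ∙ (x ⊕ y) ≡ n ∙ x ⊕ n ∙ y
  ∙-⊕ zero x y = sym (⊕-identityˡ 𝟘)
  ∙-⊕ (suc n) x y = trans (cong ((x ⊕ y) ⊕_) (∙-⊕ n x y))
    (L.solve (x ∷ y ∷ n ∙ x ∷ n ∙ y ∷ []) ((L.v0 L.⊞ L.v1) L.⊞ (L.v2 L.⊞ L.v3)) ((L.v0 L.⊞ L.v2) L.⊞ (L.v1 L.⊞ L.v3)) refl)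

theorem3p4 : ExcludedMiddle 0ℓ →
    (e : Seq) → e ≡ vec0 ⊎ e ≡ vec∞ → VCProperty vec0 e 1
theorem3p4 em e _ G (regularlyDense , _) m zero Δ =
  1 , (λ _ _ → ⊥ᶠ) , λ B (b , _ , b∈ , _) a → (λ _ → b) , (λ _ → b∈) , zero , λ ()
theorem3p4 em e _ G (regularlyDense , indices) m (suc k) Δ with em {∃ λ a → a ≢ OrientedAbelianGroup.𝟘 G}
... | yes nontrivial = Atoms.udtfs G em (CoverConstruction.universalCover G em) regularlyDense
        (λ p pr → index-1⇒divisible G p (proj₁ (indices p pr))) nontrivial m k Δ
-- Over the trivial group all parameter tuples coincide, so no admissible `B` exists.
... | no none = 1 , (λ _ _ → ⊥ᶠ) , λ B (b , b' , _ , _ , b≢b') _ →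
        contradiction (vec-trivial (λ a → em⇒dne em λ a≢𝟘 → none (a , a≢𝟘)) b b') b≢b'
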